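{- There is an absolute constant $K>0$ such that for every prime power $q$, every set $\mathcal{C}$ of irreducible conics in $\mathbb{F}_q^2$ and every set $\mathcal{P}$ of points in $\mathbb{F}_q^2$, $$I(\mathcal{P},\mathcal{C})\le K\left(\frac{|\mathcal{P}||\mathcal{C}|}{q}+q^{1/5}|\mathcal{P}|^{4/5}|\mathcal{C}|^{4/5}+|\mathcal{C}|\right).$$
   Context: $\mathbb{F}_q$ is the finite field with $q$ elements. An irreducible conic in $\mathbb{F}_q^2$ is a curve given by $g(x,y)=0$, where $g\in\mathbb{F}_q[x,y]$ is an irreducible polynomial of degree $2$ (two polynomials differing by a nonzero scalar factor give the same conic). The number of incidences is $I(\mathcal{P},\mathcal{C}) := |\{(\boldsymbol{p},C)\in \mathcal{P}\times\mathcal{C} : \boldsymbol{p}\in C\}|$. -}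

module Defs where

open import Level using (0ℓ; _⊔_)
open import Algebra.Apartness.Bundles using (HeytingField)
open import Algebra.Bundles using (CommutativeRing; RawSemiring)
import Algebra.Apartness.Properties.HeytingCommutativeRing as HeytingProperties
import Algebra.Definitions.RawSemiring as RawSemiringDefinitions
import Algebra.Properties.Semiring.Exp as Exp
import Algebra.Properties.Semiring.Sum as Sum
open import Data.Fin.Base using (Fin; toℕ)
import Data.Fin.Properties as Fin
open import Data.Integer.Base using (+_)
open import Data.List.Base using (List; length; filter; cartesianProduct)
import Data.List.Relation.Unary.Unique.Setoid as UniqueSetoid
open import Data.Nat.Base as ℕ using (ℕ; _∸_)
import Data.Nat.Properties as ℕ
open import Data.Nat.Primality using (Prime)
open import Data.Product.Base using (_×_; _,_; proj₁; proj₂; ∃-syntax)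
open import Data.Product.Relation.Binary.Pointwise.NonDependent using (×-setoid)
open import Data.Rational.Base as ℚ using (ℚ; 0ℚ; _/_)
open import Function.Bundles using (Inverse)
open import Function.Properties.Inverse using (Inverse⇒Injection)
open import Relation.Binary.Bundles using (Setoid)
open import Relation.Binary.Definitions using (Decidable)
open import Relation.Binary.PropositionalEquality as ≡ using (_≡_)
import Relation.Binary.Reasoning.Setoid as SetoidReasoning
open import Relation.Nullary using (¬_; Dec; yes; no)
open import Relation.Nullary.Decidable using (via-injection)

IsPrimePower : ℕ → Set
IsPrimePower q = ∃[ p ] ∃[ k ] (Prime p × 1 ℕ.≤ k × q ≡ p ℕ.^ k)

-- Duplicate-free lists, "duplicate" being understood up to the setoid equality.
record FiniteSubset {a ℓ} (S : Setoid a ℓ) : Set (a ⊔ ℓ) where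
  open Setoid S using (Carrier)
  open UniqueSetoid S using (Unique)
  field
    elements : List Carrier
    unique   : Unique elements

∣_∣ : ∀ {a ℓ} {S : Setoid a ℓ} → FiniteSubset S → ℕ
∣ A ∣ = length (FiniteSubset.elements A)

-- Any field with q elements. The library's fields carry an apartness _#_; on a
-- finite field it is necessarily the negation of _≈_.
record FiniteField (q : ℕ) : Set₁ where
  field
    heytingField : HeytingField 0ℓ 0ℓ 0ℓ

  open HeytingField heytingField public

  commutativeRing : CommutativeRing 0ℓ 0ℓ
  commutativeRing = record { isCommutativeRing = isCommutativeRing }

  field
    enumeration : Inverse setoid (≡.setoid (Fin q))

  _≟_ : Decidable _≈_
  _≟_ = via-injection (Inverse⇒Injection enumeration) Fin._≟_

module BivariatePolynomial {c ℓ} (R : CommutativeRing c ℓ) where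

  open CommutativeRing R
  open Sum semiring using (sum⁺-syntax; sum-cong-≋; sum-replicate-zero)
  open Exp semiring using (_^_)

  -- coeff i j is the coefficient of x^i y^j; bound is any upper bound for the
  -- total degree and is ignored by equality.
  record Polynomial : Set (c ⊔ ℓ) where
    field
      coeff    : ℕ → ℕ → Carrier
      bound    : ℕ
      vanishes : ∀ i j → bound ℕ.< i ℕ.+ j → coeff i j ≈ 0#

  open Polynomial

  infix 4 _≈ᴾ_
  _≈ᴾ_ : Polynomial → Polynomial → Set ℓ
  f ≈ᴾ g = ∀ i j → coeff f i j ≈ coeff g i j

  constant : Carrier → Polynomial
  constant a = record { coeff = co ; bound = 0 ; vanishes = va }
    where
    co : ℕ → ℕ → Carrier
    co ℕ.zero    ℕ.zero    = a
    co ℕ.zero    (ℕ.suc _) = 0#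
    co (ℕ.suc _) _         = 0#

    va : ∀ i j → 0 ℕ.< i ℕ.+ j → co i j ≈ 0#
    va ℕ.zero    (ℕ.suc _) _ = refl
    va (ℕ.suc _) _         _ = refl

  infixl 6 _+ᴾ_
  _+ᴾ_ : Polynomial → Polynomial → Polynomial
  f +ᴾ g = record
    { coeff    = λ i j → coeff f i j + coeff g i j
    ; bound    = bound f ℕ.⊔ bound g
    ; vanishes = λ i j h → trans
        (+-cong (vanishes f i j (ℕ.≤-<-trans (ℕ.m≤m⊔n _ _) h))
                (vanishes g i j (ℕ.≤-<-trans (ℕ.m≤n⊔m _ _) h)))
        (+-identityˡ 0#)
    }

  private
    sum-zero : ∀ n (t : Fin n → Carrier) → (∀ k → t k ≈ 0#) → Sum.sum semiring t ≈ 0#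
    sum-zero n t t≈0 = trans (sum-cong-≋ t≈0) (sum-replicate-zero n)

    regroup : ∀ {i j k l} → k ℕ.≤ i → l ℕ.≤ j →
              (k ℕ.+ l) ℕ.+ ((i ∸ k) ℕ.+ (j ∸ l)) ≡ i ℕ.+ j
    regroup {i} {j} {k} {l} k≤i l≤j = begin
      (k ℕ.+ l) ℕ.+ ((i ∸ k) ℕ.+ (j ∸ l)) ≡⟨ ℕ.+-assoc k l _ ⟩
      k ℕ.+ (l ℕ.+ ((i ∸ k) ℕ.+ (j ∸ l))) ≡⟨ ≡.cong (k ℕ.+_) (ℕ.+-assoc l (i ∸ k) (j ∸ l)) ⟨
      k ℕ.+ ((l ℕ.+ (i ∸ k)) ℕ.+ (j ∸ l)) ≡⟨ ≡.cong (λ z → k ℕ.+ (z ℕ.+ (j ∸ l))) (ℕ.+-comm l (i ∸ k)) ⟩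
      k ℕ.+ (((i ∸ k) ℕ.+ l) ℕ.+ (j ∸ l)) ≡⟨ ≡.cong (k ℕ.+_) (ℕ.+-assoc (i ∸ k) l (j ∸ l)) ⟩
      k ℕ.+ ((i ∸ k) ℕ.+ (l ℕ.+ (j ∸ l))) ≡⟨ ℕ.+-assoc k (i ∸ k) _ ⟨
      (k ℕ.+ (i ∸ k)) ℕ.+ (l ℕ.+ (j ∸ l)) ≡⟨ ≡.cong₂ ℕ._+_ (ℕ.m+[n∸m]≡n k≤i) (ℕ.m+[n∸m]≡n l≤j) ⟩
      i ℕ.+ j ∎
      where open ≡.≡-Reasoning

  infixl 7 _*ᴾ_
  _*ᴾ_ : Polynomial → Polynomial → Polynomial
  f *ᴾ g = record
    { coeff    = λ i j → ∑[ k ≤ i ] ∑[ l ≤ j ] term i j (toℕ k) (toℕ l)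
    ; bound    = bound f ℕ.+ bound g
    ; vanishes = λ i j h →
        sum-zero (ℕ.suc i) _ λ k → sum-zero (ℕ.suc j) _ λ l →
          term≈0 i j (toℕ k) (toℕ l) (Fin.toℕ≤pred[n] k) (Fin.toℕ≤pred[n] l) h
    }
    where
    term : ℕ → ℕ → ℕ → ℕ → Carrier
    term i j k l = coeff f k l * coeff g (i ∸ k) (j ∸ l)

    term≈0 : ∀ i j k l → k ℕ.≤ i → l ℕ.≤ j →
             bound f ℕ.+ bound g ℕ.< i ℕ.+ j → term i j k l ≈ 0#
    term≈0 i j k l k≤i l≤j h with bound f ℕ.<? k ℕ.+ l
    ... | yes p = trans (*-congʳ (vanishes f k l p)) (zeroˡ _)
    ... | no ¬p = trans (*-congˡ (vanishes g (i ∸ k) (j ∸ l) (ℕ.≰⇒> λ r →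
      ℕ.<⇒≱ h (≡.subst (ℕ._≤ bound f ℕ.+ bound g) (regroup k≤i l≤j)
        (ℕ.+-mono-≤ (ℕ.≮⇒≥ ¬p) r))))) (zeroʳ _)

  rawSemiring : RawSemiring (c ⊔ ℓ) ℓ
  rawSemiring = record
    { Carrier = Polynomial
    ; _≈_     = _≈ᴾ_
    ; _+_     = _+ᴾ_
    ; _*_     = _*ᴾ_
    ; 0#      = constant 0#
    ; 1#      = constant 1#
    }

  open RawSemiringDefinitions rawSemiring public using (Irreducible)

  HasDegree : ℕ → Polynomial → Set ℓ
  HasDegree d f =
    (∀ i j → d ℕ.< i ℕ.+ j → coeff f i j ≈ 0#) ×
    (∃[ i ] ∃[ j ] (i ℕ.+ j ≡ d × ¬ coeff f i j ≈ 0#))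

  eval : Polynomial → Carrier × Carrier → Carrier
  eval f (x , y) =
    ∑[ i ≤ bound f ] ∑[ j ≤ bound f ] (coeff f (toℕ i) (toℕ j) * (x ^ toℕ i * y ^ toℕ j))

module Plane {q : ℕ} (F : FiniteField q) where

  open FiniteField F
  open BivariatePolynomial commutativeRing public
  open HeytingProperties heytingCommutativeRing using (1#0; x-0≈x; x#0y#0→xy#0)
  open Polynomial

  pointSetoid : Setoid 0ℓ 0ℓ
  pointSetoid = ×-setoid setoid setoid

  Point : Set
  Point = Setoid.Carrier pointSetoid

  record IrreducibleConic : Set where
    field
      polynomial  : Polynomial
      degree      : HasDegree 2 polynomial
      irreducible : Irreducible polynomial

  open IrreducibleConic

  -- Conics are compared by their equations up to a nonzero scalar, not by
  -- their sets of F-points: distinct conics may have the same F-points.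
  infix 4 _≈ᶜ_
  _≈ᶜ_ : IrreducibleConic → IrreducibleConic → Set
  C ≈ᶜ D = ∃[ a ] (a # 0# ×
    (∀ i j → coeff (polynomial C) i j ≈ a * coeff (polynomial D) i j))

  private
    ≈ᶜ-sym : ∀ {C D} → C ≈ᶜ D → D ≈ᶜ C
    ≈ᶜ-sym {C} {D} (a , a#0 , C≈aD) with #⇒invertible a#0
    ... | b , ba′≈1 , a′b≈1 =
      b , invertible⇒# (a , ab′≈1 , b′a≈1) , λ i j → sym (begin
        b * coeff (polynomial C) i j       ≈⟨ *-congˡ (C≈aD i j) ⟩
        b * (a * coeff (polynomial D) i j) ≈⟨ *-assoc b a _ ⟨
        b * a * coeff (polynomial D) i j   ≈⟨ *-congʳ ba≈1 ⟩
        1# * coeff (polynomial D) i j      ≈⟨ *-identityˡ _ ⟩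
        coeff (polynomial D) i j           ∎)
      where
      open SetoidReasoning setoid
      ba≈1 : b * a ≈ 1#
      ba≈1 = trans (*-congˡ (sym (x-0≈x a))) ba′≈1
      ab′≈1 : a * (b - 0#) ≈ 1#
      ab′≈1 = trans (*-congˡ (x-0≈x b)) (trans (*-comm a b) ba≈1)
      b′a≈1 : (b - 0#) * a ≈ 1#
      b′a≈1 = trans (*-congʳ (x-0≈x b)) ba≈1

  conicSetoid : Setoid 0ℓ 0ℓ
  conicSetoid = record
    { Carrier       = IrreducibleConic
    ; _≈_           = _≈ᶜ_
    ; isEquivalence = record
      { refl  = 1# , 1#0 , λ i j → sym (*-identityˡ _)
      ; sym   = λ {C} {D} → ≈ᶜ-sym {C} {D}
      ; trans = λ { (a , a#0 , C≈aD) (b , b#0 , D≈bE) →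
          a * b , x#0y#0→xy#0 a#0 b#0 , λ i j →
            trans (C≈aD i j) (trans (*-congˡ (D≈bE i j)) (sym (*-assoc a b _))) }
      }
    }

  infix 4 _∈ᶜ_ _∈ᶜ?_
  _∈ᶜ_ : Point → IrreducibleConic → Set
  p ∈ᶜ C = eval (polynomial C) p ≈ 0#

  _∈ᶜ?_ : ∀ p C → Dec (p ∈ᶜ C)
  p ∈ᶜ? C = eval (polynomial C) p ≟ 0#

  I : FiniteSubset pointSetoid → FiniteSubset conicSetoid → ℕ
  I 𝓟 𝓒 = length (filter (λ pC → proj₁ pC ∈ᶜ? proj₂ pC)
                         (cartesianProduct (elements 𝓟) (elements 𝓒)))
    where open FiniteSubset

fromℕ : ℕ → ℚ
fromℕ n = + n / 1

-- n ^⟨ a / b ⟩≤ r says that the rational r is at least the real number n^(a/b).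
-- A real number is the infimum of the rationals above it, so, multiplication and
-- addition of nonnegative reals being continuous and monotone, an upper bound by
-- an expression in such powers holds iff it holds for all rationals above them.
infix 4 _^⟨_/_⟩≤_
_^⟨_/_⟩≤_ : (n a b : ℕ) .{{_ : ℕ.NonZero b}} → ℚ → Set
n ^⟨ a / b ⟩≤ r = 0ℚ ℚ.≤ r × fromℕ (n ℕ.^ a) ℚ.≤ r ^ b
  where open RawSemiringDefinitions ℚ.+-*-rawSemiring using (_^_)

module Submission where

-- For a triple t of distinct points let 𝓒ₜ consist of the conics of 𝓒 through t. Five
-- points determine an irreducible conic, so two members of 𝓒ₜ share at most one point
-- outside t, while each of them has q + O(1) points in the plane (project from a point
-- of t). Hence the number of members of 𝓒ₜ through a random point of the plane has mean
-- about |𝓒ₜ|/q and small variance, and by Cauchy–Schwarz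
--   I(𝓟, 𝓒ₜ) ≤ |𝓟||𝓒ₜ|/q + O(√(q |𝓟| |𝓒ₜ|)) + lower order terms.
-- Conics C with d_C ≤ 4|𝓟|/q + 18 points of 𝓟 account for the terms |𝓟||𝓒|/q and |𝓒| of
-- the theorem. On the others the main term is negligible, so (Σ_{C ∈ 𝓒ₜ} d_C)² ≤ 8 q |𝓟| |𝓒ₜ|;
-- Cauchy–Schwarz over all t gives (Σ d_C⁴)² ≲ q |𝓟|⁴ Σ d_C³, and Chebyshev's sum
-- inequality turns this into (Σ d_C)⁵ ≤ 32 q |𝓟|⁴ |𝓒|⁴.

open import Algebra.Bundles using (CommutativeRing; RawRing)
import Algebra.Apartness.Properties.HeytingCommutativeRing as HeytingProperties
import Algebra.Definitions.RawMagma as RawMagmaDefinitions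
import Algebra.Definitions.RawSemiring as RawSemiringDefinitions
import Algebra.Properties.AbelianGroup as AbelianGroupProperties
import Algebra.Properties.CommutativeSemiring.Exp as CommutativeExp
import Algebra.Properties.Ring as RingProperties
import Algebra.Properties.Semiring.Exp as Exp
import Algebra.Properties.Semiring.Mult as Mult
import Algebra.Properties.Semiring.Sum as Sum
import Algebra.Solver.Ring as RingSolver
open import Algebra.Solver.Ring.AlmostCommutativeRing using (fromCommutativeRing; _-Raw-AlmostCommutative⟶_)
open import Data.Empty using (⊥; ⊥-elim)
open import Data.Fin.Base using (Fin; toℕ; zero; suc)
import Data.Fin.Properties as Fin
import Data.Integer.Base as ℤ
import Data.Integer.Properties as ℤ
open import Data.List.Base using (List; []; _∷_; _++_; map; length; filter; cartesianProduct; allFin)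
import Data.List.Membership.Propositional as Membership
open import Data.List.Membership.Propositional.Properties
  using (∈-∃++; ∈-++⁻; ∈-++⁺ˡ; ∈-++⁺ʳ; ∈-filter⁺; ∈-filter⁻; ∈-allFin; ∈-cartesianProduct⁺)
open import Data.List.Properties using (map-++; length-filter; length-map; length-tabulate)
open import Data.List.Relation.Unary.All as All using (All; []; _∷_)
import Data.List.Relation.Unary.All.Properties as All
open import Data.List.Relation.Unary.AllPairs using (AllPairs; []; _∷_)
import Data.List.Relation.Unary.AllPairs.Properties as AllPairs
open import Data.List.Relation.Unary.Any using (here; there)
open import Data.List.Relation.Unary.Unique.Propositional using (Unique)
import Data.List.Relation.Unary.Unique.Propositional.Properties as Unique
import Data.List.Relation.Unary.Unique.Setoid.Properties as UniqueSetoid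
open import Data.Maybe.Base using (just; nothing)
open import Data.Nat.Base as ℕ using (ℕ; zero; suc; _∸_; z≤n; s≤s)
import Data.Nat.Properties as ℕ
open import Data.Nat.Tactic.RingSolver using (solve-∀)
open import Data.Product.Base using (_×_; _,_; ∃-syntax; proj₁; proj₂)
open import Data.Product.Properties using (≡-dec)
open import Data.Rational.Base as ℚ using (ℚ; 0ℚ; toℚᵘ; positive; nonNegative)
import Data.Rational.Properties as ℚ
open import Data.Rational.Unnormalised.Base as ℚᵘ using (mkℚᵘ; *≡*; *≤*; *<*)
import Data.Rational.Unnormalised.Properties as ℚᵘ
open import Data.Sign.Base as Sign using (Sign)
open import Data.Sum.Base using (inj₁; inj₂)
open import Function.Base using (_∘_)
open import Function.Bundles using (Inverse)
open import Relation.Binary.Bundles using (Setoid)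
open import Relation.Binary.Definitions using (DecidableEquality; WeaklyDecidable)
open import Relation.Binary.PropositionalEquality as ≡ using (_≡_; _≢_)
import Relation.Binary.Reasoning.Setoid as SetoidReasoning
open import Relation.Nullary using (¬_; Dec; yes; no; contradiction)
open import Relation.Nullary.Decidable using (_×-dec_; ¬?)
open import Relation.Unary using (Decidable)

open import Defs

-- Why triples: with three points fixed, two members of 𝓒ₜ share at most 1 further point of the q²
-- points of the plane, which is what two independent sets of density 1/q would share. In the
-- variance the pairs C ≠ D therefore cancel against the squared mean, and only the diagonal, of
-- order q |𝓒ₜ|, is left. With no point fixed, two conics may meet in four points and a term of
-- order |𝓒|² would survive. Why the poor conics are set aside beforehand: the main term |𝓟||𝓒ₜ|/q
-- can then be absorbed conic by conic, before any summation over t brings in the weights d_C³.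
-- Irreducibility is over the field itself and not over its closure, so a conic may be a pair of
-- conjugate lines with one rational point or none. It enters only as the absence of a line in the
-- conic. Characteristic two is included, so no square is completed: tangents are read off from the
-- linear part after a translation. The counting stays in natural numbers: deviations from the mean
-- are multiplied by q, and fifth roots are replaced by a comparison of fifth powers.

-- Polynomial identities with integer coefficients in a commutative ring.

module IntegerSolver {c ℓ} (R : CommutativeRing c ℓ) where
  open import Data.Integer.Base using (ℤ; +_; -[1+_]; _⊖_; _◃_; sign)
  open CommutativeRing R
  open RingProperties ring using (-0#≈0#; -‿distribˡ-*; -‿distribʳ-*; -‿involutive)
  open AbelianGroupProperties +-abelianGroup using (⁻¹-∙-comm)
  open Mult semiring using (×-homo-+; ×1-homo-*) renaming (_×_ to _·_)
  open SetoidReasoning setoid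

  private
    fromℤ : ℤ → Carrier
    fromℤ (+ n)    = n · 1#
    fromℤ -[1+ n ] = - (suc n · 1#)

    signed : Sign → Carrier → Carrier
    signed Sign.+ x = x
    signed Sign.- x = - x

    fromℤ-◃ : ∀ s n → fromℤ (s ◃ n) ≈ signed s (n · 1#)
    fromℤ-◃ Sign.+ zero    = refl
    fromℤ-◃ Sign.- zero    = sym -0#≈0#
    fromℤ-◃ Sign.+ (suc n) = refl
    fromℤ-◃ Sign.- (suc n) = refl

    fromℤ-signed : ∀ i → fromℤ i ≈ signed (sign i) (ℤ.∣ i ∣ · 1#)
    fromℤ-signed (+ n)    = refl
    fromℤ-signed -[1+ n ] = refl

    signed-cong : ∀ s {x y} → x ≈ y → signed s x ≈ signed s y
    signed-cong Sign.+ h = h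
    signed-cong Sign.- h = -‿cong h

    signed-* : ∀ s t x y → signed (s Sign.* t) (x * y) ≈ signed s x * signed t y
    signed-* Sign.+ Sign.+ x y = refl
    signed-* Sign.+ Sign.- x y = -‿distribʳ-* x y
    signed-* Sign.- Sign.+ x y = -‿distribˡ-* x y
    signed-* Sign.- Sign.- x y = begin
      x * y         ≈⟨ -‿involutive _ ⟨
      - - (x * y)   ≈⟨ -‿cong (-‿distribʳ-* x y) ⟩
      - (x * - y)   ≈⟨ -‿distribˡ-* x (- y) ⟩
      - x * - y     ∎

    *-homo : ∀ i j → fromℤ (i ℤ.* j) ≈ fromℤ i * fromℤ j
    *-homo i j = begin
      fromℤ (i ℤ.* j)                                          ≈⟨ fromℤ-◃ (sign i Sign.* sign j) (ℤ.∣ i ∣ ℕ.* ℤ.∣ j ∣) ⟩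
      signed (sign i Sign.* sign j) ((ℤ.∣ i ∣ ℕ.* ℤ.∣ j ∣) · 1#)   ≈⟨ signed-cong (sign i Sign.* sign j) (×1-homo-* ℤ.∣ i ∣ ℤ.∣ j ∣) ⟩
      signed (sign i Sign.* sign j) (ℤ.∣ i ∣ · 1# * (ℤ.∣ j ∣ · 1#)) ≈⟨ signed-* (sign i) (sign j) _ _ ⟩
      signed (sign i) (ℤ.∣ i ∣ · 1#) * signed (sign j) (ℤ.∣ j ∣ · 1#) ≈⟨ *-cong (fromℤ-signed i) (fromℤ-signed j) ⟨
      fromℤ i * fromℤ j ∎

    cancel : ∀ x y z → x + y - (x + z) ≈ y - z
    cancel x y z = begin
      x + y - (x + z)     ≈⟨ +-cong (+-comm y x) (⁻¹-∙-comm x z) ⟨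
      y + x + (- x - z)   ≈⟨ +-assoc y x _ ⟩
      y + (x + (- x - z)) ≈⟨ +-congˡ (+-assoc x (- x) (- z)) ⟨
      y + (x - x - z)     ≈⟨ +-congˡ (+-congʳ (-‿inverseʳ x)) ⟩
      y + (0# - z)        ≈⟨ +-congˡ (+-identityˡ (- z)) ⟩
      y - z               ∎

    ⊖-homo : ∀ m n → fromℤ (m ⊖ n) ≈ m · 1# - n · 1#
    ⊖-homo zero    zero    = sym (-‿inverseʳ 0#)
    ⊖-homo (suc m) zero    = sym (trans (+-congˡ -0#≈0#) (+-identityʳ _))
    ⊖-homo zero    (suc n) = sym (+-identityˡ _)
    ⊖-homo (suc m) (suc n) = begin
      fromℤ (suc m ⊖ suc n)             ≡⟨ ≡.cong fromℤ (ℤ.[1+m]⊖[1+n]≡m⊖n m n) ⟩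
      fromℤ (m ⊖ n)                     ≈⟨ ⊖-homo m n ⟩
      m · 1# - n · 1#                   ≈⟨ cancel 1# _ _ ⟨
      suc m · 1# - suc n · 1#           ∎

    +-homo : ∀ i j → fromℤ (i ℤ.+ j) ≈ fromℤ i + fromℤ j
    +-homo (+ m)    (+ n)    = ×-homo-+ 1# m n
    +-homo (+ m)    -[1+ n ] = ⊖-homo m (suc n)
    +-homo -[1+ m ] (+ n)    = trans (⊖-homo n (suc m)) (+-comm _ _)
    +-homo -[1+ m ] -[1+ n ] = begin
      - (suc (suc (m ℕ.+ n)) · 1#)      ≡⟨ ≡.cong (λ k → - (k · 1#)) (≡.cong suc (≡.sym (ℕ.+-suc m n))) ⟩
      - ((suc m ℕ.+ suc n) · 1#)        ≈⟨ -‿cong (×-homo-+ 1# (suc m) (suc n)) ⟩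
      - (suc m · 1# + suc n · 1#)       ≈⟨ ⁻¹-∙-comm _ _ ⟨
      - (suc m · 1#) - suc n · 1#       ∎

    -‿homo : ∀ i → fromℤ (ℤ.- i) ≈ - fromℤ i
    -‿homo (+ zero)    = sym -0#≈0#
    -‿homo (+ (suc n)) = refl
    -‿homo -[1+ n ]    = sym (-‿involutive _)

    ℤ-rawRing : RawRing _ _
    ℤ-rawRing = record
      { Carrier = ℤ ; _≈_ = _≡_ ; _+_ = ℤ._+_ ; _*_ = ℤ._*_ ; -_ = ℤ.-_ ; 0# = ℤ.0ℤ ; 1# = ℤ.1ℤ }

    -- The integer 1 is sent to `1# + 0#`, which is `1#` only up to `_≈_`, whereas 0 is sent to `0#`
    -- itself. Hence the identities below treat `1#` as one more variable, usually called `o`, but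
    -- use `con ℤ.0ℤ` for zero.
    morphism : ℤ-rawRing -Raw-AlmostCommutative⟶ fromCommutativeRing R
    morphism = record
      { ⟦_⟧    = fromℤ
      ; +-homo = +-homo
      ; *-homo = *-homo
      ; -‿homo = -‿homo
      ; 0-homo = refl
      ; 1-homo = +-identityʳ 1#
      }

    _ℤ≟_ : WeaklyDecidable (λ i j → fromℤ i ≈ fromℤ j)
    i ℤ≟ j with i ℤ.≟ j
    ... | yes i≡j = just (reflexive (≡.cong fromℤ i≡j))
    ... | no  _   = nothing

  open RingSolver ℤ-rawRing (fromCommutativeRing R) morphism _ℤ≟_ public

-- Affine quadrics without lines, and their determination by five points.

module Quadrics {q : ℕ} (F : FiniteField q) where
  open FiniteField F
  open CommutativeRing commutativeRing using (ring)
  open HeytingProperties heytingCommutativeRing using (invertibleʳ⇒#; x-0≈x)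
  open RingProperties ring using (-0#≈0#)
  open import Algebra.Properties.AbelianGroup (CommutativeRing.+-abelianGroup commutativeRing) using (x∙y⁻¹≈ε⇒x≈y)
  open IntegerSolver commutativeRing using (solve; _:=_; _:+_; _:*_; _:-_; :-_; Polynomial)

  open SetoidReasoning setoid

  infix 4 _≉_
  _≉_ : Carrier → Carrier → Set
  x ≉ y = ¬ x ≈ y

  -- Tightness only refutes ¬ x # 0#, so the inverse itself is found by
  -- searching through the enumeration.
  inverse : ∀ {x} → x ≉ 0# → ∃[ y ] (x * y ≈ 1#)
  inverse {x} x≉0 with Fin.any? (λ i → (x * Inverse.from enumeration i) ≟ 1#)
  ... | yes (i , xy≈1) = Inverse.from enumeration i , xy≈1
  ... | no  noInverse  = contradiction (proj₁ (tight x 0#) λ x#0 → invertible⇒⊥ (#⇒invertible x#0)) x≉0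
    where
    invertible⇒⊥ : ∃[ y ] (y * (x - 0#) ≈ 1# × (x - 0#) * y ≈ 1#) → ⊥
    invertible⇒⊥ (y , _ , xy≈1) = noInverse
      ( Inverse.to enumeration y
      , trans (*-cong (sym (x-0≈x x)) (Inverse.strictlyInverseʳ enumeration y)) xy≈1)

  ≉0⇒# : ∀ {x} → x ≉ 0# → x # 0#
  ≉0⇒# {x} x≉0 with inverse x≉0
  ... | y , xy≈1 = invertibleʳ⇒# (y , trans (*-congʳ (x-0≈x x)) xy≈1)

  x≉0∧xy≈0⇒y≈0 : ∀ {x y} → x ≉ 0# → x * y ≈ 0# → y ≈ 0#
  x≉0∧xy≈0⇒y≈0 {x} {y} x≉0 xy≈0 with inverse x≉0
  ... | z , xz≈1 = begin
    y           ≈⟨ *-identityˡ y ⟨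
    1# * y      ≈⟨ *-congʳ xz≈1 ⟨
    x * z * y   ≈⟨ solve 3 (λ x y z → x :* z :* y := z :* (x :* y)) refl x y z ⟩
    z * (x * y) ≈⟨ *-congˡ xy≈0 ⟩
    z * 0#      ≈⟨ zeroʳ z ⟩
    0#          ∎

  +≈0 : ∀ {x y} → x ≈ 0# → y ≈ 0# → x + y ≈ 0#
  +≈0 x≈0 y≈0 = trans (+-cong x≈0 y≈0) (+-identityˡ 0#)

  *≈0 : ∀ x {y} → y ≈ 0# → x * y ≈ 0#
  *≈0 x y≈0 = trans (*-congˡ y≈0) (zeroʳ x)

  *ˡ≈0 : ∀ {x} y → x ≈ 0# → x * y ≈ 0#
  *ˡ≈0 y x≈0 = trans (*-congʳ x≈0) (zeroˡ y)

  -≈0 : ∀ {x} → x ≈ 0# → - x ≈ 0#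
  -≈0 x≈0 = trans (-‿cong x≈0) -0#≈0#

  ≈⇒-≈0 : ∀ {x y} → x ≈ y → x - y ≈ 0#
  ≈⇒-≈0 {y = y} x≈y = trans (+-congʳ x≈y) (-‿inverseʳ y)

  -≈0⇒≈ : ∀ {x y} → x - y ≈ 0# → x ≈ y
  -≈0⇒≈ = x∙y⁻¹≈ε⇒x≈y _ _

  record Quadric : Set where
    constructor quadric
    field
      a b c d e f : Carrier
  open Quadric

  form : Quadric → Carrier → Carrier → Carrier
  form κ u v = a κ * (u * u) + b κ * (u * v) + c κ * (v * v)

  linear : Quadric → Carrier → Carrier → Carrier
  linear κ u v = d κ * u + e κ * v

  -- The polarisation form (w + w′) - form w - form w′. Doubled products are written as sums, so the
  -- formula is right in characteristic two as well.
  polar : Quadric → Carrier → Carrier → Carrier → Carrier → Carrier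
  polar κ u v u′ v′ =
    a κ * (u * u′ + u * u′) + b κ * (u * v′ + u′ * v) + c κ * (v * v′ + v * v′)

  value : Quadric → Carrier → Carrier → Carrier
  value κ x y = form κ x y + linear κ x y + f κ

  -- Translation of the origin to (x , y). The new `d` and `e` are the partial derivatives there, so
  -- `linear (recentre κ x y)` is the differential of the quadric at (x , y), and its zeros are the
  -- tangent directions if the point lies on the quadric.
  recentre : Quadric → Carrier → Carrier → Quadric
  recentre κ x y = record κ
    { d = a κ * (x + x) + b κ * y + d κ
    ; e = b κ * x + c κ * (y + y) + e κ
    ; f = value κ x y
    }

  det : Carrier → Carrier → Carrier → Carrier → Carrier
  det u v u′ v′ = u * v′ - u′ * v

  module _ {n : ℕ} where
    private P = Polynomial n

    form′ : P → P → P → P → P → P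
    form′ a b c u v = a :* (u :* u) :+ b :* (u :* v) :+ c :* (v :* v)

    linear′ : P → P → P → P → P
    linear′ d e u v = d :* u :+ e :* v

    polar′ : P → P → P → P → P → P → P → P
    polar′ a b c u v u′ v′ =
      a :* (u :* u′ :+ u :* u′) :+ b :* (u :* v′ :+ u′ :* v) :+ c :* (v :* v′ :+ v :* v′)

    det′ : P → P → P → P → P
    det′ u v u′ v′ = u :* v′ :- u′ :* v

  form-cong : ∀ κ {u v u′ v′} → u ≈ u′ → v ≈ v′ → form κ u v ≈ form κ u′ v′
  form-cong κ p q =
    +-cong (+-cong (*-congˡ (*-cong p p)) (*-congˡ (*-cong p q))) (*-congˡ (*-cong q q))

  linear-cong : ∀ κ {u v u′ v′} → u ≈ u′ → v ≈ v′ → linear κ u v ≈ linear κ u′ v′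
  linear-cong κ p q = +-cong (*-congˡ p) (*-congˡ q)

  value-cong : ∀ κ {u v u′ v′} → u ≈ u′ → v ≈ v′ → value κ u v ≈ value κ u′ v′
  value-cong κ p q = +-congʳ (+-cong (form-cong κ p q) (linear-cong κ p q))

  det-cong : ∀ {u v u′ v′ x y x′ y′} → u ≈ x → v ≈ y → u′ ≈ x′ → v′ ≈ y′ →
             det u v u′ v′ ≈ det x y x′ y′
  det-cong p q r s = +-cong (*-cong p s) (-‿cong (*-cong r q))

  value-recentre : ∀ κ x y u v → value (recentre κ x y) u v ≈ value κ (x + u) (y + v)
  value-recentre κ x y u v = solve 10
    (λ a b c d e f x y u v →
      form′ a b c u v
        :+ linear′ (a :* (x :+ x) :+ b :* y :+ d) (b :* x :+ c :* (y :+ y) :+ e) u v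
        :+ (form′ a b c x y :+ linear′ d e x y :+ f)
      := form′ a b c (x :+ u) (y :+ v) :+ linear′ d e (x :+ u) (y :+ v) :+ f)
    refl (a κ) (b κ) (c κ) (d κ) (e κ) (f κ) x y u v

  -- After recentring at a point of the quadric the constant term is zero, so this expression
  -- vanishes exactly at the displacements to points of the quadric.
  chord : Quadric → Carrier → Carrier → Carrier
  chord κ u v = form κ u v + linear κ u v

  x+[y-x]≈y : ∀ x y → x + (y - x) ≈ y
  x+[y-x]≈y = solve 2 (λ x y → x :+ (y :- x) := y) refl

  chord-recentre : ∀ κ {x y x′ y′} → value κ x y ≈ 0# → value κ x′ y′ ≈ 0# →
                   chord (recentre κ x y) (x′ - x) (y′ - y) ≈ 0#
  chord-recentre κ {x} {y} {x′} {y′} h h′ = begin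
    chord κ₀ u v                ≈⟨ +-identityʳ _ ⟨
    chord κ₀ u v + 0#           ≈⟨ +-congˡ h ⟨
    value κ₀ u v                ≈⟨ value-recentre κ x y u v ⟩
    value κ (x + u) (y + v)     ≈⟨ value-cong κ (x+[y-x]≈y x x′) (x+[y-x]≈y y y′) ⟩
    value κ x′ y′               ≈⟨ h′ ⟩
    0#                          ∎
    where
    u = x′ - x
    v = y′ - y
    κ₀ = recentre κ x y

  form-scale : ∀ κ l u v → form κ (l * u) (l * v) ≈ l * l * form κ u v
  form-scale κ l u v = solve 6
    (λ a b c l u v → form′ a b c (l :* u) (l :* v) := l :* l :* form′ a b c u v)
    refl (a κ) (b κ) (c κ) l u v

  linear-scale : ∀ κ l u v → linear κ (l * u) (l * v) ≈ l * linear κ u v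
  linear-scale κ l u v = solve 5
    (λ d e l u v → linear′ d e (l :* u) (l :* v) := l :* linear′ d e u v)
    refl (d κ) (e κ) l u v

  -- Along the line of (u , v) the chord equation is l² Φ + l Λ. It vanishes at the parameters 1 and
  -- l; subtracting l times the first equation from the second leaves l (l - 1) Φ ≈ 0.
  scaled-chords : ∀ κ {l u v} → l ≉ 0# → l ≉ 1# →
    chord κ u v ≈ 0# → chord κ (l * u) (l * v) ≈ 0# → linear κ u v ≈ 0# × form κ u v ≈ 0#
  scaled-chords κ {l} {u} {v} l≉0 l≉1 h h′ = lin≈0 , form≈0
    where
    Λ = linear κ u v
    Φ = form κ u v

    expand : l * ((l - 1#) * Φ) ≈ chord κ (l * u) (l * v) - l * chord κ u v
    expand = begin
      l * ((l - 1#) * Φ)                          ≈⟨ solve 4 (λ l o Φ Λ → l :* ((l :- o) :* Φ) := l :* l :* Φ :+ l :* Λ :- l :* (o :* Φ :+ Λ)) refl l 1# Φ Λ ⟩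
      l * l * Φ + l * Λ - l * (1# * Φ + Λ)        ≈⟨ +-cong (+-cong (form-scale κ l u v) (linear-scale κ l u v)) (-‿cong (*-congˡ (+-congʳ (sym (*-identityˡ Φ))))) ⟨
      chord κ (l * u) (l * v) - l * chord κ u v   ∎

    form≈0 : Φ ≈ 0#
    form≈0 = x≉0∧xy≈0⇒y≈0 (λ l-1≈0 → l≉1 (-≈0⇒≈ l-1≈0))
      (x≉0∧xy≈0⇒y≈0 l≉0 (trans expand (+≈0 h′ (-≈0 (*≈0 l h)))))

    lin≈0 : Λ ≈ 0#
    lin≈0 = trans (sym (+-identityˡ Λ)) (trans (+-congʳ (sym form≈0)) h)

  proportional : ∀ {u v u′ v′} → ¬ (u ≈ 0# × v ≈ 0#) → det u v u′ v′ ≈ 0# →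
                 ∃[ l ] (u′ ≈ l * u × v′ ≈ l * v)
  proportional {u} {v} {u′} {v′} nonzero det≈0 with u ≟ 0#
  ... | no u≉0 with inverse u≉0
  ...   | w , uw≈1 = u′ * w , scale u′ , (begin
    v′              ≈⟨ scale v′ ⟩
    v′ * w * u      ≈⟨ solve 3 (λ v′ w u → v′ :* w :* u := w :* (u :* v′)) refl v′ w u ⟩
    w * (u * v′)    ≈⟨ *-congˡ (-≈0⇒≈ det≈0) ⟩
    w * (u′ * v)    ≈⟨ solve 3 (λ w u′ v → w :* (u′ :* v) := u′ :* w :* v) refl w u′ v ⟩
    u′ * w * v      ∎)
    where
    scale : ∀ z → z ≈ z * w * u
    scale z = begin
      z           ≈⟨ *-identityʳ z ⟨
      z * 1#      ≈⟨ *-congˡ uw≈1 ⟨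
      z * (u * w) ≈⟨ solve 3 (λ z u w → z :* (u :* w) := z :* w :* u) refl z u w ⟩
      z * w * u   ∎
  proportional {u} {v} {u′} {v′} nonzero det≈0 | yes u≈0 with inverse (λ v≈0 → nonzero (u≈0 , v≈0))
  ...   | w , vw≈1 = v′ * w , (begin
    u′              ≈⟨ scale u′ ⟩
    u′ * w * v      ≈⟨ solve 3 (λ u′ w v → u′ :* w :* v := w :* (u′ :* v)) refl u′ w v ⟩
    w * (u′ * v)    ≈⟨ *-congˡ (-≈0⇒≈ det≈0) ⟨
    w * (u * v′)    ≈⟨ solve 3 (λ w u v′ → w :* (u :* v′) := v′ :* w :* u) refl w u v′ ⟩
    v′ * w * u      ∎) , scale v′
    where
    scale : ∀ z → z ≈ z * w * v
    scale z = begin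
      z           ≈⟨ *-identityʳ z ⟨
      z * 1#      ≈⟨ *-congˡ vw≈1 ⟨
      z * (v * w) ≈⟨ solve 3 (λ z u w → z :* (u :* w) := z :* w :* u) refl z v w ⟩
      z * w * v   ∎

  collinear-chords : ∀ κ {u v u′ v′} → chord κ u v ≈ 0# → chord κ u′ v′ ≈ 0# →
    ¬ (u ≈ 0# × v ≈ 0#) → ¬ (u′ ≈ 0# × v′ ≈ 0#) → ¬ (u ≈ u′ × v ≈ v′) →
    det u v u′ v′ ≈ 0# → linear κ u v ≈ 0# × form κ u v ≈ 0#
  collinear-chords κ {u} {v} h h′ w≉0 w′≉0 w≉w′ det≈0 with proportional w≉0 det≈0
  ... | l , u′≈lu , v′≈lv = scaled-chords κ
    (λ l≈0 → w′≉0 (trans u′≈lu (*ˡ≈0 u l≈0) , trans v′≈lv (*ˡ≈0 v l≈0)))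
    (λ l≈1 → w≉w′ ( sym (trans u′≈lu (trans (*-congʳ l≈1) (*-identityˡ u)))
                  , sym (trans v′≈lv (trans (*-congʳ l≈1) (*-identityˡ v)))))
    h (trans (+-cong (form-cong κ (sym u′≈lu) (sym v′≈lv)) (linear-cong κ (sym u′≈lu) (sym v′≈lv))) h′)

  -- The hypotheses say that value κ vanishes identically on the line through (x , y)
  -- in direction (u , v).
  NoLine : Quadric → Set
  NoLine κ = ∀ x y u v → value κ x y ≈ 0# →
    linear (recentre κ x y) u v ≈ 0# → form κ u v ≈ 0# → u ≈ 0# × v ≈ 0#

  Point : Set
  Point = Carrier × Carrier

  infix 4 _≈ₚ_ _≉ₚ_ _∈_
  _≈ₚ_ _≉ₚ_ : Point → Point → Set
  (x , y) ≈ₚ (x′ , y′) = x ≈ x′ × y ≈ y′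
  P ≉ₚ Q = ¬ P ≈ₚ Q

  _∈_ : Point → Quadric → Set
  (x , y) ∈ κ = value κ x y ≈ 0#

  orientation : Point → Point → Point → Carrier
  orientation (x , y) (x₁ , y₁) (x₂ , y₂) = det (x₁ - x) (y₁ - y) (x₂ - x) (y₂ - y)

  ≉⇒-≉0 : ∀ {x y x′ y′} → (x , y) ≉ₚ (x′ , y′) → ¬ (x′ - x ≈ 0# × y′ - y ≈ 0#)
  ≉⇒-≉0 P≉P′ (p , q) = P≉P′ (sym (-≈0⇒≈ p) , sym (-≈0⇒≈ q))

  -- Seen from P, the points Q and R are two chords on one line with different nonzero parameters,
  -- which forces the quadric to vanish on all of that line.
  no-three-collinear : ∀ {κ} → NoLine κ → ∀ {P Q R} → P ∈ κ → Q ∈ κ → R ∈ κ →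
    P ≉ₚ Q → P ≉ₚ R → Q ≉ₚ R → orientation P Q R ≉ 0#
  no-three-collinear {κ} noLine {x , y} {x₁ , y₁} {x₂ , y₂} P∈κ Q∈κ R∈κ P≉Q P≉R Q≉R or≈0 =
    ≉⇒-≉0 P≉Q (noLine x y _ _ P∈κ (proj₁ vanish) (proj₂ vanish))
    where
    shift : ∀ {z z′ t} → z - t ≈ z′ - t → z ≈ z′
    shift {z} {z′} {t} h = -≈0⇒≈ (trans
      (solve 3 (λ z z′ t → z :- z′ := (z :- t) :- (z′ :- t)) refl z z′ t) (≈⇒-≈0 h))
    vanish = collinear-chords (recentre κ x y) (chord-recentre κ P∈κ Q∈κ) (chord-recentre κ P∈κ R∈κ)
      (≉⇒-≉0 P≉Q) (≉⇒-≉0 P≉R) (λ { (p , q) → Q≉R (shift p , shift q) }) or≈0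

  coordinates : ∀ {u v u′ v′} → det u v u′ v′ ≉ 0# → ∀ x y →
    ∃[ s ] ∃[ t ] (x ≈ s * u + t * u′ × y ≈ s * v + t * v′)
  coordinates {u} {v} {u′} {v′} δ≉0 x y with inverse δ≉0
  ... | w , δw≈1 = w * det x y u′ v′ , w * det u v x y
    , trans (unscale x) (solve 7 (λ u v u′ v′ x y w →
        x :* (det′ u v u′ v′ :* w) := w :* det′ x y u′ v′ :* u :+ w :* det′ u v x y :* u′) refl u v u′ v′ x y w)
    , trans (unscale y) (solve 7 (λ u v u′ v′ x y w →
        y :* (det′ u v u′ v′ :* w) := w :* det′ x y u′ v′ :* v :+ w :* det′ u v x y :* v′) refl u v u′ v′ x y w)
    where
    unscale : ∀ z → z ≈ z * (det u v u′ v′ * w)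
    unscale z = trans (sym (*-identityʳ z)) (*-congˡ (sym δw≈1))

  chord-cong : ∀ κ {u v u′ v′} → u ≈ u′ → v ≈ v′ → chord κ u v ≈ chord κ u′ v′
  chord-cong κ p q = +-cong (form-cong κ p q) (linear-cong κ p q)

  form-combination : ∀ κ u v u′ v′ s r →
    form κ (s * u + r * u′) (s * v + r * v′) ≈
      s * s * form κ u v + s * r * polar κ u v u′ v′ + r * r * form κ u′ v′
  form-combination κ u v u′ v′ s r = solve 9
    (λ a b c u v u′ v′ s r →
      form′ a b c (s :* u :+ r :* u′) (s :* v :+ r :* v′) :=
      s :* s :* form′ a b c u v :+ s :* r :* polar′ a b c u v u′ v′ :+ r :* r :* form′ a b c u′ v′)
    refl (a κ) (b κ) (c κ) u v u′ v′ s r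

  linear-combination : ∀ κ u v u′ v′ s r →
    linear κ (s * u + r * u′) (s * v + r * v′) ≈ s * linear κ u v + r * linear κ u′ v′
  linear-combination κ u v u′ v′ s r = solve 8
    (λ d e u v u′ v′ s r →
      linear′ d e (s :* u :+ r :* u′) (s :* v :+ r :* v′) :=
      s :* linear′ d e u v :+ r :* linear′ d e u′ v′)
    refl (d κ) (e κ) u v u′ v′ s r

  -- The term r² D + r G is regrouped as r (r - 1) D + r (D + G). When the last bracket vanishes,
  -- the quadric appears as the product of the line r = 0 and the line s B + (r - 1) D = 0, with B
  -- the polar value; the second passes through the point (u′ , v′), where s = 0 and r = 1.
  chord-combination : ∀ κ u v u′ v′ s r →
    chord κ (s * u + r * u′) (s * v + r * v′) ≈
      r * (s * polar κ u v u′ v′ + (r - 1#) * form κ u′ v′)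
        + (s * s * form κ u v + s * linear κ u v + r * chord κ u′ v′)
  chord-combination κ u v u′ v′ s r = begin
    chord κ (s * u + r * u′) (s * v + r * v′)
      ≈⟨ +-cong (form-combination κ u v u′ v′ s r) (linear-combination κ u v u′ v′ s r) ⟩
    (s * s * A + s * r * B + r * r * D) + (s * E + r * G)
      ≈⟨ solve 7 (λ s r A B D E G →
           (s :* s :* A :+ s :* r :* B :+ r :* r :* D) :+ (s :* E :+ r :* G) :=
           r :* (s :* B :+ (r :* D :- D)) :+ (s :* s :* A :+ s :* E :+ r :* (D :+ G)))
           refl s r A B D E G ⟩
    r * (s * B + (r * D - D)) + (s * s * A + s * E + r * (D + G))
      ≈⟨ +-congʳ (*-congˡ (+-congˡ rD-D)) ⟩
    r * (s * B + (r - 1#) * D) + (s * s * A + s * E + r * (D + G)) ∎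
    where
    A = form κ u v
    B = polar κ u v u′ v′
    D = form κ u′ v′
    E = linear κ u v
    G = linear κ u′ v′
    rD-D : r * D - D ≈ (r - 1#) * D
    rD-D = trans (+-congˡ (-‿cong (sym (*-identityˡ D))))
      (solve 3 (λ r o D → r :* D :- o :* D := (r :- o) :* D) refl r 1# D)

  cramer-zero : ∀ {s t s′ t′ B D} → det s s′ t t′ ≉ 0# →
    s * B + t * D ≈ 0# → s′ * B + t′ * D ≈ 0# → B ≈ 0# × D ≈ 0#
  cramer-zero {s} {t} {s′} {t′} {B} {D} Δ≉0 h h′ =
    x≉0∧xy≈0⇒y≈0 Δ≉0 (trans
      (solve 6 (λ s t s′ t′ B D → det′ s s′ t t′ :* B :=
        t′ :* (s :* B :+ t :* D) :- t :* (s′ :* B :+ t′ :* D)) refl s t s′ t′ B D)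
      (+≈0 (*≈0 t′ h) (-≈0 (*≈0 t h′)))) ,
    x≉0∧xy≈0⇒y≈0 Δ≉0 (trans
      (solve 6 (λ s t s′ t′ B D → det′ s s′ t t′ :* D :=
        s :* (s′ :* B :+ t′ :* D) :- s′ :* (s :* B :+ t :* D)) refl s t s′ t′ B D)
      (+≈0 (*≈0 s h′) (-≈0 (*≈0 s′ h))))

  -- A quadratic form is recovered from its Gram data in the basis (u , v), (u′ , v′). The
  -- identities are the inverse of this change of basis, cleared of denominators: the squared
  -- determinant for the form, the determinant for the linear part.
  coefficients-zero : ∀ κ {u v u′ v′} → det u v u′ v′ ≉ 0# →
    form κ u v ≈ 0# → polar κ u v u′ v′ ≈ 0# → form κ u′ v′ ≈ 0# →
    linear κ u v ≈ 0# → linear κ u′ v′ ≈ 0# →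
    a κ ≈ 0# × b κ ≈ 0# × c κ ≈ 0# × d κ ≈ 0# × e κ ≈ 0#
  coefficients-zero κ {u} {v} {u′} {v′} δ≉0 A≈0 B≈0 D≈0 E≈0 G≈0 =
    δδ (trans (solve 7 (λ a b c u v u′ v′ →
          det′ u v u′ v′ :* (det′ u v u′ v′ :* a) :=
          v′ :* v′ :* form′ a b c u v :+ (:- (v :* v′)) :* polar′ a b c u v u′ v′ :+ v :* v :* form′ a b c u′ v′)
          refl (a κ) (b κ) (c κ) u v u′ v′)
        (+≈0 (+≈0 (*≈0 _ A≈0) (*≈0 _ B≈0)) (*≈0 _ D≈0))) ,
    δδ (trans (solve 7 (λ a b c u v u′ v′ →
          det′ u v u′ v′ :* (det′ u v u′ v′ :* b) :=
          (:- (u′ :* v′ :+ u′ :* v′)) :* form′ a b c u v :+ (v′ :* u :+ v :* u′) :* polar′ a b c u v u′ v′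
            :+ (:- (u :* v :+ u :* v)) :* form′ a b c u′ v′)
          refl (a κ) (b κ) (c κ) u v u′ v′)
        (+≈0 (+≈0 (*≈0 _ A≈0) (*≈0 _ B≈0)) (*≈0 _ D≈0))) ,
    δδ (trans (solve 7 (λ a b c u v u′ v′ →
          det′ u v u′ v′ :* (det′ u v u′ v′ :* c) :=
          u′ :* u′ :* form′ a b c u v :+ (:- (u :* u′)) :* polar′ a b c u v u′ v′ :+ u :* u :* form′ a b c u′ v′)
          refl (a κ) (b κ) (c κ) u v u′ v′)
        (+≈0 (+≈0 (*≈0 _ A≈0) (*≈0 _ B≈0)) (*≈0 _ D≈0))) ,
    x≉0∧xy≈0⇒y≈0 δ≉0 (trans (solve 6 (λ d e u v u′ v′ →
          det′ u v u′ v′ :* d := v′ :* linear′ d e u v :+ (:- v) :* linear′ d e u′ v′)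
          refl (d κ) (e κ) u v u′ v′)
        (+≈0 (*≈0 _ E≈0) (*≈0 _ G≈0))) ,
    x≉0∧xy≈0⇒y≈0 δ≉0 (trans (solve 6 (λ d e u v u′ v′ →
          det′ u v u′ v′ :* e := (:- u′) :* linear′ d e u v :+ u :* linear′ d e u′ v′)
          refl (d κ) (e κ) u v u′ v′)
        (+≈0 (*≈0 _ E≈0) (*≈0 _ G≈0)))
    where
    δδ : ∀ {z} → det u v u′ v′ * (det u v u′ v′ * z) ≈ 0# → z ≈ 0#
    δδ h = x≉0∧xy≈0⇒y≈0 δ≉0 (x≉0∧xy≈0⇒y≈0 δ≉0 h)

  det-combination : ∀ u v u′ v′ s t s′ t′ →
    det (s * u + t * u′) (s * v + t * v′) (s′ * u + t′ * u′) (s′ * v + t′ * v′) ≈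
    det u v u′ v′ * det s s′ t t′
  det-combination = solve 8
    (λ u v u₂ v₂ s t s′ t′ →
      det′ (s :* u :+ t :* u₂) (s :* v :+ t :* v₂) (s′ :* u :+ t′ :* u₂) (s′ :* v :+ t′ :* v₂) :=
      det′ u v u₂ v₂ :* det′ s s′ t t′)
    refl

  -- A quadric through the origin that contains the line of e₁ and passes through
  -- three non-collinear points off that line is the union of that line and a
  -- line through those points, hence zero.
  vanishing : ∀ κ {u v u₂ v₂ u₃ v₃ u₄ v₄} →
    det u v u₂ v₂ ≉ 0# → det u v u₃ v₃ ≉ 0# → det u v u₄ v₄ ≉ 0# →
    det (u₃ - u₂) (v₃ - v₂) (u₄ - u₂) (v₄ - v₂) ≉ 0# →
    form κ u v ≈ 0# → chord κ u v ≈ 0# →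
    chord κ u₂ v₂ ≈ 0# → chord κ u₃ v₃ ≈ 0# → chord κ u₄ v₄ ≈ 0# →
    a κ ≈ 0# × b κ ≈ 0# × c κ ≈ 0# × d κ ≈ 0# × e κ ≈ 0#
  vanishing κ {u} {v} {u₂} {v₂} {u₃} {v₃} {u₄} {v₄} δ≉0 δ₃≉0 δ₄≉0 or≉0 A≈0 h h₂ h₃ h₄
    = coefficients-zero κ δ≉0 A≈0 (proj₁ BD≈0) (proj₂ BD≈0) lin≈0 lin₂≈0
    where
    coordinates₃ = coordinates δ≉0 u₃ v₃
    coordinates₄ = coordinates δ≉0 u₄ v₄
    s  = proj₁ coordinates₃
    r  = proj₁ (proj₂ coordinates₃)
    s′ = proj₁ coordinates₄
    r′ = proj₁ (proj₂ coordinates₄)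
    x₃≈  = proj₁ (proj₂ (proj₂ coordinates₃))
    y₃≈  = proj₂ (proj₂ (proj₂ coordinates₃))
    x₄≈ = proj₁ (proj₂ (proj₂ coordinates₄))
    y₄≈ = proj₂ (proj₂ (proj₂ coordinates₄))
    lin≈0 : linear κ u v ≈ 0#
    lin≈0 = trans (sym (+-identityˡ _)) (trans (+-congʳ (sym A≈0)) h)

    reduced : ∀ {x y s r} → det u v x y ≉ 0# → chord κ x y ≈ 0# →
      x ≈ s * u + r * u₂ → y ≈ s * v + r * v₂ →
      s * polar κ u v u₂ v₂ + (r - 1#) * form κ u₂ v₂ ≈ 0#
    reduced {x} {y} {s} {r} δ′≉0 h′ x≈ y≈ = x≉0∧xy≈0⇒y≈0 r≉0 (begin
      r * X                        ≈⟨ +-identityʳ _ ⟨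
      r * X + 0#                   ≈⟨ +-congˡ (rest≈0) ⟨
      r * X + (s * s * form κ u v + s * linear κ u v + r * chord κ u₂ v₂)                 ≈⟨ chord-combination κ u v u₂ v₂ s r ⟨
      chord κ (s * u + r * u₂) (s * v + r * v₂) ≈⟨ chord-cong κ x≈ y≈ ⟨
      chord κ x y                  ≈⟨ h′ ⟩
      0#                           ∎)
      where
      rest≈0 : s * s * form κ u v + s * linear κ u v + r * chord κ u₂ v₂ ≈ 0#
      rest≈0 = +≈0 (+≈0 (*≈0 (s * s) A≈0) (*≈0 s lin≈0)) (*≈0 r h₂)
      X = s * polar κ u v u₂ v₂ + (r - 1#) * form κ u₂ v₂
      -- r = 0 is the line of e₁, and the point (x , y) lies off it.
      r≉0 : r ≉ 0#
      r≉0 r≈0 = δ′≉0 (begin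
        det u v x y                                ≈⟨ det-cong refl refl x≈ y≈ ⟩
        det u v (s * u + r * u₂) (s * v + r * v₂)  ≈⟨ solve 6 (λ u v u₂ v₂ s r →
            det′ u v (s :* u :+ r :* u₂) (s :* v :+ r :* v₂) := r :* det′ u v u₂ v₂)
            refl u v u₂ v₂ s r ⟩
        r * det u v u₂ v₂                          ≈⟨ *ˡ≈0 _ r≈0 ⟩
        0#                                         ∎)

    shift : ∀ {x s r z z′} → x ≈ s * z + r * z′ → x - z′ ≈ s * z + (r - 1#) * z′
    shift {x} {s} {r} {z} {z′} x≈ = trans (+-cong x≈ (-‿cong (sym (*-identityˡ z′))))
      (solve 5 (λ s r z z′ o → (s :* z :+ r :* z′) :- o :* z′ := s :* z :+ (r :- o) :* z′)
        refl s r z z′ 1#)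

    -- The pairs (s , r - 1) are the coordinates of the displacements from the second point. So Δ
    -- is, up to the nonzero determinant of the basis, the orientation of the three points off the
    -- line, and the two equations for the residual line have only the zero solution.
    Δ≉0 : det s s′ (r - 1#) (r′ - 1#) ≉ 0#
    Δ≉0 Δ≈0 = or≉0 (begin
      det (u₃ - u₂) (v₃ - v₂) (u₄ - u₂) (v₄ - v₂)
        ≈⟨ det-cong (shift x₃≈) (shift y₃≈) (shift x₄≈) (shift y₄≈) ⟩
      det (s * u + (r - 1#) * u₂) (s * v + (r - 1#) * v₂) (s′ * u + (r′ - 1#) * u₂) (s′ * v + (r′ - 1#) * v₂)
        ≈⟨ det-combination u v u₂ v₂ s (r - 1#) s′ (r′ - 1#) ⟩
      det u v u₂ v₂ * det s s′ (r - 1#) (r′ - 1#)  ≈⟨ *≈0 _ Δ≈0 ⟩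
      0#                                           ∎)

    BD≈0 = cramer-zero Δ≉0 (reduced δ₃≉0 h₃ x₃≈ y₃≈) (reduced δ₄≉0 h₄ x₄≈ y₄≈)

    lin₂≈0 : linear κ u₂ v₂ ≈ 0#
    lin₂≈0 = trans (sym (+-identityˡ _)) (trans (+-congʳ (sym (proj₂ BD≈0))) h₂)

  _-[_]_ : Quadric → Carrier → Quadric → Quadric
  κ′ -[ μ ] κ = quadric (a κ′ - μ * a κ) (b κ′ - μ * b κ) (c κ′ - μ * c κ)
                        (d κ′ - μ * d κ) (e κ′ - μ * e κ) (f κ′ - μ * f κ)

  form-combine : ∀ κ′ μ κ u v → form (κ′ -[ μ ] κ) u v ≈ form κ′ u v - μ * form κ u v
  form-combine κ′ μ κ u v = solve 9 (λ a b c a′ b′ c′ μ u v →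
    form′ (a′ :- μ :* a) (b′ :- μ :* b) (c′ :- μ :* c) u v :=
    form′ a′ b′ c′ u v :- μ :* form′ a b c u v)
    refl (a κ) (b κ) (c κ) (a κ′) (b κ′) (c κ′) μ u v

  linear-combine : ∀ κ′ μ κ u v → linear (κ′ -[ μ ] κ) u v ≈ linear κ′ u v - μ * linear κ u v
  linear-combine κ′ μ κ u v = solve 7
    (λ d e d′ e′ μ u v →
      linear′ (d′ :- μ :* d) (e′ :- μ :* e) u v := linear′ d′ e′ u v :- μ :* linear′ d e u v)
    refl (d κ) (e κ) (d κ′) (e κ′) μ u v

  value-combine : ∀ κ′ μ κ x y → value (κ′ -[ μ ] κ) x y ≈ value κ′ x y - μ * value κ x y
  value-combine κ′ μ κ x y = trans
    (+-congʳ (+-cong (form-combine κ′ μ κ x y) (linear-combine κ′ μ κ x y)))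
    (solve 7 (λ μ A B f A′ B′ f′ →
        (A′ :- μ :* A) :+ (B′ :- μ :* B) :+ (f′ :- μ :* f) := (A′ :+ B′ :+ f′) :- μ :* (A :+ B :+ f))
      refl μ (form κ x y) (linear κ x y) (f κ) (form κ′ x y) (linear κ′ x y) (f κ′))

  infix 4 _≈[_]_
  record _≈[_]_ (κ′ : Quadric) (μ : Carrier) (κ : Quadric) : Set where
    field
      a≈ : a κ′ ≈ μ * a κ
      b≈ : b κ′ ≈ μ * b κ
      c≈ : c κ′ ≈ μ * c κ
      d≈ : d κ′ ≈ μ * d κ
      e≈ : e κ′ ≈ μ * e κ
      f≈ : f κ′ ≈ μ * f κ

  -- κ′ is compared with the multiple μ κ that agrees with it on the line P₁P₂:
  -- their difference contains that line and passes through P₃, P₄ and P₅.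
  five-points : ∀ {κ κ′ P₁ P₂ P₃ P₄ P₅} → NoLine κ →
    P₁ ∈ κ → P₂ ∈ κ → P₃ ∈ κ → P₄ ∈ κ → P₅ ∈ κ →
    P₁ ∈ κ′ → P₂ ∈ κ′ → P₃ ∈ κ′ → P₄ ∈ κ′ → P₅ ∈ κ′ →
    P₁ ≉ₚ P₂ → P₁ ≉ₚ P₃ → P₁ ≉ₚ P₄ → P₁ ≉ₚ P₅ → P₂ ≉ₚ P₃ →
    P₂ ≉ₚ P₄ → P₂ ≉ₚ P₅ → P₃ ≉ₚ P₄ → P₃ ≉ₚ P₅ → P₄ ≉ₚ P₅ →
    ∃[ μ ] κ′ ≈[ μ ] κ
  five-points {κ} {κ′} {x₁ , y₁} {x₂ , y₂} {x₃ , y₃} {x₄ , y₄} {x₅ , y₅} noLine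
    h₁ h₂ h₃ h₄ h₅ h₁′ h₂′ h₃′ h₄′ h₅′ ≉₁₂ ≉₁₃ ≉₁₄ ≉₁₅ ≉₂₃ ≉₂₄ ≉₂₅ ≉₃₄ ≉₃₅ ≉₄₅ =
    μ , record
      { a≈ = -≈0⇒≈ a≈0 ; b≈ = -≈0⇒≈ b≈0 ; c≈ = -≈0⇒≈ c≈0
      ; d≈ = -≈0⇒≈ d≈0 ; e≈ = -≈0⇒≈ e≈0 ; f≈ = -≈0⇒≈ f≈0 }
    where
    u = x₂ - x₁
    v = y₂ - y₁

    form≉0 : form κ u v ≉ 0#
    form≉0 form≈0 = ≉⇒-≉0 ≉₁₂ (noLine x₁ y₁ u v h₁
      (trans (sym (+-identityˡ _)) (trans (+-congʳ (sym form≈0)) (chord-recentre κ h₁ h₂))) form≈0)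

    w = proj₁ (inverse form≉0)
    -- On the line P₁P₂ both quadrics restrict to polynomials of degree at most two that vanish at
    -- P₁ and P₂, so the ratio of the leading coefficients is the multiple that makes them agree.
    μ = form κ′ u v * w
    δ = κ′ -[ μ ] κ
    δ₀ = recentre δ x₁ y₁

    ∈δ : ∀ {P} → P ∈ κ → P ∈ κ′ → P ∈ δ
    ∈δ {x , y} h h′ = trans (value-combine κ′ μ κ x y) (+≈0 h′ (-≈0 (*≈0 μ h)))

    form-δ≈0 : form δ u v ≈ 0#
    form-δ≈0 = begin
      form δ u v                                      ≈⟨ form-combine κ′ μ κ u v ⟩
      form κ′ u v - form κ′ u v * w * form κ u v      ≈⟨ +-congˡ (-‿cong (begin
        form κ′ u v * w * form κ u v     ≈⟨ solve 3 (λ A w B → A :* w :* B := A :* (B :* w)) refl (form κ′ u v) w (form κ u v) ⟩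
        form κ′ u v * (form κ u v * w)   ≈⟨ *-congˡ (proj₂ (inverse form≉0)) ⟩
        form κ′ u v * 1#                 ≈⟨ *-identityʳ _ ⟩
        form κ′ u v                      ∎)) ⟩
      form κ′ u v - form κ′ u v                       ≈⟨ -‿inverseʳ _ ⟩
      0#                                              ∎

    through : ∀ {P} → P ∈ δ → chord δ₀ (proj₁ P - x₁) (proj₂ P - y₁) ≈ 0#
    through = chord-recentre δ (∈δ h₁ h₁′)

    unshift : ∀ x x′ z → (x - z) - (x′ - z) ≈ x - x′
    unshift = solve 3 (λ x x′ z → (x :- z) :- (x′ :- z) := x :- x′) refl

    zeros = vanishing δ₀
      (no-three-collinear noLine h₁ h₂ h₃ ≉₁₂ ≉₁₃ ≉₂₃)
      (no-three-collinear noLine h₁ h₂ h₄ ≉₁₂ ≉₁₄ ≉₂₄)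
      (no-three-collinear noLine h₁ h₂ h₅ ≉₁₂ ≉₁₅ ≉₂₅)
      (λ det≈0 → no-three-collinear noLine h₃ h₄ h₅ ≉₃₄ ≉₃₅ ≉₄₅ (trans
        (sym (det-cong (unshift x₄ x₃ x₁) (unshift y₄ y₃ y₁) (unshift x₅ x₃ x₁) (unshift y₅ y₃ y₁))) det≈0))
      form-δ≈0 (through (∈δ h₂ h₂′)) (through (∈δ h₃ h₃′)) (through (∈δ h₄ h₄′)) (through (∈δ h₅ h₅′))

    a≈0 = proj₁ zeros
    b≈0 = proj₁ (proj₂ zeros)
    c≈0 = proj₁ (proj₂ (proj₂ zeros))

    summand≈0 : ∀ {x y} → x ≈ 0# → x + y ≈ 0# → y ≈ 0#
    summand≈0 x≈0 h = trans (sym (+-identityˡ _)) (trans (+-congʳ (sym x≈0)) h)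

    -- `zeros` concerns the recentred quadric. Once a, b and c vanish, translation does not change d
    -- and e, and the value at P₁ reduces to f.
    d≈0 : d δ ≈ 0#
    d≈0 = summand≈0 (+≈0 (*ˡ≈0 _ a≈0) (*ˡ≈0 _ b≈0)) (proj₁ (proj₂ (proj₂ (proj₂ zeros))))

    e≈0 : e δ ≈ 0#
    e≈0 = summand≈0 (+≈0 (*ˡ≈0 _ b≈0) (*ˡ≈0 _ c≈0)) (proj₂ (proj₂ (proj₂ (proj₂ zeros))))

    f≈0 : f δ ≈ 0#
    f≈0 = summand≈0
      (+≈0 (+≈0 (+≈0 (*ˡ≈0 _ a≈0) (*ˡ≈0 _ b≈0)) (*ˡ≈0 _ c≈0)) (+≈0 (*ˡ≈0 _ d≈0) (*ˡ≈0 _ e≈0)))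
      (∈δ h₁ h₁′)

-- From irreducible polynomials of degree two to quadrics that contain no line.

module ConicQuadrics {q : ℕ} (F : FiniteField q) where
  open FiniteField F
  open CommutativeRing commutativeRing using (semiring)
  open HeytingProperties heytingCommutativeRing using (1#0)
  open Quadrics F hiding (Point; _∈_)
  open Plane F
  open RawSemiringDefinitions rawSemiring using (_∣_)
  open Polynomial
  open IrreducibleConic
  open IntegerSolver commutativeRing using (solve; _:=_; _:+_; _:*_; _:-_; :-_; con)
  open Sum semiring using (sum; sum-syntax; sum⁺-syntax; sum-cong-≋; sum-replicate-zero; ∑-comm)
  open Exp semiring using (_^_)

  1≉0 : 1# ≉ 0#
  1≉0 1≈0 = proj₂ (tight 1# 0#) 1≈0 1#0

  sum-zero : ∀ n {t : Fin n → Carrier} → (∀ k → t k ≈ 0#) → sum t ≈ 0#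
  sum-zero n t≈0 = trans (sum-cong-≋ t≈0) (sum-replicate-zero n)

  sum-single : ∀ {n k₀} (t : ℕ → Carrier) → k₀ ℕ.≤ n →
    (∀ k → k ℕ.≤ n → k ≢ k₀ → t k ≈ 0#) → ∑[ k ≤ n ] t (toℕ k) ≈ t k₀
  sum-single {n} {zero} t _ h = trans
    (+-congˡ (sum-zero n (λ k → h (suc (toℕ k)) (Fin.toℕ<n k) (λ ())))) (+-identityʳ _)
  sum-single {suc n} {suc k₀} t (s≤s k₀≤n) h = trans
    (+-cong (h 0 z≤n (λ ())) (sum-single (λ k → t (suc k)) k₀≤n
      (λ k k≤n k≢k₀ → h (suc k) (s≤s k≤n) (λ eq → k≢k₀ (ℕ.suc-injective eq)))))
    (+-identityˡ _)

  sum²-single : ∀ {m n k₀ l₀} (t : ℕ → ℕ → Carrier) → k₀ ℕ.≤ m → l₀ ℕ.≤ n →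
    (∀ k l → k ℕ.≤ m → l ℕ.≤ n → ¬ (k ≡ k₀ × l ≡ l₀) → t k l ≈ 0#) →
    ∑[ k ≤ m ] ∑[ l ≤ n ] t (toℕ k) (toℕ l) ≈ t k₀ l₀
  sum²-single {m} {n} {k₀} {l₀} t k₀≤m l₀≤n h = trans
    (sum-single (λ k → ∑[ l ≤ n ] t k (toℕ l)) k₀≤m (λ k k≤m k≢k₀ →
      sum-zero (suc n) (λ l → h k (toℕ l) k≤m (Fin.toℕ≤pred[n] l) (λ eq → k≢k₀ (proj₁ eq)))))
    (sum-single (t k₀) l₀≤n (λ l l≤n l≢l₀ → h k₀ l k₀≤m l≤n (λ eq → l≢l₀ (proj₂ eq))))

  affine : Carrier → Carrier → Carrier → Polynomial
  affine α β γ = record { coeff = co ; bound = 1 ; vanishes = va }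
    where
    co : ℕ → ℕ → Carrier
    co 0 0 = α
    co 1 0 = β
    co 0 1 = γ
    co _ _ = 0#

    va : ∀ i j → 1 ℕ.< i ℕ.+ j → co i j ≈ 0#
    va 0 (suc (suc j))   _           = refl
    va 1 (suc j)         _           = refl
    va (suc (suc i)) j   _           = refl
    va 0 1               (s≤s ())
    va 1 0               (s≤s ())

  constant-coeff : ∀ a i j → 0 ℕ.< i ℕ.+ j → coeff (constant a) i j ≈ 0#
  constant-coeff a = vanishes (constant a)

  module _ {h : Polynomial} {α β γ} (unit : h *ᴾ affine α β γ ≈ᴾ constant 1#) where

    private
      ℓ = affine α β γ

      VanishFrom : ℕ → Set
      VanishFrom n = ∀ i j → n ℕ.≤ i ℕ.+ j → coeff h i j ≈ 0#

      descend : (∀ n → VanishFrom (suc n) → VanishFrom n) → ∀ n → VanishFrom n → VanishFrom 0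
      descend step zero    v = v
      descend step (suc n) v = descend step n (step n v)

      extend : ∀ {n} → VanishFrom (suc n) → (∀ i j → i ℕ.+ j ≡ n → coeff h i j ≈ 0#) → VanishFrom n
      extend {n} v top i j n≤i+j with ℕ.m≤n⇒m<n∨m≡n n≤i+j
      ... | inj₁ n<i+j = v i j n<i+j
      ... | inj₂ n≡i+j = top i j (≡.sym n≡i+j)

      index-sum : ∀ {k i p} → k ℕ.≤ i → i ∸ k ≡ p → k ℕ.+ p ≡ i
      index-sum k≤i ≡.refl = ℕ.m+[n∸m]≡n k≤i

      -- At (suc i , j) only the x-term of ℓ contributes: its constant term meets a
      -- coefficient of h of degree suc n, its y-term one treated earlier in the
      -- induction on j.
      x-step : β ≉ 0# → ∀ n → VanishFrom (suc n) → ∀ i j → i ℕ.+ j ≡ n → coeff h i j ≈ 0#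
      x-step β≉0 n v i j i+j≡n = x≉0∧xy≈0⇒y≈0 β≉0 (trans (*-comm _ _) (trans (sym single) (trans (unit (suc i) j) (constant-coeff 1# (suc i) j (s≤s z≤n)))))
        where
        term : ℕ → ℕ → Carrier
        term k l = coeff h k l * coeff ℓ (suc i ∸ k) (j ∸ l)

        previous : ∀ l → l ℕ.+ 1 ≡ j → coeff h (suc i) l ≈ 0#
        previous l l+1≡j with ℕ.+-comm l 1
        ... | eq with ≡.trans (≡.sym eq) l+1≡j
        ... | ≡.refl = x-step β≉0 n v (suc i) l (≡.trans (≡.sym (ℕ.+-suc i l)) i+j≡n)

        zero-term : ∀ k l → k ℕ.≤ suc i → l ℕ.≤ j → ¬ (k ≡ i × l ≡ j) → term k l ≈ 0#
        zero-term k l k≤ l≤ ≢ with suc i ∸ k in p-eq | j ∸ l in r-eq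
        ... | 0 | 0 = *ˡ≈0 _ (v k l (ℕ.≤-reflexive (≡.sym (≡.trans
                (≡.cong₂ ℕ._+_ (≡.trans (≡.sym (ℕ.+-identityʳ k)) (index-sum k≤ p-eq))
                               (≡.trans (≡.sym (ℕ.+-identityʳ l)) (index-sum l≤ r-eq)))
                (≡.cong suc i+j≡n)))))
        ... | 1 | 0 = contradiction
                ( ℕ.suc-injective (≡.trans (ℕ.+-comm 1 k) (index-sum k≤ p-eq))
                , ≡.trans (≡.sym (ℕ.+-identityʳ l)) (index-sum l≤ r-eq)) ≢
        ... | 0 | 1 = *ˡ≈0 _ (trans (reflexive (≡.cong (λ z → coeff h z l)
                (≡.trans (≡.sym (ℕ.+-identityʳ k)) (index-sum k≤ p-eq)))) (previous l (index-sum l≤ r-eq)))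
        ... | 0 | suc (suc _) = zeroʳ _
        ... | 1 | suc _ = zeroʳ _
        ... | suc (suc _) | _ = zeroʳ _

        single : coeff (h *ᴾ ℓ) (suc i) j ≈ coeff h i j * β
        single = trans (sum²-single term (ℕ.n≤1+n i) ℕ.≤-refl zero-term)
          (*-congˡ (reflexive (≡.cong₂ (coeff ℓ) (ℕ.m+n∸n≡m 1 i) (ℕ.n∸n≡0 j))))

    -- Downward induction on the degree, started above the bound of `h`, removes every coefficient
    -- of `h`. The constant coefficient of the product is then 0 instead of 1.
    not-unit-x : β ≉ 0# → ⊥
    not-unit-x β≉0 = 1≉0 (trans (sym (unit 0 0)) (+≈0 (+≈0 (*ˡ≈0 α h₀₀≈0) refl) refl))
      where
      h₀₀≈0 : coeff h 0 0 ≈ 0#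
      h₀₀≈0 = descend (λ n v → extend v (x-step β≉0 n v)) (suc (bound h)) (vanishes h) 0 0 z≤n

  -- Irreducibility says only that one of two factors divides 1, so a factorisation into affine
  -- polynomials contradicts it once these are known not to be units.
  affine-∤1 : ∀ {α β γ} → ¬ (β ≈ 0# × γ ≈ 0#) → ¬ affine α β γ ∣ constant 1#
  affine-∤1 {α} {β} {γ} nonconstant (h RawMagmaDefinitions., unit) with β ≟ 0#
  ... | no β≉0 = not-unit-x {h} unit β≉0
  -- Exchanging the variables moves the nonzero coefficient γ to x.
  ... | yes β≈0 = not-unit-x {transpose} transposed-unit (λ γ≈0 → nonconstant (β≈0 , γ≈0))
    where
    transpose : Polynomial
    transpose = record
      { coeff = λ i j → coeff h j i
      ; bound = bound h
      ; vanishes = λ i j b<i+j → vanishes h j i (≡.subst (bound h ℕ.<_) (ℕ.+-comm i j) b<i+j) }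

    affine-transpose : ∀ i j → coeff (affine α γ β) i j ≡ coeff (affine α β γ) j i
    affine-transpose 0 0 = ≡.refl
    affine-transpose 1 0 = ≡.refl
    affine-transpose 0 1 = ≡.refl
    affine-transpose 1 1 = ≡.refl
    affine-transpose 0 (suc (suc j)) = ≡.refl
    affine-transpose 1 (suc (suc j)) = ≡.refl
    affine-transpose (suc (suc i)) 0 = ≡.refl
    affine-transpose (suc (suc i)) 1 = ≡.refl
    affine-transpose (suc (suc i)) (suc (suc j)) = ≡.refl

    constant-transpose : ∀ a i j → coeff (constant a) i j ≡ coeff (constant a) j i
    constant-transpose a zero    zero    = ≡.refl
    constant-transpose a zero    (suc j) = ≡.refl
    constant-transpose a (suc i) zero    = ≡.refl
    constant-transpose a (suc i) (suc j) = ≡.refl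

    transposed-unit : transpose *ᴾ affine α γ β ≈ᴾ constant 1#
    transposed-unit i j = trans
      (sum-cong-≋ {suc i} λ k → sum-cong-≋ {suc j} λ l →
        *-congˡ {coeff h (toℕ l) (toℕ k)} (reflexive (affine-transpose (i ∸ toℕ k) (j ∸ toℕ l))))
      (trans (∑-comm {suc i} {suc j} (λ k l →
          coeff h (toℕ l) (toℕ k) * coeff (affine α β γ) (j ∸ toℕ l) (i ∸ toℕ k)))
        (trans (unit j i) (reflexive (constant-transpose 1# j i))))

  quadratic : Polynomial → Quadric
  quadratic g = quadric (coeff g 2 0) (coeff g 1 1) (coeff g 0 2) (coeff g 1 0) (coeff g 0 1) (coeff g 0 0)

  AtMostQuadratic : Polynomial → Set
  AtMostQuadratic g = ∀ i j → 2 ℕ.< i ℕ.+ j → coeff g i j ≈ 0#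

  affine-product : ∀ {g α β γ α′ β′ γ′} → AtMostQuadratic g →
    coeff g 0 0 ≈ α * α′ → coeff g 1 0 ≈ α * β′ + β * α′ → coeff g 0 1 ≈ α * γ′ + γ * α′ →
    coeff g 2 0 ≈ β * β′ → coeff g 1 1 ≈ β * γ′ + γ * β′ → coeff g 0 2 ≈ γ * γ′ →
    g ≈ᴾ affine α β γ *ᴾ affine α′ β′ γ′
  affine-product {g} {α} {β} {γ} {α′} {β′} {γ′} deg h₀₀ h₁₀ h₀₁ h₂₀ h₁₁ h₀₂ = go
    where
    high : ∀ i j → 2 ℕ.< i ℕ.+ j → coeff g i j ≈ coeff (affine α β γ *ᴾ affine α′ β′ γ′) i j
    high i j 2<i+j = trans (deg i j 2<i+j) (sym (vanishes (affine α β γ *ᴾ affine α′ β′ γ′) i j 2<i+j))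

    go : g ≈ᴾ affine α β γ *ᴾ affine α′ β′ γ′
    -- The right-hand sides spell out the convolution as it unfolds, with the zero coefficients of
    -- the affine factors and the empty tails of the sums.
    go 0 0 = trans h₀₀ (solve 6 (λ α β γ α′ β′ γ′ → α :* α′ := α :* α′ :+ con ℤ.0ℤ :+ con ℤ.0ℤ) refl α β γ α′ β′ γ′)
    go 1 0 = trans h₁₀ (solve 6 (λ α β γ α′ β′ γ′ → α :* β′ :+ β :* α′ :=
      α :* β′ :+ con ℤ.0ℤ :+ (β :* α′ :+ con ℤ.0ℤ :+ con ℤ.0ℤ)) refl α β γ α′ β′ γ′)
    go 0 1 = trans h₀₁ (solve 6 (λ α β γ α′ β′ γ′ → α :* γ′ :+ γ :* α′ :=
      α :* γ′ :+ (γ :* α′ :+ con ℤ.0ℤ) :+ con ℤ.0ℤ) refl α β γ α′ β′ γ′)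
    go 2 0 = trans h₂₀ (solve 6 (λ α β γ α′ β′ γ′ → β :* β′ :=
      α :* con ℤ.0ℤ :+ con ℤ.0ℤ :+ (β :* β′ :+ con ℤ.0ℤ :+ (con ℤ.0ℤ :* α′ :+ con ℤ.0ℤ :+ con ℤ.0ℤ))) refl α β γ α′ β′ γ′)
    go 1 1 = trans h₁₁ (solve 6 (λ α β γ α′ β′ γ′ → β :* γ′ :+ γ :* β′ :=
      α :* con ℤ.0ℤ :+ (γ :* β′ :+ con ℤ.0ℤ) :+ (β :* γ′ :+ (con ℤ.0ℤ :* α′ :+ con ℤ.0ℤ) :+ con ℤ.0ℤ)) refl α β γ α′ β′ γ′)
    go 0 2 = trans h₀₂ (solve 6 (λ α β γ α′ β′ γ′ → γ :* γ′ :=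
      α :* con ℤ.0ℤ :+ (γ :* γ′ :+ (con ℤ.0ℤ :* α′ :+ con ℤ.0ℤ)) :+ con ℤ.0ℤ) refl α β γ α′ β′ γ′)
    go 0 (suc (suc (suc j))) = high 0 (3 ℕ.+ j) (s≤s (s≤s (s≤s z≤n)))
    go 1 (suc (suc j))       = high 1 (2 ℕ.+ j) (s≤s (s≤s (s≤s z≤n)))
    go 2 (suc j)             = high 2 (1 ℕ.+ j) (s≤s (s≤s (s≤s z≤n)))
    go (suc (suc (suc i))) j = high (3 ℕ.+ i) j (s≤s (s≤s (s≤s z≤n)))

  module _ {g : Polynomial} (degree : HasDegree 2 g) (irreducible : Irreducible g) where

    private
      κ = quadratic g
      open Quadric κ

      noFactors : ∀ {α β γ α′ β′ γ′} → ¬ (β ≈ 0# × γ ≈ 0#) → ¬ (β′ ≈ 0# × γ′ ≈ 0#) →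
                  ¬ g ≈ᴾ affine α β γ *ᴾ affine α′ β′ γ′
      noFactors n n′ g≈ with RawSemiringDefinitions.Irreducible.split-∣1 irreducible g≈
      ... | inj₁ ∣1 = affine-∤1 n ∣1
      ... | inj₂ ∣1 = affine-∤1 n′ ∣1

    form-nonzero : ¬ (a ≈ 0# × b ≈ 0# × c ≈ 0#)
    form-nonzero (a≈0 , b≈0 , c≈0) = contra (proj₂ degree)
      where
      contra : ∃[ i ] ∃[ j ] (i ℕ.+ j ≡ 2 × ¬ coeff g i j ≈ 0#) → ⊥
      contra (0 , 2 , ≡.refl , ≉0) = ≉0 c≈0
      contra (1 , 1 , ≡.refl , ≉0) = ≉0 b≈0
      contra (2 , 0 , ≡.refl , ≉0) = ≉0 a≈0

    private
      -- Division of g by Y - y - σ (X - x), as polynomials in Y. The remainder is g restricted to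
      -- this line, and the three hypotheses say that its Taylor coefficients at X = x vanish. The
      -- quotient is α′ + β′ X + γ′ Y; it is not constant, since otherwise c and b, and then a,
      -- would vanish.
      noSlantedLine : ∀ x y σ → value κ x y ≈ 0# →
        Quadric.d (recentre κ x y) + Quadric.e (recentre κ x y) * σ ≈ 0# →
        a + b * σ + c * (σ * σ) ≈ 0# → ⊥
      noSlantedLine x y σ V≈0 L≈0 H≈0 = noFactors
        (λ (_ , 1≈0) → 1≉0 1≈0)
        (λ (b+cσ≈0 , c≈0) →
          let b≈0 = trans (sym (+-identityʳ b)) (trans (+-congˡ (sym (*ˡ≈0 σ c≈0))) b+cσ≈0)
          in form-nonzero
            ( trans (sym (+-identityʳ a)) (trans (sym (+-congˡ {a} (+≈0 (*ˡ≈0 σ b≈0) (*ˡ≈0 (σ * σ) c≈0))))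
                (trans (sym (+-assoc a _ _)) H≈0))
            , b≈0 , c≈0))
        (affine-product {g} {α} {β} {γ} {α′} {β′} {γ′} (proj₁ degree)
          (-≈0⇒≈ (trans (solve 9 (λ a b c d e f x y σ → let E = b :* x :+ c :* (y :+ y) :+ e in
              f :- (σ :* x :- y) :* (E :- c :* y :- (b :+ c :* σ) :* x) :=
              (form′ a b c x y :+ linear′ d e x y :+ f)
                :- x :* (a :* (x :+ x) :+ b :* y :+ d :+ E :* σ)
                :+ x :* x :* (a :+ b :* σ :+ c :* (σ :* σ)))
              refl a b c d e f x y σ)
            (+≈0 (+≈0 V≈0 (-≈0 (*≈0 x L≈0))) (*≈0 (x * x) H≈0))))
          (-≈0⇒≈ (trans (solve 8 (λ a b c d e x y σ → let E = b :* x :+ c :* (y :+ y) :+ e in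
              d :- ((σ :* x :- y) :* (b :+ c :* σ) :+ (:- σ) :* (E :- c :* y :- (b :+ c :* σ) :* x)) :=
              (a :* (x :+ x) :+ b :* y :+ d :+ E :* σ)
                :+ (:- (x :+ x)) :* (a :+ b :* σ :+ c :* (σ :* σ)))
              refl a b c d e x y σ)
            (+≈0 L≈0 (*≈0 _ H≈0))))
          (trans (solve 6 (λ b c e x y σ →
              e := (σ :* x :- y) :* c :+ (b :* x :+ c :* (y :+ y) :+ e :- c :* y :- (b :+ c :* σ) :* x))
              refl b c e x y σ)
            (+-congˡ (sym (*-identityˡ _))))
          (-≈0⇒≈ (trans (solve 4 (λ a b c σ →
              a :- (:- σ) :* (b :+ c :* σ) := a :+ b :* σ :+ c :* (σ :* σ)) refl a b c σ) H≈0))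
          (trans (solve 3 (λ b c σ → b := (:- σ) :* c :+ (b :+ c :* σ)) refl b c σ)
            (+-congˡ (sym (*-identityˡ _))))
          (sym (*-identityˡ c)))
        where
        α = σ * x - y
        β = - σ
        γ = 1#
        γ′ = c
        β′ = b + c * σ
        α′ = Quadric.e (recentre κ x y) - c * y - (b + c * σ) * x

      -- The remaining direction (0 , 1): here X - x divides g, with quotient (d + a x) + a X + b Y.
      noVerticalLine : ∀ x y → value κ x y ≈ 0# → Quadric.e (recentre κ x y) ≈ 0# → c ≈ 0# → ⊥
      noVerticalLine x y V≈0 E≈0 c≈0 = noFactors
        (λ (1≈0 , _) → 1≉0 1≈0)
        (λ (a≈0 , b≈0) → form-nonzero (a≈0 , b≈0 , c≈0))
        (affine-product {g} { - x} {1#} {0#} {d + a * x} {a} {b} (proj₁ degree)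
          (-≈0⇒≈ (trans (solve 8 (λ a b c d e f x y →
              f :- (:- x) :* (d :+ a :* x) :=
              (form′ a b c x y :+ linear′ d e x y :+ f)
                :- y :* (b :* x :+ c :* (y :+ y) :+ e) :+ y :* y :* c)
              refl a b c d e f x y)
            (+≈0 (+≈0 V≈0 (-≈0 (*≈0 y E≈0))) (*≈0 (y * y) c≈0))))
          (trans (solve 3 (λ a d x → d := (:- x) :* a :+ (d :+ a :* x)) refl a d x)
            (+-congˡ (sym (*-identityˡ _))))
          (-≈0⇒≈ (trans (solve 6 (λ b c d e x y →
              e :- ((:- x) :* b :+ con ℤ.0ℤ :* d) := (b :* x :+ c :* (y :+ y) :+ e) :- (y :+ y) :* c)
              refl b c (d + a * x) e x y)
            (+≈0 E≈0 (-≈0 (*≈0 (y + y) c≈0)))))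
          (sym (*-identityˡ a))
          (sym (trans (+-cong (*-identityˡ b) (zeroˡ a)) (+-identityʳ b)))
          (trans c≈0 (sym (zeroˡ b))))

    noLine : NoLine κ
    noLine x y u v V≈0 L≈0 H≈0 = direction (u ≟ 0#) (v ≟ 0#)
      where
      κ₀ = recentre κ x y

      direction : Dec (u ≈ 0#) → Dec (v ≈ 0#) → u ≈ 0# × v ≈ 0#
      direction (yes u≈0) (yes v≈0) = u≈0 , v≈0
      direction (yes u≈0) (no  v≉0) = ⊥-elim (noVerticalLine x y V≈0
        (x≉0∧xy≈0⇒y≈0 v≉0 (trans (*-comm v _) (trans (sym (+-identityˡ _))
          (trans (+-congʳ (sym (*≈0 (Quadric.d κ₀) u≈0))) L≈0))))
        (x≉0∧xy≈0⇒y≈0 v≉0 (x≉0∧xy≈0⇒y≈0 v≉0 (trans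
          (solve 2 (λ v c → v :* (v :* c) := c :* (v :* v)) refl v c)
          (trans (sym (+-identityˡ _)) (trans
            (+-congʳ (sym (+≈0 (*≈0 a (*ˡ≈0 u u≈0)) (*≈0 b (*ˡ≈0 v u≈0))))) H≈0))))))
      direction (no u≉0) _ = ⊥-elim (noSlantedLine x y σ V≈0
        (trans (+-congʳ (sym (*-identityʳ _))) (trans
          (linear-cong κ₀ (sym wu≈1) refl) (trans (linear-scale κ₀ w u v) (*≈0 w L≈0))))
        (trans (+-congʳ (+-cong (sym (trans (*-congˡ (*-identityˡ 1#)) (*-identityʳ a))) (*-congˡ (sym (*-identityˡ σ)))))
          (trans (form-cong κ (sym wu≈1) refl) (trans (form-scale κ w u v) (*≈0 (w * w) H≈0)))))
        where
        w = proj₁ (inverse u≉0)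
        σ = w * v
        wu≈1 : w * u ≈ 1#
        wu≈1 = trans (*-comm w u) (proj₂ (inverse u≉0))

    -- The number of summands depends on `bound`, which may be any upper bound for the degree. A
    -- nonzero coefficient of degree 2 forces it to be at least 2, so that the six low terms can be
    -- split off and everything else is zero.
    eval≈value : ∀ x y → eval g (x , y) ≈ value κ x y
    eval≈value x y = upTo (bound g) (2≤bound (proj₂ degree))
      where
      term : ℕ → ℕ → Carrier
      term i j = coeff g i j * (x ^ i * y ^ j)

      high : ∀ i j → 2 ℕ.< i ℕ.+ j → term i j ≈ 0#
      high i j 2<i+j = *ˡ≈0 _ (proj₁ degree i j 2<i+j)

      2≤bound : ∃[ i ] ∃[ j ] (i ℕ.+ j ≡ 2 × ¬ coeff g i j ≈ 0#) → 2 ℕ.≤ bound g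
      2≤bound (i , j , i+j≡2 , ≉0) = ℕ.≮⇒≥ λ bound<2 →
        ≉0 (vanishes g i j (≡.subst (bound g ℕ.<_) (≡.sym i+j≡2) bound<2))

      upTo : ∀ n → 2 ℕ.≤ n → ∑[ i ≤ n ] ∑[ j ≤ n ] term (toℕ i) (toℕ j) ≈ value κ x y
      upTo (suc (suc n)) (s≤s (s≤s z≤n)) = begin
        ∑[ i ≤ 2 ℕ.+ n ] ∑[ j ≤ 2 ℕ.+ n ] term (toℕ i) (toℕ j)
          ≈⟨ +-cong row₀ (+-cong row₁ (+-cong row₂ rows)) ⟩
        (term 0 0 + (term 0 1 + term 0 2)) + ((term 1 0 + term 1 1) + (term 2 0 + 0#))
          ≈⟨ +-cong (+-cong f·1 (+-cong (m 1·y) (m 1·y²))) (+-cong (+-cong (m x·1) (m x·y)) (+-congʳ (m x²·1))) ⟩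
        (f + (e * y + c * (y * y))) + ((d * x + b * (x * y)) + (a * (x * x) + 0#))
          ≈⟨ solve 8 (λ a b c d e f x y →
              (f :+ (e :* y :+ c :* (y :* y))) :+ ((d :* x :+ b :* (x :* y)) :+ (a :* (x :* x) :+ con ℤ.0ℤ))
              := form′ a b c x y :+ linear′ d e x y :+ f) refl a b c d e f x y ⟩
        value κ x y ∎
        where
        open SetoidReasoning setoid

        tail₀ : ∀ {m s} → (∀ (k : Fin m) → s k ≈ 0#) → ∀ z → z + sum s ≈ z
        tail₀ {m} h z = trans (+-congˡ (sum-zero m h)) (+-identityʳ z)

        row₀ : ∑[ j ≤ 2 ℕ.+ n ] term 0 (toℕ j) ≈ term 0 0 + (term 0 1 + term 0 2)
        row₀ = +-congˡ (+-congˡ (tail₀ {n} (λ k → high 0 (3 ℕ.+ toℕ k) (s≤s (s≤s (s≤s z≤n)))) _))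

        row₁ : ∑[ j ≤ 2 ℕ.+ n ] term 1 (toℕ j) ≈ term 1 0 + term 1 1
        row₁ = +-congˡ (tail₀ {suc n} (λ k → high 1 (2 ℕ.+ toℕ k) (s≤s (s≤s (s≤s z≤n)))) _)

        row₂ : ∑[ j ≤ 2 ℕ.+ n ] term 2 (toℕ j) ≈ term 2 0
        row₂ = tail₀ {suc (suc n)} (λ k → high 2 (1 ℕ.+ toℕ k) (s≤s (s≤s (s≤s z≤n)))) _

        rows : ∑[ i < n ] ∑[ j ≤ 2 ℕ.+ n ] term (3 ℕ.+ toℕ i) (toℕ j) ≈ 0#
        rows = sum-zero n (λ i → sum-zero (3 ℕ.+ n) (λ j → high (3 ℕ.+ toℕ i) (toℕ j) (s≤s (s≤s (s≤s z≤n)))))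

        m : ∀ {k s t} → s ≈ t → k * s ≈ k * t
        m = *-congˡ

        f·1 : f * (1# * 1#) ≈ f
        f·1 = trans (*-congˡ (*-identityˡ 1#)) (*-identityʳ f)
        x¹ : ∀ z → z ^ 1 ≈ z
        x¹ z = *-identityʳ z
        x² : ∀ z → z ^ 2 ≈ z * z
        x² z = *-congˡ (x¹ z)
        1·y = trans (*-identityˡ _) (x¹ y)
        1·y² = trans (*-identityˡ _) (x² y)
        x·1 = trans (*-identityʳ _) (x¹ x)
        x²·1 = trans (*-identityʳ _) (x² x)
        x·y = *-cong (x¹ x) (x¹ y)

-- Sums over lists and the inequalities of the counting argument.

module FiniteSums where
  open import Data.List.Membership.Propositional using (_∈_)
  open import Data.Nat.Base using (_+_; _*_; _≤_; ∣_-_∣; NonZero)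
  open import Data.Nat.ListAction using (sum)
  open import Data.Nat.ListAction.Properties using (sum-++)
  open import Data.Nat.Properties
  open ≡ using (refl; sym; trans; cong; cong₂; subst)

  private
    variable
      A B : Set

  ∑ : List A → (A → ℕ) → ℕ
  ∑ xs f = sum (map f xs)

  ∑-mono : ∀ (xs : List A) {f g : A → ℕ} → (∀ x → x ∈ xs → f x ≤ g x) → ∑ xs f ≤ ∑ xs g
  ∑-mono []       h = z≤n
  ∑-mono (x ∷ xs) h = +-mono-≤ (h x (here refl)) (∑-mono xs (λ y y∈ → h y (there y∈)))

  ∑-cong : ∀ (xs : List A) {f g : A → ℕ} → (∀ x → f x ≡ g x) → ∑ xs f ≡ ∑ xs g
  ∑-cong []       h = refl
  ∑-cong (x ∷ xs) h = cong₂ _+_ (h x) (∑-cong xs h)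

  ∑-+ : ∀ (xs : List A) (f g : A → ℕ) → ∑ xs (λ x → f x + g x) ≡ ∑ xs f + ∑ xs g
  ∑-+ []       f g = refl
  ∑-+ (x ∷ xs) f g = trans (cong (f x + g x +_) (∑-+ xs f g)) (lemma (f x) (g x) _ _)
    where
    lemma : ∀ a b c d → a + b + (c + d) ≡ a + c + (b + d)
    lemma = solve-∀

  ∑-* : ∀ (xs : List A) k (f : A → ℕ) → ∑ xs (λ x → k * f x) ≡ k * ∑ xs f
  ∑-* []       k f = sym (*-zeroʳ k)
  ∑-* (x ∷ xs) k f = trans (cong (k * f x +_) (∑-* xs k f)) (sym (*-distribˡ-+ k (f x) _))

  ∑-*ʳ : ∀ (xs : List A) k (f : A → ℕ) → ∑ xs (λ x → f x * k) ≡ ∑ xs f * k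
  ∑-*ʳ []       k f = refl
  ∑-*ʳ (x ∷ xs) k f = trans (cong (f x * k +_) (∑-*ʳ xs k f)) (sym (*-distribʳ-+ k (f x) _))

  ∑-const : ∀ (xs : List A) k → ∑ xs (λ _ → k) ≡ length xs * k
  ∑-const []       k = refl
  ∑-const (x ∷ xs) k = cong (k +_) (∑-const xs k)

  ∑-swap : ∀ (xs : List A) (ys : List B) (f : A → B → ℕ) →
           ∑ xs (λ x → ∑ ys (f x)) ≡ ∑ ys (λ y → ∑ xs (λ x → f x y))
  ∑-swap []       ys f = sym (trans (∑-const ys 0) (*-zeroʳ (length ys)))
  ∑-swap (x ∷ xs) ys f = trans (cong (∑ ys (f x) +_) (∑-swap xs ys f)) (sym (∑-+ ys (f x) _))

  ∑-++ : ∀ (xs ys : List A) (f : A → ℕ) → ∑ (xs ++ ys) f ≡ ∑ xs f + ∑ ys f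
  ∑-++ xs ys f = trans (cong sum (map-++ f xs ys)) (sum-++ (map f xs) (map f ys))

  ∑-cartesianProduct : ∀ (xs : List A) (ys : List B) (f : A × B → ℕ) →
    ∑ (cartesianProduct xs ys) f ≡ ∑ xs (λ x → ∑ ys (λ y → f (x , y)))
  ∑-cartesianProduct []       ys f = refl
  ∑-cartesianProduct (x ∷ xs) ys f = trans
    (∑-++ (map (x ,_) ys) (cartesianProduct xs ys) f)
    (cong₂ _+_ (∑-map ys) (∑-cartesianProduct xs ys f))
    where
    ∑-map : ∀ ys → ∑ (map (x ,_) ys) f ≡ ∑ ys (λ y → f (x , y))
    ∑-map []       = refl
    ∑-map (y ∷ ys) = cong (f (x , y) +_) (∑-map ys)

  length-cartesianProduct : ∀ (xs : List A) (ys : List B) → length (cartesianProduct xs ys) ≡ length xs * length ys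
  length-cartesianProduct xs ys = trans (sym (count (cartesianProduct xs ys)))
    (trans (∑-cartesianProduct xs ys (λ _ → 1)) (trans (∑-const xs _) (cong (length xs *_) (count ys))))
    where
    count : ∀ {A : Set} (zs : List A) → ∑ zs (λ _ → 1) ≡ length zs
    count zs = trans (∑-const zs 1) (*-identityʳ _)

  ∑-⊆ : ∀ {xs ys : List A} (f : A → ℕ) → Unique xs → (∀ {x} → x ∈ xs → x ∈ ys) → ∑ xs f ≤ ∑ ys f
  ∑-⊆ f []               xs⊆ys = z≤n
  ∑-⊆ {xs = x ∷ xs} {ys} f (x∉xs ∷ uniq) xs⊆ys with ∈-∃++ (xs⊆ys (here refl))
  ... | as , bs , refl = begin
    f x + ∑ xs f          ≤⟨ +-monoʳ-≤ (f x) (∑-⊆ f uniq xs⊆rest) ⟩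
    f x + ∑ (as ++ bs) f  ≡⟨ cong (f x +_) (∑-++ as bs f) ⟩
    f x + (∑ as f + ∑ bs f) ≡⟨ lemma (f x) (∑ as f) (∑ bs f) ⟩
    ∑ as f + (f x + ∑ bs f) ≡⟨ ∑-++ as (x ∷ bs) f ⟨
    ∑ (as ++ x ∷ bs) f    ∎
    where
    open ≤-Reasoning
    lemma : ∀ a b c → a + (b + c) ≡ b + (a + c)
    lemma = solve-∀
    xs⊆rest : ∀ {y} → y ∈ xs → y ∈ as ++ bs
    xs⊆rest y∈xs with ∈-++⁻ as (xs⊆ys (there y∈xs))
    ... | inj₁ y∈as         = ∈-++⁺ˡ y∈as
    ... | inj₂ (here refl)  = ⊥-elim (All.lookup x∉xs y∈xs refl)
    ... | inj₂ (there y∈bs) = ∈-++⁺ʳ as y∈bs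

  -- The hypothesis is (f x - f y) (g x - g y) ≥ 0 without subtraction. In the induction it is
  -- applied to the head paired with each entry of the tail.
  chebyshev : ∀ (xs : List A) (f g : A → ℕ) →
    (∀ x y → f x * g y + g x * f y ≤ f x * g x + f y * g y) →
    ∑ xs f * ∑ xs g ≤ length xs * ∑ xs (λ x → f x * g x)
  chebyshev []       f g h = z≤n
  chebyshev (x ∷ xs) f g h = begin
    (f x + F) * (g x + G)                       ≡⟨ lemma₁ (f x) F (g x) G ⟩
    f x * g x + (f x * G + g x * F) + F * G     ≤⟨ +-mono-≤ (+-monoʳ-≤ (f x * g x) mixed) (chebyshev xs f g h) ⟩
    f x * g x + (n * (f x * g x) + H) + n * H   ≡⟨ lemma₂ (f x * g x) n H ⟩
    suc n * (f x * g x + H)                     ∎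
    where
    open ≤-Reasoning
    n = length xs
    F = ∑ xs f
    G = ∑ xs g
    H = ∑ xs (λ y → f y * g y)
    lemma₁ : ∀ a b c d → (a + b) * (c + d) ≡ a * c + (a * d + c * b) + b * d
    lemma₁ = solve-∀
    lemma₂ : ∀ a n b → a + (n * a + b) + n * b ≡ suc n * (a + b)
    lemma₂ = solve-∀
    mixed : f x * G + g x * F ≤ n * (f x * g x) + H
    mixed = begin
      f x * G + g x * F                               ≡⟨ cong₂ _+_ (∑-* xs (f x) g) (∑-* xs (g x) f) ⟨
      ∑ xs (λ y → f x * g y) + ∑ xs (λ y → g x * f y) ≡⟨ ∑-+ xs _ _ ⟨
      ∑ xs (λ y → f x * g y + g x * f y)              ≤⟨ ∑-mono xs (λ y _ → h x y) ⟩
      ∑ xs (λ y → f x * g x + f y * g y)              ≡⟨ ∑-+ xs _ _ ⟩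
      ∑ xs (λ y → f x * g x) + H                      ≡⟨ cong (_+ H) (∑-const xs _) ⟩
      n * (f x * g x) + H                             ∎

  rearrangement : ∀ {a a′ b b′} → a ≤ a′ → b ≤ b′ → a * b′ + b * a′ ≤ a * b + a′ * b′
  rearrangement {a} {b = b} a≤a′ b≤b′ with m≤n⇒∃[o]m+o≡n a≤a′ | m≤n⇒∃[o]m+o≡n b≤b′
  ... | i , refl | j , refl = begin
    a * (b + j) + b * (a + i)           ≤⟨ m≤m+n _ (i * j) ⟩
    a * (b + j) + b * (a + i) + i * j   ≡⟨ lemma a b i j ⟩
    a * b + (a + i) * (b + j)           ∎
    where
    open ≤-Reasoning
    lemma : ∀ a b i j → a * (b + j) + b * (a + i) + i * j ≡ a * b + (a + i) * (b + j)
    lemma = solve-∀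

  chebyshev-monotone : ∀ (xs : List A) (f : A → ℕ) (φ : ℕ → ℕ) → (∀ {m n} → m ≤ n → φ m ≤ φ n) →
    ∑ xs f * ∑ xs (λ x → φ (f x)) ≤ length xs * ∑ xs (λ x → f x * φ (f x))
  chebyshev-monotone xs f φ φ-mono = chebyshev xs f (λ x → φ (f x)) compare
    where
    swap : ∀ a b c d → a * c + d * b ≡ b * d + c * a
    swap = solve-∀
    compare : ∀ x y → f x * φ (f y) + φ (f x) * f y ≤ f x * φ (f x) + f y * φ (f y)
    compare x y with ≤-total (f x) (f y)
    ... | inj₁ fx≤fy = rearrangement fx≤fy (φ-mono fx≤fy)
    ... | inj₂ fy≤fx = begin
      f x * φ (f y) + φ (f x) * f y   ≡⟨ swap (f x) (f y) (φ (f y)) (φ (f x)) ⟩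
      f y * φ (f x) + φ (f y) * f x   ≤⟨ rearrangement fy≤fx (φ-mono fy≤fx) ⟩
      f y * φ (f y) + f x * φ (f x)   ≡⟨ +-comm (f y * φ (f y)) _ ⟩
      f x * φ (f x) + f y * φ (f y)   ∎
      where open ≤-Reasoning

  cauchy : ∀ (xs : List A) (f : A → ℕ) → ∑ xs f * ∑ xs f ≤ length xs * ∑ xs (λ x → f x * f x)
  cauchy xs f = chebyshev-monotone xs f (λ n → n) (λ m≤n → m≤n)

  ⟦_⟧ : ∀ {P : Set} → Dec P → ℕ
  ⟦ yes _ ⟧ = 1
  ⟦ no  _ ⟧ = 0

  ⟦⟧≤1 : ∀ {P : Set} (d : Dec P) → ⟦ d ⟧ ≤ 1
  ⟦⟧≤1 (yes _) = s≤s z≤n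
  ⟦⟧≤1 (no  _) = z≤n

  ⟦⟧-mono : ∀ {P Q : Set} (d : Dec P) (e : Dec Q) → (P → Q) → ⟦ d ⟧ ≤ ⟦ e ⟧
  ⟦⟧-mono (no  _) e       h = z≤n
  ⟦⟧-mono (yes p) (yes _) h = ≤-refl
  ⟦⟧-mono (yes p) (no ¬q) h = ⊥-elim (¬q (h p))

  ⟦⟧-cong : ∀ {P Q : Set} (d : Dec P) (e : Dec Q) → (P → Q) → (Q → P) → ⟦ d ⟧ ≡ ⟦ e ⟧
  ⟦⟧-cong d e f g = ≤-antisym (⟦⟧-mono d e f) (⟦⟧-mono e d g)

  module _ {P : A → Set} (P? : Decidable P) where

    ∑-filter : ∀ xs (f : A → ℕ) → ∑ (filter P? xs) f ≡ ∑ xs (λ x → ⟦ P? x ⟧ * f x)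
    ∑-filter []       f = refl
    ∑-filter (x ∷ xs) f with P? x
    ... | yes _ = cong₂ _+_ (sym (+-identityʳ (f x))) (∑-filter xs f)
    ... | no  _ = ∑-filter xs f

    length-filter-∑ : ∀ xs → length (filter P? xs) ≡ ∑ xs (λ x → ⟦ P? x ⟧)
    length-filter-∑ []       = refl
    length-filter-∑ (x ∷ xs) with P? x
    ... | yes _ = cong suc (length-filter-∑ xs)
    ... | no  _ = length-filter-∑ xs

    none : ∀ {xs} → (∀ {x} → x ∈ xs → ¬ P x) → ∑ xs (λ x → ⟦ P? x ⟧) ≡ 0
    none {[]}     h = refl
    none {x ∷ xs} h with P? x
    ... | yes p = ⊥-elim (h (here refl) p)
    ... | no  _ = none (λ x∈ → h (there x∈))

    atMostOne : ∀ {xs} → Unique xs → (∀ {x y} → x ≢ y → P x → P y → ⊥) → ∑ xs (λ x → ⟦ P? x ⟧) ≤ 1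
    atMostOne []                     h = z≤n
    atMostOne {x ∷ xs} (x∉xs ∷ uniq) h with P? x
    ... | yes p = ≤-reflexive (cong suc (none λ y∈ → h (All.lookup x∉xs y∈) p))
    ... | no  _ = atMostOne uniq h

  atMostTwo : ∀ {P : A → Set} (P? : Decidable P) {xs} → Unique xs →
    (∀ {x y z} → x ≢ y → x ≢ z → y ≢ z → P x → P y → P z → ⊥) → ∑ xs (λ x → ⟦ P? x ⟧) ≤ 2
  atMostTwo P? []                              h = z≤n
  atMostTwo {A} {P} P? {x ∷ xs} (x∉xs ∷ uniq) h with P? x
  ... | no  _ = atMostTwo P? uniq h
  ... | yes p = s≤s (others uniq (λ y∈ → All.lookup x∉xs y∈))
    where
    others : ∀ {ys} → Unique ys → (∀ {y} → y ∈ ys → x ≢ y) → ∑ ys (λ y → ⟦ P? y ⟧) ≤ 1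
    others []                     x≢ = z≤n
    others {y ∷ ys} (y∉ys ∷ uniq) x≢ with P? y
    ... | yes p′ = ≤-reflexive (cong suc (none P? λ z∈ →
          h (x≢ (here refl)) (x≢ (there z∈)) (All.lookup y∉ys z∈) p p′))
    ... | no  _  = others uniq (λ y∈ → x≢ (there y∈))

  ∑-pairs : ∀ (h : B → B → ℕ) u {xs} → AllPairs (λ x y → h x y ≤ 1 × h y x ≤ 1) xs →
    All (λ x → h x x ≤ u) xs → ∑ xs (λ x → ∑ xs (h x)) ≤ u * length xs + length xs * length xs
  ∑-pairs h u []                       []          = z≤n
  ∑-pairs h u {x ∷ xs} (hx ∷ pairs) (hxx ∷ diag) = begin
    h x x + ∑ xs (h x) + ∑ xs (λ y → h y x + ∑ xs (h y))
      ≡⟨ cong (h x x + ∑ xs (h x) +_) (∑-+ xs _ _) ⟩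
    h x x + ∑ xs (h x) + (∑ xs (λ y → h y x) + ∑ xs (λ y → ∑ xs (h y)))
      ≤⟨ +-mono-≤ (+-mono-≤ hxx (row (λ y∈ → proj₁ (All.lookup hx y∈))))
                  (+-mono-≤ (row (λ y∈ → proj₂ (All.lookup hx y∈))) (∑-pairs h u pairs diag)) ⟩
    u + n + (n + (u * n + n * n))
      -- The spare 1 completes n² + 2n to (n + 1)²: the diagonal pair is also counted in the square.
      ≤⟨ n≤1+n _ ⟩
    suc (u + n + (n + (u * n + n * n)))
      ≡⟨ lemma u n ⟩
    u * suc n + suc n * suc n ∎
    where
    open ≤-Reasoning
    n = length xs
    lemma : ∀ u n → suc (u + n + (n + (u * n + n * n))) ≡ u * suc n + suc n * suc n
    lemma = solve-∀
    row : ∀ {f : _ → ℕ} → (∀ {y} → y ∈ xs → f y ≤ 1) → ∑ xs f ≤ n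
    row h = ≤-trans (∑-mono xs (λ y y∈ → h y∈)) (≤-reflexive (trans (∑-const xs 1) (*-identityʳ n)))

  ∣-∣²-expand : ∀ a b → ∣ a - b ∣ * ∣ a - b ∣ + 2 * (a * b) ≡ a * a + b * b
  ∣-∣²-expand zero    b       = refl′ b
    where
    refl′ : ∀ b → b * b + 2 * (0 * b) ≡ 0 * 0 + b * b
    refl′ = solve-∀
  ∣-∣²-expand (suc a) zero    = lemma a
    where
    lemma : ∀ a → suc a * suc a + 2 * (suc a * 0) ≡ suc a * suc a + 0 * 0
    lemma = solve-∀
  ∣-∣²-expand (suc a) (suc b) = trans (lemma₁ a b (∣ a - b ∣)) (trans (cong (λ z → z + 2 * (a + b + 1)) (∣-∣²-expand a b)) (lemma₂ a b))
    where
    lemma₁ : ∀ a b d → d * d + 2 * (suc a * suc b) ≡ (d * d + 2 * (a * b)) + 2 * (a + b + 1)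
    lemma₁ = solve-∀
    lemma₂ : ∀ a b → (a * a + b * b) + 2 * (a + b + 1) ≡ suc a * suc a + suc b * suc b
    lemma₂ = solve-∀

  -- Expanding the square gives q² Σ c² - 2 q m Σ c + m² `length xs`. The three bounds contribute q²
  -- m² + q² m² - 2 q² m², which cancels. What remains is the diagonal 2 q³ m and the error 12 q m²
  -- caused by the deficit 6 m of the first moment.
  variance : ∀ (xs : List A) (c : A → ℕ) q m → length xs ≤ q * q →
    ∑ xs (λ x → c x * c x) ≤ 2 * q * m + m * m →
    q * m ≤ ∑ xs c + 6 * m →
    ∑ xs (λ x → ∣ q * c x - m ∣ * ∣ q * c x - m ∣) ≤ 2 * (q * q * q) * m + 12 * q * (m * m)
  variance xs c q m len≤ second first = +-cancelʳ-≤ (2 * q * m * S + 2 * (q * q) * (m * m)) _ _ (begin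
    V + (2 * q * m * S + 2 * (q * q) * (m * m))
      ≡⟨ +-assoc V _ _ ⟨
    V + 2 * q * m * S + 2 * (q * q) * (m * m)
      ≡⟨ cong (_+ 2 * (q * q) * (m * m)) expanded ⟩
    q * q * S₂ + length xs * (m * m) + 2 * (q * q) * (m * m)
      ≤⟨ +-mono-≤ (+-mono-≤ (*-monoʳ-≤ (q * q) second) (*-monoˡ-≤ (m * m) len≤))
                  (≤-trans (≤-reflexive (lemma₁ q m)) (*-monoʳ-≤ (2 * q * m) first)) ⟩
    q * q * (2 * q * m + m * m) + q * q * (m * m) + 2 * q * m * (S + 6 * m)
      ≡⟨ lemma₂ q m S ⟩
    2 * (q * q * q) * m + 12 * q * (m * m) + (2 * q * m * S + 2 * (q * q) * (m * m)) ∎)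
    where
    open ≤-Reasoning
    S = ∑ xs c
    S₂ = ∑ xs (λ x → c x * c x)
    V = ∑ xs (λ x → ∣ q * c x - m ∣ * ∣ q * c x - m ∣)
    lemma₁ : ∀ q m → 2 * (q * q) * (m * m) ≡ 2 * q * m * (q * m)
    lemma₁ = solve-∀
    lemma₂ : ∀ q m S → q * q * (2 * q * m + m * m) + q * q * (m * m) + 2 * q * m * (S + 6 * m)
      ≡ 2 * (q * q * q) * m + 12 * q * (m * m) + (2 * q * m * S + 2 * (q * q) * (m * m))
    lemma₂ = solve-∀
    lemma₃ : ∀ q m c → 2 * q * m * c ≡ 2 * (q * c * m)
    lemma₃ = solve-∀
    lemma₄ : ∀ q c m → q * c * (q * c) + m * m ≡ q * q * (c * c) + m * m
    lemma₄ = solve-∀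
    expanded : V + 2 * q * m * S ≡ q * q * S₂ + length xs * (m * m)
    expanded = begin-equality
      V + 2 * q * m * S
        ≡⟨ cong (V +_) (∑-* xs (2 * q * m) c) ⟨
      V + ∑ xs (λ x → 2 * q * m * c x)
        ≡⟨ ∑-+ xs _ _ ⟨
      ∑ xs (λ x → ∣ q * c x - m ∣ * ∣ q * c x - m ∣ + 2 * q * m * c x)
        ≡⟨ ∑-cong xs (λ x → trans (cong (∣ q * c x - m ∣ * ∣ q * c x - m ∣ +_) (lemma₃ q m (c x)))
             (trans (∣-∣²-expand (q * c x) m) (lemma₄ q (c x) m))) ⟩
      ∑ xs (λ x → q * q * (c x * c x) + m * m)
        ≡⟨ ∑-+ xs _ _ ⟩
      ∑ xs (λ x → q * q * (c x * c x)) + ∑ xs (λ _ → m * m)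
        ≡⟨ cong₂ _+_ (∑-* xs (q * q) _) (∑-const xs (m * m)) ⟩
      q * q * S₂ + length xs * (m * m) ∎

  square-mono : ∀ {m n} → m ≤ n → m * m ≤ n * n
  square-mono m≤n = *-mono-≤ m≤n m≤n

  four-products : ∀ a b → 4 * (a * b) ≤ (a + b) * (a + b)
  four-products a b = begin
    4 * (a * b)                              ≤⟨ m≤n+m _ (∣ a - b ∣ * ∣ a - b ∣) ⟩
    ∣ a - b ∣ * ∣ a - b ∣ + 4 * (a * b)      ≡⟨ lemma₁ (∣ a - b ∣ * ∣ a - b ∣) (a * b) ⟩
    ∣ a - b ∣ * ∣ a - b ∣ + 2 * (a * b) + 2 * (a * b) ≡⟨ cong (_+ 2 * (a * b)) (∣-∣²-expand a b) ⟩
    a * a + b * b + 2 * (a * b)              ≡⟨ lemma₂ a b ⟩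
    (a + b) * (a + b)                        ∎
    where
    open ≤-Reasoning
    lemma₁ : ∀ d p → d + 4 * p ≡ d + 2 * p + 2 * p
    lemma₁ = solve-∀
    lemma₂ : ∀ a b → a * a + b * b + 2 * (a * b) ≡ (a + b) * (a + b)
    lemma₂ = solve-∀

  -- The term 12 q m² of the variance is absorbed by the square of the margin 12 q m.
  rich-bound : ∀ q .{{_ : NonZero q}} N m D S Y →
    q * D + (4 * N + 12 * q) * m ≤ 2 * (q * S) →
    q * S ≤ N * m + Y →
    Y * Y ≤ N * (2 * (q * q * q) * m + 12 * q * (m * m)) →
    D * D ≤ 8 * N * q * m
  rich-bound q N m D S Y rich excess Y²≤ =
    *-cancelˡ-≤ q (*-cancelˡ-≤ q (+-cancelʳ-≤ (4 * ((N + 6 * q) * (N + 6 * q)) * (m * m)) _ _ (begin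
      q * (q * (D * D)) + 4 * ((N + 6 * q) * (N + 6 * q)) * (m * m)
        ≤⟨ m≤m+n _ (2 * (q * D) * (2 * (N + 6 * q) * m)) ⟩
      q * (q * (D * D)) + 4 * ((N + 6 * q) * (N + 6 * q)) * (m * m) + 2 * (q * D) * (2 * (N + 6 * q) * m)
        ≡⟨ lemma₁ q D (N + 6 * q) m ⟩
      (q * D + 2 * (N + 6 * q) * m) * (q * D + 2 * (N + 6 * q) * m)
        ≤⟨ square-mono linear ⟩
      2 * Y * (2 * Y)
        ≡⟨ lemma₂ Y ⟩
      4 * (Y * Y)
        ≤⟨ *-monoʳ-≤ 4 Y²≤ ⟩
      4 * (N * (2 * (q * q * q) * m + 12 * q * (m * m)))
        ≡⟨ lemma₃ q N m ⟩
      q * (q * (8 * N * q * m)) + 2 * (4 * (N * (6 * q))) * (m * m)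
        -- The mixed term is 48 N q m², and 4 (N · 6q) ≤ (N + 6q)² bounds it by half of the square
        -- that was added on the left.
        ≤⟨ +-monoʳ-≤ (q * (q * (8 * N * q * m))) (*-monoˡ-≤ (m * m) (≤-trans
             (*-monoʳ-≤ 2 (four-products N (6 * q))) (*-monoˡ-≤ ((N + 6 * q) * (N + 6 * q)) (s≤s (s≤s (z≤n {2})))))) ⟩
      q * (q * (8 * N * q * m)) + 4 * ((N + 6 * q) * (N + 6 * q)) * (m * m) ∎)))
    where
    open ≤-Reasoning
    lemma₁ : ∀ q D k m → q * (q * (D * D)) + 4 * (k * k) * (m * m) + 2 * (q * D) * (2 * k * m)
      ≡ (q * D + 2 * k * m) * (q * D + 2 * k * m)
    lemma₁ = solve-∀
    lemma₂ : ∀ Y → 2 * Y * (2 * Y) ≡ 4 * (Y * Y)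
    lemma₂ = solve-∀
    lemma₃ : ∀ q N m → 4 * (N * (2 * (q * q * q) * m + 12 * q * (m * m)))
      ≡ q * (q * (8 * N * q * m)) + 2 * (4 * (N * (6 * q))) * (m * m)
    lemma₃ = solve-∀
    lemma₄ : ∀ q N m D → q * D + 2 * (N + 6 * q) * m + 2 * N * m ≡ q * D + (4 * N + 12 * q) * m
    lemma₄ = solve-∀
    lemma₅ : ∀ N m Y → 2 * (N * m + Y) ≡ 2 * Y + 2 * N * m
    lemma₅ = solve-∀
    -- Half of the margin 4 N m cancels the doubled main term 2 N m. The other half and 12 q m form
    -- the square that absorbs the error.
    linear : q * D + 2 * (N + 6 * q) * m ≤ 2 * Y
    linear = +-cancelʳ-≤ (2 * N * m) _ _ (begin
      q * D + 2 * (N + 6 * q) * m + 2 * N * m ≡⟨ lemma₄ q N m D ⟩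
      q * D + (4 * N + 12 * q) * m            ≤⟨ rich ⟩
      2 * (q * S)                             ≤⟨ *-monoʳ-≤ 2 excess ⟩
      2 * (N * m + Y)                         ≡⟨ lemma₅ N m Y ⟩
      2 * Y + 2 * N * m                       ∎)

  -- In the application S₂, S₃, S₄ are power sums of degrees, V and Z their analogues with d³
  -- replaced by the number of triples on the conic. Squaring U S₃ ≤ M S₄ ≤ 2 M V gives U² S₃² ≤ 32
  -- M² q N⁴ S₃. One factor S₃ cancels, and U³ ≤ M² S₃ turns the remaining bound on U² S₃ into one
  -- on U⁵.
  fifth-power : ∀ q N M U S₂ S₃ S₄ V Z → U * U ≤ M * S₂ → U * S₂ ≤ M * S₃ → U * S₃ ≤ M * S₄ →
    S₄ ≤ 2 * V → Z ≤ S₃ → V * V ≤ 8 * q * (N * N * N * N) * Z →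
    U * U * U * U * U ≤ 32 * (q * (N * N * N * N) * (M * M * M * M))
  fifth-power q N M U S₂ S₃ S₄ V Z h₂ h₃ h₄ S₄≤2V Z≤S₃ V²≤ = cases S₃ refl
    where
    open ≤-Reasoning
    cube : U * U * U ≤ M * M * S₃
    cube = begin
      U * U * U       ≤⟨ *-monoˡ-≤ U h₂ ⟩
      M * S₂ * U      ≡⟨ lemma M S₂ U ⟩
      M * (U * S₂)    ≤⟨ *-monoʳ-≤ M h₃ ⟩
      M * (M * S₃)    ≡⟨ *-assoc M M S₃ ⟨
      M * M * S₃      ∎
      where
      lemma : ∀ a b c → a * b * c ≡ a * (c * b)
      lemma = solve-∀
    product : U * U * S₃ * S₃ ≤ 32 * (M * M) * q * (N * N * N * N) * S₃
    product = begin
      U * U * S₃ * S₃                ≡⟨ lemma₁ U S₃ ⟩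
      U * S₃ * (U * S₃)              ≤⟨ square-mono (≤-trans h₄ (*-monoʳ-≤ M S₄≤2V)) ⟩
      M * (2 * V) * (M * (2 * V))    ≡⟨ lemma₂ M V ⟩
      4 * (M * M) * (V * V)          ≤⟨ *-monoʳ-≤ (4 * (M * M)) (≤-trans V²≤ (*-monoʳ-≤ (8 * q * (N * N * N * N)) Z≤S₃)) ⟩
      4 * (M * M) * (8 * q * (N * N * N * N) * S₃) ≡⟨ lemma₃ (M * M) q (N * N * N * N) S₃ ⟩
      32 * (M * M) * q * (N * N * N * N) * S₃      ∎
      where
      lemma₁ : ∀ U s → U * U * s * s ≡ U * s * (U * s)
      lemma₁ = solve-∀
      lemma₂ : ∀ M V → M * (2 * V) * (M * (2 * V)) ≡ 4 * (M * M) * (V * V)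
      lemma₂ = solve-∀
      lemma₃ : ∀ a q n s → 4 * a * (8 * q * n * s) ≡ 32 * a * q * n * s
      lemma₃ = solve-∀
    cases : ∀ s → S₃ ≡ s → U * U * U * U * U ≤ 32 * (q * (N * N * N * N) * (M * M * M * M))
    -- Here nothing can be cancelled, but `cube` gives U³ = 0.
    cases zero    S₃≡0 = subst (λ z → z * U * U ≤ 32 * (q * (N * N * N * N) * (M * M * M * M)))
      (sym (n≤0⇒n≡0 (≤-trans cube (≤-reflexive (trans (cong (M * M *_) S₃≡0) (*-zeroʳ (M * M))))))) z≤n
    cases (suc s) S₃≡  = begin
      U * U * U * U * U          ≡⟨ lemma₁ U ⟩
      U * U * (U * U * U)        ≤⟨ *-monoʳ-≤ (U * U) cube ⟩
      U * U * (M * M * S₃)       ≡⟨ lemma₂ (U * U) (M * M) S₃ ⟩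
      U * U * S₃ * (M * M)       ≤⟨ *-monoˡ-≤ (M * M) (cancel S₃≡) ⟩
      32 * (M * M) * q * (N * N * N * N) * (M * M) ≡⟨ lemma₃ M q (N * N * N * N) ⟩
      32 * (q * (N * N * N * N) * (M * M * M * M)) ∎
      where
      lemma₁ : ∀ U → U * U * U * U * U ≡ U * U * (U * U * U)
      lemma₁ = solve-∀
      lemma₂ : ∀ a b c → a * (b * c) ≡ a * c * b
      lemma₂ = solve-∀
      lemma₃ : ∀ M q n → 32 * (M * M) * q * n * (M * M) ≡ 32 * (q * n * (M * M * M * M))
      lemma₃ = solve-∀
      cancel : ∀ {s} → S₃ ≡ suc s → U * U * S₃ ≤ 32 * (M * M) * q * (N * N * N * N)
      cancel {s} refl = *-cancelʳ-≤ _ _ (suc s) product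

  ⟦⟧-× : ∀ {P Q : Set} (d : Dec P) (e : Dec Q) → ⟦ d ×-dec e ⟧ ≡ ⟦ d ⟧ * ⟦ e ⟧
  ⟦⟧-× (yes _) (yes _) = refl
  ⟦⟧-× (yes _) (no  _) = refl
  ⟦⟧-× (no  _) _       = refl

  ⟦⟧-idem : ∀ {P : Set} (d : Dec P) → ⟦ d ⟧ * ⟦ d ⟧ ≡ ⟦ d ⟧
  ⟦⟧-idem (yes _) = refl
  ⟦⟧-idem (no  _) = refl

  ⟦⟧-¬? : ∀ {P : Set} (d : Dec P) → ⟦ ¬? d ⟧ + ⟦ d ⟧ ≡ 1
  ⟦⟧-¬? (yes _) = refl
  ⟦⟧-¬? (no  _) = refl

  AllPairs-refine : ∀ {B : Set} {Q : B → Set} {R S : B → B → Set} → (∀ {x y} → Q x → Q y → R x y → S x y) →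
    ∀ {xs} → All Q xs → AllPairs R xs → AllPairs S xs
  AllPairs-refine f []       []       = []
  AllPairs-refine f (q ∷ qs) (r ∷ rs) =
    All.zipWith (λ { (q′ , r) → f q q′ r }) (qs , r) ∷ AllPairs-refine f qs rs

  term≤∑ : ∀ {A : Set} {xs : List A} {x} (f : A → ℕ) → x ∈ xs → f x ≤ ∑ xs f
  term≤∑ {x = x} f x∈xs with ∈-∃++ x∈xs
  ... | as , bs , refl = ≤-trans (m≤m+n (f x) (∑ bs f))
    (≤-trans (m≤n+m _ (∑ as f)) (≤-reflexive (sym (∑-++ as (x ∷ bs) f))))

-- The second moment method for an abstract conic-like family.

module Counting
  {A B : Set} (_≟_ : DecidableEquality A)
  {_∈ᶜ_ : A → B → Set} (_∈ᶜ?_ : (p : A) (C : B) → Dec (p ∈ᶜ C))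
  (_∼_ : B → B → Set)
  (q : ℕ) .{{_ : ℕ.NonZero q}}
  (W : List A) (W-unique : Unique W) (W-complete : (p : A) → p Membership.∈ W) (length-W : length W ≡ q ℕ.* q)
  where

  open import Data.Nat.Base using (_+_; _*_; _≤_; ∣_-_∣)
  open import Data.Nat.Properties hiding (_≟_)
  open ≡ using (refl; sym; trans; cong; cong₂)
  open Membership using (_∈_)
  open FiniteSums

  Triple : Set
  Triple = A × A × A

  Distinct : Triple → Set
  Distinct (p₁ , p₂ , p₃) = p₂ ≢ p₁ × p₃ ≢ p₁ × p₃ ≢ p₂

  Avoids : Triple → A → Set
  Avoids (p₁ , p₂ , p₃) p = p ≢ p₁ × p ≢ p₂ × p ≢ p₃

  Through : Triple → B → Set
  Through (p₁ , p₂ , p₃) C = p₁ ∈ᶜ C × p₂ ∈ᶜ C × p₃ ∈ᶜ C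

  distinct? : Decidable Distinct
  distinct? (p₁ , p₂ , p₃) = ¬? (p₂ ≟ p₁) ×-dec ¬? (p₃ ≟ p₁) ×-dec ¬? (p₃ ≟ p₂)

  avoids? : ∀ t → Decidable (Avoids t)
  avoids? (p₁ , p₂ , p₃) p = ¬? (p ≟ p₁) ×-dec ¬? (p ≟ p₂) ×-dec ¬? (p ≟ p₃)

  through? : ∀ t → Decidable (Through t)
  through? (p₁ , p₂ , p₃) C = (p₁ ∈ᶜ? C) ×-dec (p₂ ∈ᶜ? C) ×-dec (p₃ ∈ᶜ? C)

  on : B → A → ℕ
  on C p = ⟦ p ∈ᶜ? C ⟧

  away : A → A → ℕ
  away a p = ⟦ ¬? (p ≟ a) ⟧

  away-≤ : ∀ a {xs} (f : A → ℕ) → Unique xs → (∀ p → f p ≤ 1) →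
           ∑ xs f ≤ ∑ xs (λ p → f p * away a p) + 1
  away-≤ a {xs} f uniq f≤1 = begin
    ∑ xs f                                              ≤⟨ ∑-mono xs (λ p _ → pointwise (p ≟ a) (f≤1 p)) ⟩
    ∑ xs (λ p → f p * away a p + ⟦ p ≟ a ⟧)              ≡⟨ ∑-+ xs _ _ ⟩
    ∑ xs (λ p → f p * away a p) + ∑ xs (λ p → ⟦ p ≟ a ⟧) ≤⟨ +-monoʳ-≤ _ (atMostOne (_≟ a) uniq λ x≢y x≡a y≡a → x≢y (trans x≡a (sym y≡a))) ⟩
    ∑ xs (λ p → f p * away a p) + 1                     ∎
    where
    open ≤-Reasoning
    pointwise : ∀ {n} {P : Set} (d : Dec P) → n ≤ 1 → n ≤ n * ⟦ ¬? d ⟧ + ⟦ d ⟧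
    pointwise {n} (yes _) n≤1 = ≤-trans n≤1 (m≤n+m 1 (n * 0))
    pointwise {n} (no  _) n≤1 = ≤-reflexive (sym (trans (+-identityʳ _) (*-identityʳ n)))

  avoid-≤ : ∀ t {xs} (f : A → ℕ) → Unique xs → (∀ p → f p ≤ 1) →
            ∑ xs f ≤ ∑ (filter (avoids? t) xs) f + 3
  avoid-≤ t@(p₁ , p₂ , p₃) {xs} f uniq f≤1 = begin
    ∑ xs f                       ≤⟨ away-≤ p₁ f uniq f≤1 ⟩
    ∑ xs f₁ + 1                  ≤⟨ +-monoˡ-≤ 1 (away-≤ p₂ f₁ uniq f₁≤1) ⟩
    ∑ xs f₂ + 1 + 1              ≤⟨ +-monoˡ-≤ 1 (+-monoˡ-≤ 1 (away-≤ p₃ f₂ uniq f₂≤1)) ⟩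
    ∑ xs f₃ + 1 + 1 + 1          ≡⟨ trans (+-assoc _ 1 1) (trans (+-assoc _ 1 2) (cong (_+ 3) merge)) ⟩
    ∑ (filter (avoids? t) xs) f + 3 ∎
    where
    open ≤-Reasoning
    f₁ f₂ f₃ : A → ℕ
    f₁ p = f p * away p₁ p
    f₂ p = f₁ p * away p₂ p
    f₃ p = f₂ p * away p₃ p
    f₁≤1 : ∀ p → f₁ p ≤ 1
    f₁≤1 p = *-mono-≤ (f≤1 p) (⟦⟧≤1 (¬? (p ≟ p₁)))
    f₂≤1 : ∀ p → f₂ p ≤ 1
    f₂≤1 p = *-mono-≤ (f₁≤1 p) (⟦⟧≤1 (¬? (p ≟ p₂)))
    reorder : ∀ f a b c → f * a * b * c ≡ a * (b * c) * f
    reorder = solve-∀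
    merge : ∑ xs f₃ ≡ ∑ (filter (avoids? t) xs) f
    merge = sym (trans (∑-filter (avoids? t) xs f) (∑-cong xs λ p → trans
      (cong (_* f p) (trans (⟦⟧-× (¬? (p ≟ p₁)) (¬? (p ≟ p₂) ×-dec ¬? (p ≟ p₃)))
        (cong (away p₁ p *_) (⟦⟧-× (¬? (p ≟ p₂)) (¬? (p ≟ p₃))))))
      (sym (reorder (f p) (away p₁ p) (away p₂ p) (away p₃ p)))))

  -- The geometry needed by the counting. A lower bound for all conics would be false: an
  -- irreducible quadratic polynomial in x alone defines a conic without points. So `lower` concerns
  -- only conics through a triple.
  record ConicLike (𝓒 : List B) : Set where
    field
      distinct  : AllPairs (λ C D → ¬ C ∼ D) 𝓒
      ∼-sym     : ∀ {C D} → C ∼ D → D ∼ C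
      upper     : ∀ C → ∑ W (on C) ≤ 2 * q
      lower     : ∀ {t} C → Distinct t → Through t C → q ≤ ∑ W (on C) + 3
      bezout    : ∀ {t C D p p′} → Distinct t → Through t C → Through t D →
                  Avoids t p → Avoids t p′ → p ≢ p′ →
                  p ∈ᶜ C → p ∈ᶜ D → p′ ∈ᶜ C → p′ ∈ᶜ D → C ∼ D

  module Incidences (P : List A) (P-unique : Unique P) (𝓒 : List B) (conicLike : ConicLike 𝓒) where
    open ConicLike conicLike

    N = length P

    deg : B → ℕ
    deg C = ∑ P (on C)

    -- 4 N leaves room for twice the main term, 18 q for the points lost by removing t.
    rich? : Decidable (λ C → 4 * N + 18 * q ≤ q * deg C)
    rich? C = (4 * N + 18 * q) ≤? (q * deg C)

    R = filter rich? 𝓒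

    module _ (t : Triple) where

      L = filter (through? t) R
      W′ = filter (avoids? t) W
      P′ = filter (avoids? t) P
      m = length L
      D = ∑ L deg

      c : A → ℕ
      c p = ∑ L (λ C → on C p)

      y : A → ℕ
      y p = ∣ q * c p - m ∣

      module _ (t-distinct : Distinct t) where

        L-through : All (Through t) L
        L-through = All.all-filter (through? t) R

        L-rich : All (λ C → 4 * N + 18 * q ≤ q * deg C) L
        L-rich = All.filter⁺ (through? t) (All.all-filter rich? 𝓒)

        common : B → B → ℕ
        common C D = ∑ W′ (λ p → on C p * on D p)

        common-≤1 : ∀ {C D} → Through t C → Through t D → ¬ C ∼ D → common C D ≤ 1
        common-≤1 {C} {D} tC tD C≁D = begin
          ∑ W′ (λ p → on C p * on D p)
            ≡⟨ ∑-cong W′ (λ p → sym (⟦⟧-× (p ∈ᶜ? C) (p ∈ᶜ? D))) ⟩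
          ∑ W′ (λ p → ⟦ (p ∈ᶜ? C) ×-dec (p ∈ᶜ? D) ⟧)
            ≤⟨ ∑-mono W′ (λ p p∈ → ⟦⟧-mono ((p ∈ᶜ? C) ×-dec (p ∈ᶜ? D)) (both? p)
                 (λ both → proj₂ (∈-filter⁻ (avoids? t) {xs = W} p∈) , both)) ⟩
          ∑ W′ (λ p → ⟦ both? p ⟧)
            ≤⟨ atMostOne both? (Unique.filter⁺ (avoids? t) W-unique)
                 (λ { p≢p′ (a , pC , pD) (a′ , p′C , p′D) →
                      C≁D (bezout t-distinct tC tD a a′ p≢p′ pC pD p′C p′D) }) ⟩
          1 ∎
          where
          open ≤-Reasoning
          both? : ∀ p → Dec (Avoids t p × p ∈ᶜ C × p ∈ᶜ D)
          both? p = avoids? t p ×-dec ((p ∈ᶜ? C) ×-dec (p ∈ᶜ? D))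

        common-diagonal : ∀ C → common C C ≤ 2 * q
        common-diagonal C = begin
          ∑ W′ (λ p → on C p * on C p)  ≡⟨ ∑-cong W′ (λ p → ⟦⟧-idem (p ∈ᶜ? C)) ⟩
          ∑ W′ (on C)                   ≤⟨ ∑-⊆ (on C) (Unique.filter⁺ (avoids? t) W-unique) (λ p∈ → proj₁ (∈-filter⁻ (avoids? t) {xs = W} p∈)) ⟩
          ∑ W (on C)                    ≤⟨ upper C ⟩
          2 * q                         ∎
          where open ≤-Reasoning

        -- The square of `c` counts ordered pairs of members through a point. A pair of different
        -- members contributes at most 1, a diagonal pair the size of the conic, at most 2 q.
        second-moment : ∑ W′ (λ p → c p * c p) ≤ 2 * q * m + m * m
        second-moment = begin
          ∑ W′ (λ p → c p * c p)
            ≡⟨ ∑-cong W′ (λ p → trans (sym (∑-*ʳ L (c p) (λ C → on C p)))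
                 (∑-cong L (λ C → sym (∑-* L (on C p) (λ D → on D p))))) ⟩
          ∑ W′ (λ p → ∑ L (λ C → ∑ L (λ D → on C p * on D p)))
            ≡⟨ ∑-swap W′ L _ ⟩
          ∑ L (λ C → ∑ W′ (λ p → ∑ L (λ D → on C p * on D p)))
            ≡⟨ ∑-cong L (λ C → ∑-swap W′ L _) ⟩
          ∑ L (λ C → ∑ L (common C))
            ≤⟨ ∑-pairs common (2 * q)
                 (AllPairs-refine (λ tC tD C≁D → common-≤1 tC tD C≁D , common-≤1 tD tC (λ D∼C → C≁D (∼-sym D∼C)))
                   L-through (AllPairs.filter⁺ (through? t) (AllPairs.filter⁺ rich? distinct)))
                 (All.universal common-diagonal L) ⟩
          2 * q * m + m * m ∎
          where open ≤-Reasoning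

        first-moment : q * m ≤ ∑ W′ c + 6 * m
        first-moment = begin
          q * m                          ≡⟨ trans (*-comm q m) (sym (∑-const L q)) ⟩
          -- The 6 consists of 3 from `lower` and 3 for the points of t removed from the plane.
          ∑ L (λ _ → q)                  ≤⟨ ∑-mono L (λ C C∈ → ≤-trans (lower C t-distinct (All.lookup L-through C∈))
                                              (≤-trans (+-monoˡ-≤ 3 (avoid-≤ t (on C) W-unique (λ p → ⟦⟧≤1 (p ∈ᶜ? C))))
                                                (≤-reflexive (+-assoc _ 3 3)))) ⟩
          ∑ L (λ C → ∑ W′ (on C) + 6)    ≡⟨ ∑-+ L _ _ ⟩
          ∑ L (λ C → ∑ W′ (on C)) + ∑ L (λ _ → 6) ≡⟨ cong₂ _+_ (∑-swap L W′ on) (trans (∑-const L 6) (*-comm m 6)) ⟩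
          ∑ W′ c + 6 * m                 ∎
          where open ≤-Reasoning

        excess : q * ∑ P′ c ≤ N * m + ∑ P′ y
        excess = begin
          q * ∑ P′ c                 ≡⟨ ∑-* P′ q c ⟨
          ∑ P′ (λ p → q * c p)       ≤⟨ ∑-mono P′ (λ p _ → m≤n+∣m-n∣ (q * c p) m) ⟩
          ∑ P′ (λ p → m + y p)       ≡⟨ ∑-+ P′ _ _ ⟩
          ∑ P′ (λ _ → m) + ∑ P′ y    ≡⟨ cong (_+ ∑ P′ y) (∑-const P′ m) ⟩
          length P′ * m + ∑ P′ y     ≤⟨ +-monoˡ-≤ (∑ P′ y) (*-monoˡ-≤ m (length-filter (avoids? t) P)) ⟩
          N * m + ∑ P′ y             ∎
          where open ≤-Reasoning

        -- After Cauchy-Schwarz the sum of squares over P′ is enlarged to all of W′, where the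
        -- variance is known. Squares are nonnegative, so nothing about the position of P is needed.
        deviation : ∑ P′ y * ∑ P′ y ≤ N * (2 * (q * q * q) * m + 12 * q * (m * m))
        deviation = begin
          ∑ P′ y * ∑ P′ y                      ≤⟨ cauchy P′ y ⟩
          length P′ * ∑ P′ (λ p → y p * y p)   ≤⟨ *-mono-≤ (length-filter (avoids? t) P) (≤-trans
            (∑-⊆ (λ p → y p * y p) (Unique.filter⁺ (avoids? t) P-unique) P′⊆W′)
            (variance W′ c q m (≤-trans (length-filter (avoids? t) W) (≤-reflexive length-W)) second-moment first-moment)) ⟩
          N * (2 * (q * q * q) * m + 12 * q * (m * m)) ∎
          where
          open ≤-Reasoning
          P′⊆W′ : ∀ {p} → p ∈ P′ → p ∈ W′
          P′⊆W′ {p} p∈ = ∈-filter⁺ (avoids? t) (W-complete p) (proj₂ (∈-filter⁻ (avoids? t) {xs = P} p∈))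

        -- Richness is added to q d on the way to 2 q d. Counting d only off t loses at most 3
        -- points, hence 6 q in 2 q d; of the 18 q there remain 12 q as margin against the error in
        -- the variance.
        rich-sum : q * D + (4 * N + 12 * q) * m ≤ 2 * (q * ∑ P′ c)
        rich-sum = begin
          q * D + (4 * N + 12 * q) * m
            ≡⟨ cong₂ _+_ (sym (∑-* L q deg)) (trans (*-comm _ m) (sym (∑-const L (4 * N + 12 * q)))) ⟩
          ∑ L (λ C → q * deg C) + ∑ L (λ _ → 4 * N + 12 * q)
            ≡⟨ ∑-+ L _ _ ⟨
          ∑ L (λ C → q * deg C + (4 * N + 12 * q))
            ≤⟨ ∑-mono L (λ C C∈ → pointwise C (All.lookup L-rich C∈)) ⟩
          ∑ L (λ C → 2 * q * ∑ P′ (on C))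
            ≡⟨ ∑-* L (2 * q) _ ⟩
          2 * q * ∑ L (λ C → ∑ P′ (on C))
            ≡⟨ trans (*-assoc 2 q _) (cong (λ z → 2 * (q * z)) (∑-swap L P′ on)) ⟩
          2 * (q * ∑ P′ c) ∎
          where
          open ≤-Reasoning
          lemma₁ : ∀ N d q → q * d + (4 * N + 12 * q) + 6 * q ≡ q * d + (4 * N + 18 * q)
          lemma₁ = solve-∀
          lemma₂ : ∀ q n → q * (n + 3) + q * (n + 3) ≡ 2 * q * n + 6 * q
          lemma₂ = solve-∀
          pointwise : ∀ C → 4 * N + 18 * q ≤ q * deg C → q * deg C + (4 * N + 12 * q) ≤ 2 * q * ∑ P′ (on C)
          pointwise C rich = +-cancelʳ-≤ (6 * q) _ _ (begin
            q * deg C + (4 * N + 12 * q) + 6 * q   ≡⟨ lemma₁ N (deg C) q ⟩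
            q * deg C + (4 * N + 18 * q)           ≤⟨ +-monoʳ-≤ (q * deg C) rich ⟩
            q * deg C + q * deg C                  ≤⟨ +-mono-≤ qd≤ qd≤ ⟩
            q * (∑ P′ (on C) + 3) + q * (∑ P′ (on C) + 3) ≡⟨ lemma₂ q (∑ P′ (on C)) ⟩
            2 * q * ∑ P′ (on C) + 6 * q            ∎)
            where
            qd≤ : q * deg C ≤ q * (∑ P′ (on C) + 3)
            qd≤ = *-monoʳ-≤ q (avoid-≤ t (on C) P-unique (λ p → ⟦⟧≤1 (p ∈ᶜ? C)))

        triple-bound : D * D ≤ 8 * N * q * m
        triple-bound = rich-bound q N m D (∑ P′ c) (∑ P′ y) rich-sum excess deviation

    -- Summation over all triples of points.

    triples = cartesianProduct P (cartesianProduct P P)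
    T = filter distinct? triples

    -- This is d (d - 1) (d - 2) for d = `deg C`. The argument needs it only between d³ / 2 and d³
    -- on rich conics.
    w : B → ℕ
    w C = ∑ T (λ t → ⟦ through? t C ⟧)

    ∑D : ∑ T D ≡ ∑ R (λ C → w C * deg C)
    ∑D = trans (∑-cong T (λ t → ∑-filter (through? t) R deg))
      (trans (∑-swap T R _) (∑-cong R (λ C → ∑-*ʳ T (deg C) (λ t → ⟦ through? t C ⟧))))

    ∑m : ∑ T m ≡ ∑ R w
    ∑m = trans (∑-cong T (λ t → length-filter-∑ (through? t) R)) (∑-swap T R _)

    length-T : length T ≤ N * (N * N)
    length-T = ≤-trans (length-filter distinct? triples) (≤-reflexive
      (trans (length-cartesianProduct P (cartesianProduct P P)) (cong (N *_) (length-cartesianProduct P P))))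

    weighted-bound : ∑ R (λ C → w C * deg C) * ∑ R (λ C → w C * deg C) ≤ 8 * q * (N * N * N * N) * ∑ R w
    weighted-bound = begin
      ∑ R (λ C → w C * deg C) * ∑ R (λ C → w C * deg C)
        ≡⟨ cong₂ _*_ ∑D ∑D ⟨
      ∑ T D * ∑ T D
        ≤⟨ cauchy T D ⟩
      length T * ∑ T (λ t → D t * D t)
        ≤⟨ *-mono-≤ length-T (∑-mono T (λ t t∈ → triple-bound t (proj₂ (∈-filter⁻ distinct? {xs = triples} t∈)))) ⟩
      N * (N * N) * ∑ T (λ t → 8 * N * q * m t)
        ≡⟨ cong (N * (N * N) *_) (trans (∑-* T (8 * N * q) m) (cong (8 * N * q *_) ∑m)) ⟩
      N * (N * N) * (8 * N * q * ∑ R w)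
        ≡⟨ lemma N q (∑ R w) ⟩
      8 * q * (N * N * N * N) * ∑ R w ∎
      where
      open ≤-Reasoning
      lemma : ∀ N q Z → N * (N * N) * (8 * N * q * Z) ≡ 8 * q * (N * N * N * N) * Z
      lemma = solve-∀

    through-product : ∀ C p₁ p₂ p₃ → ⟦ through? (p₁ , p₂ , p₃) C ⟧ ≡ on C p₁ * (on C p₂ * on C p₃)
    through-product C p₁ p₂ p₃ = trans (⟦⟧-× (p₁ ∈ᶜ? C) ((p₂ ∈ᶜ? C) ×-dec (p₃ ∈ᶜ? C)))
      (cong (on C p₁ *_) (⟦⟧-× (p₂ ∈ᶜ? C) (p₃ ∈ᶜ? C)))

    ∑-triples : ∀ f → ∑ triples f ≡ ∑ P (λ p₁ → ∑ P (λ p₂ → ∑ P (λ p₃ → f (p₁ , p₂ , p₃))))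
    ∑-triples f = trans (∑-cartesianProduct P (cartesianProduct P P) f)
      (∑-cong P (λ p₁ → ∑-cartesianProduct P P (λ r → f (p₁ , r))))

    w≤deg³ : ∀ C → w C ≤ deg C * (deg C * deg C)
    w≤deg³ C = begin
      ∑ T (λ t → ⟦ through? t C ⟧)
        ≡⟨ ∑-filter distinct? triples _ ⟩
      ∑ triples (λ t → ⟦ distinct? t ⟧ * ⟦ through? t C ⟧)
        ≤⟨ ∑-mono triples (λ t _ → ≤-trans (*-monoˡ-≤ ⟦ through? t C ⟧ (⟦⟧≤1 (distinct? t))) (≤-reflexive (+-identityʳ _))) ⟩
      ∑ triples (λ t → ⟦ through? t C ⟧)
        ≡⟨ ∑-triples _ ⟩
      ∑ P (λ p₁ → ∑ P (λ p₂ → ∑ P (λ p₃ → ⟦ through? (p₁ , p₂ , p₃) C ⟧)))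
        ≡⟨ ∑-cong P (λ p₁ → trans (∑-cong P (λ p₂ → trans (∑-cong P (through-product C p₁ p₂))
             (trans (∑-* P (on C p₁) _) (cong (on C p₁ *_) (∑-* P (on C p₂) (on C))))))
             (trans (∑-* P (on C p₁) _) (cong (on C p₁ *_) (∑-*ʳ P (deg C) (on C))))) ⟩
      ∑ P (λ p₁ → on C p₁ * (deg C * deg C))
        ≡⟨ ∑-*ʳ P _ (on C) ⟩
      deg C * (deg C * deg C) ∎
      where open ≤-Reasoning

    -- The three points are chosen in turn, and each earlier choice excludes at most one point.
    falling≤w : ∀ C → deg C * ((deg C ∸ 1) * (deg C ∸ 2)) ≤ w C
    falling≤w C = begin
      d * ((d ∸ 1) * (d ∸ 2))
        ≡⟨ ∑-*ʳ P _ (on C) ⟨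
      ∑ P (λ p₁ → on C p₁ * ((d ∸ 1) * (d ∸ 2)))
        ≤⟨ ∑-mono P (λ p₁ _ → *-monoʳ-≤ (on C p₁) (second p₁)) ⟩
      ∑ P (λ p₁ → on C p₁ * ∑ P (λ p₂ → on C p₂ * away p₁ p₂ * ∑ P (λ p₃ → on C p₃ * away p₁ p₃ * away p₂ p₃)))
        ≡⟨ ∑-cong P (λ p₁ → trans (sym (∑-* P (on C p₁) _)) (∑-cong P (λ p₂ →
             trans (cong (on C p₁ *_) (sym (∑-* P (on C p₂ * away p₁ p₂) _)))
                   (sym (∑-* P (on C p₁) _))))) ⟩
      ∑ P (λ p₁ → ∑ P (λ p₂ → ∑ P (λ p₃ → on C p₁ * (on C p₂ * away p₁ p₂ * (on C p₃ * away p₁ p₃ * away p₂ p₃)))))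
        ≡⟨ ∑-cong P (λ p₁ → ∑-cong P (λ p₂ → ∑-cong P (λ p₃ → regroup p₁ p₂ p₃))) ⟩
      ∑ P (λ p₁ → ∑ P (λ p₂ → ∑ P (λ p₃ → ⟦ distinct? (p₁ , p₂ , p₃) ⟧ * ⟦ through? (p₁ , p₂ , p₃) C ⟧)))
        ≡⟨ ∑-triples _ ⟨
      ∑ triples (λ t → ⟦ distinct? t ⟧ * ⟦ through? t C ⟧)
        ≡⟨ ∑-filter distinct? triples _ ⟨
      w C ∎
      where
      open ≤-Reasoning
      d = deg C
      on≤1 : ∀ p → on C p ≤ 1
      on≤1 p = ⟦⟧≤1 (p ∈ᶜ? C)
      on-away≤1 : ∀ a p → on C p * away a p ≤ 1
      on-away≤1 a p = *-mono-≤ (on≤1 p) (⟦⟧≤1 (¬? (p ≟ a)))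
      third : ∀ p₁ p₂ → d ∸ 2 ≤ ∑ P (λ p₃ → on C p₃ * away p₁ p₃ * away p₂ p₃)
      third p₁ p₂ = m≤n+o⇒m∸n≤o d 2 (begin
        d                                                          ≤⟨ away-≤ p₁ (on C) P-unique on≤1 ⟩
        ∑ P (λ p₃ → on C p₃ * away p₁ p₃) + 1                      ≤⟨ +-monoˡ-≤ 1 (away-≤ p₂ _ P-unique (on-away≤1 p₁)) ⟩
        ∑ P (λ p₃ → on C p₃ * away p₁ p₃ * away p₂ p₃) + 1 + 1     ≡⟨ trans (+-assoc _ 1 1) (+-comm _ 2) ⟩
        2 + ∑ P (λ p₃ → on C p₃ * away p₁ p₃ * away p₂ p₃)         ∎)
      second : ∀ p₁ → (d ∸ 1) * (d ∸ 2) ≤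
        ∑ P (λ p₂ → on C p₂ * away p₁ p₂ * ∑ P (λ p₃ → on C p₃ * away p₁ p₃ * away p₂ p₃))
      second p₁ = begin
        (d ∸ 1) * (d ∸ 2)
          ≤⟨ *-monoˡ-≤ (d ∸ 2) (m≤n+o⇒m∸n≤o d 1 (≤-trans (away-≤ p₁ (on C) P-unique on≤1) (≤-reflexive (+-comm _ 1)))) ⟩
        ∑ P (λ p₂ → on C p₂ * away p₁ p₂) * (d ∸ 2)
          ≡⟨ ∑-*ʳ P (d ∸ 2) _ ⟨
        ∑ P (λ p₂ → on C p₂ * away p₁ p₂ * (d ∸ 2))
          ≤⟨ ∑-mono P (λ p₂ _ → *-monoʳ-≤ (on C p₂ * away p₁ p₂) (third p₁ p₂)) ⟩
        ∑ P (λ p₂ → on C p₂ * away p₁ p₂ * ∑ P (λ p₃ → on C p₃ * away p₁ p₃ * away p₂ p₃)) ∎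
      regroup : ∀ p₁ p₂ p₃ →
        on C p₁ * (on C p₂ * away p₁ p₂ * (on C p₃ * away p₁ p₃ * away p₂ p₃)) ≡
        ⟦ distinct? (p₁ , p₂ , p₃) ⟧ * ⟦ through? (p₁ , p₂ , p₃) C ⟧
      regroup p₁ p₂ p₃ = trans (lemma (on C p₁) (on C p₂) (on C p₃) (away p₁ p₂) (away p₁ p₃) (away p₂ p₃))
        (sym (cong₂ _*_ (trans (⟦⟧-× (¬? (p₂ ≟ p₁)) (¬? (p₃ ≟ p₁) ×-dec ¬? (p₃ ≟ p₂)))
                               (cong (away p₁ p₂ *_) (⟦⟧-× (¬? (p₃ ≟ p₁)) (¬? (p₃ ≟ p₂)))))
                        (through-product C p₁ p₂ p₃)))
        where
        lemma : ∀ a b c x y z → a * (b * x * (c * y * z)) ≡ x * (y * z) * (a * (b * c))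
        lemma = solve-∀

    -- The term 18 q in the definition of richness also gives a lower bound on the degree, more than
    -- the 6 needed to compare d³ with the number of triples.
    18≤deg : ∀ {C} → 4 * N + 18 * q ≤ q * deg C → 18 ≤ deg C
    18≤deg {C} rich = *-cancelˡ-≤ q (≤-trans (≤-reflexive (*-comm q 18)) (≤-trans (m≤n+m _ (4 * N)) rich))

    -- The threshold is sharp: at d = 5 the two sides are 25 and 24, at d = 6 they are 36 and 40.
    square≤falling : ∀ d → 6 ≤ d → d * d ≤ 2 * ((d ∸ 1) * (d ∸ 2))
    square≤falling (suc (suc d)) (s≤s (s≤s 4≤d)) = begin
      suc (suc d) * suc (suc d)          ≡⟨ lemma₁ d ⟩
      d * d + 2 * d + (2 * d + 4)        ≤⟨ +-monoʳ-≤ (d * d + 2 * d) (begin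
        2 * d + 4                        ≤⟨ +-monoʳ-≤ (2 * d) (≤-trans 4≤d (m≤m+n d (d + 0))) ⟩
        2 * d + 2 * d                    ≡⟨ lemma₂ d ⟩
        4 * d                            ≤⟨ *-monoˡ-≤ d 4≤d ⟩
        d * d                            ∎) ⟩
      d * d + 2 * d + d * d              ≡⟨ lemma₃ d ⟩
      2 * (suc d * d)                    ∎
      where
      open ≤-Reasoning
      lemma₁ : ∀ d → suc (suc d) * suc (suc d) ≡ d * d + 2 * d + (2 * d + 4)
      lemma₁ = solve-∀
      lemma₂ : ∀ d → 2 * d + 2 * d ≡ 4 * d
      lemma₂ = solve-∀
      lemma₃ : ∀ d → d * d + 2 * d + d * d ≡ 2 * (suc d * d)
      lemma₃ = solve-∀

    deg³≤2w : ∀ {C} → 4 * N + 18 * q ≤ q * deg C → deg C * (deg C * deg C) ≤ 2 * w C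
    deg³≤2w {C} rich = begin
      deg C * (deg C * deg C)                             ≤⟨ *-monoʳ-≤ (deg C) (square≤falling (deg C) (≤-trans (m≤m+n 6 12) (18≤deg {C} rich))) ⟩
      deg C * (2 * ((deg C ∸ 1) * (deg C ∸ 2)))           ≡⟨ lemma (deg C) ((deg C ∸ 1) * (deg C ∸ 2)) ⟩
      2 * (deg C * ((deg C ∸ 1) * (deg C ∸ 2)))           ≤⟨ *-monoʳ-≤ 2 (falling≤w C) ⟩
      2 * w C                                             ∎
      where
      open ≤-Reasoning
      lemma : ∀ a b → a * (2 * b) ≡ 2 * (a * b)
      lemma = solve-∀

    U = ∑ R deg

    rich-incidences : U * U * U * U * U ≤ 32 * (q * (N * N * N * N) * (length R * length R * length R * length R))
    rich-incidences = fifth-power q N (length R) U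
      (∑ R (λ C → deg C * deg C))
      (∑ R (λ C → deg C * (deg C * deg C)))
      (∑ R (λ C → deg C * (deg C * (deg C * deg C))))
      (∑ R (λ C → w C * deg C)) (∑ R w)
      (chebyshev-monotone R deg (λ n → n) (λ h → h))
      (chebyshev-monotone R deg (λ n → n * n) square-mono)
      (chebyshev-monotone R deg (λ n → n * (n * n)) (λ h → *-mono-≤ h (square-mono h)))
      (≤-trans (∑-mono R (λ C C∈ → ≤-trans
          (*-monoʳ-≤ (deg C) (deg³≤2w {C} (proj₂ (∈-filter⁻ rich? {xs = 𝓒} C∈))))
          (≤-reflexive (reorder (deg C) (w C)))))
        (≤-reflexive (∑-* R 2 _)))
      (∑-mono R (λ C _ → w≤deg³ C))
      weighted-bound
      where
      reorder : ∀ d w → d * (2 * w) ≡ 2 * (w * d)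
      reorder = solve-∀

    poor-incidences : q * ∑ (filter (λ C → ¬? (rich? C)) 𝓒) deg ≤ (4 * N + 18 * q) * length 𝓒
    poor-incidences = begin
      q * ∑ Q deg                      ≡⟨ ∑-* Q q deg ⟨
      ∑ Q (λ C → q * deg C)            ≤⟨ ∑-mono Q (λ C C∈ → ≰⇒≥ (proj₂ (∈-filter⁻ (λ C → ¬? (rich? C)) {xs = 𝓒} C∈))) ⟩
      ∑ Q (λ _ → 4 * N + 18 * q)       ≡⟨ trans (∑-const Q _) (*-comm (length Q) _) ⟩
      (4 * N + 18 * q) * length Q      ≤⟨ *-monoʳ-≤ (4 * N + 18 * q) (length-filter (λ C → ¬? (rich? C)) 𝓒) ⟩
      (4 * N + 18 * q) * length 𝓒      ∎
      where
      open ≤-Reasoning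
      Q = filter (λ C → ¬? (rich? C)) 𝓒

    incidence-bound : ∃[ I₁ ] ∃[ I₂ ] (∑ 𝓒 deg ≡ I₁ + I₂ × q * I₁ ≤ (4 * N + 18 * q) * length 𝓒 ×
      I₂ * I₂ * I₂ * I₂ * I₂ ≤ 32 * (q * (N * N * N * N) * (length 𝓒 * length 𝓒 * length 𝓒 * length 𝓒)))
    incidence-bound = ∑ Q deg , U , split , poor-incidences , ≤-trans rich-incidences
      (*-monoʳ-≤ 32 (*-monoʳ-≤ (q * (N * N * N * N))
        (*-mono-≤ (*-mono-≤ (square-mono R≤) R≤) R≤)))
      where
      Q = filter (λ C → ¬? (rich? C)) 𝓒
      R≤ = length-filter rich? 𝓒
      split : ∑ 𝓒 deg ≡ ∑ Q deg + U
      split = sym (trans (cong₂ _+_ (∑-filter (λ C → ¬? (rich? C)) 𝓒 deg) (∑-filter rich? 𝓒 deg))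
        (trans (sym (∑-+ 𝓒 _ _)) (∑-cong 𝓒 (λ C → trans
          (sym (*-distribʳ-+ (deg C) ⟦ ¬? (rich? C) ⟧ ⟦ rich? C ⟧))
          (trans (cong (_* deg C) (⟦⟧-¬? (rich? C))) (+-identityʳ (deg C)))))))

-- Conics in the finite plane form a conic-like family.

module PlaneCounting {q : ℕ} .{{_ : ℕ.NonZero q}} (F : FiniteField q) where
  open FiniteSums
  open FiniteField F
  open Quadrics F hiding (Point)
  open Quadric
  open ConicQuadrics F
  open Plane F
  open Polynomial
  open IrreducibleConic
  open IntegerSolver commutativeRing using (solve; _:=_; _:+_; _:*_; _:-_; :-_)

  ι : Fin q → Carrier
  ι = Inverse.from enumeration

  index : Carrier → Fin q
  index = Inverse.to enumeration

  ι-index : ∀ x → ι (index x) ≈ x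
  ι-index = Inverse.strictlyInverseʳ enumeration

  ι-injective : ∀ {i j} → ι i ≈ ι j → i ≡ j
  ι-injective {i} {j} ιi≈ιj = ≡.trans (≡.sym (Inverse.strictlyInverseˡ enumeration i))
    (≡.trans (Inverse.to-cong enumeration ιi≈ιj) (Inverse.strictlyInverseˡ enumeration j))

  -- Points are replaced by pairs of indices, on which propositional equality is decidable and
  -- corresponds to the equality of points.
  A : Set
  A = Fin q × Fin q

  pt : A → Point
  pt (i , j) = ι i , ι j

  pt-injective : ∀ {p p′} → p ≢ p′ → pt p ≉ₚ pt p′
  pt-injective p≢p′ (x≈ , y≈) = p≢p′ (≡.cong₂ _,_ (ι-injective x≈) (ι-injective y≈))

  _≟ᴬ_ : DecidableEquality A
  _≟ᴬ_ = ≡-dec Fin._≟_ Fin._≟_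

  W : List A
  W = cartesianProduct (allFin q) (allFin q)

  W-unique : Unique W
  W-unique = Unique.cartesianProduct⁺ (Unique.allFin⁺ q) (Unique.allFin⁺ q)

  W-complete : ∀ p → p Membership.∈ W
  W-complete (i , j) = ∈-cartesianProduct⁺ (∈-allFin i) (∈-allFin j)

  length-allFin : length (allFin q) ≡ q
  length-allFin = length-tabulate {n = q} (λ i → i)

  length-W : length W ≡ q ℕ.* q
  length-W = ≡.trans (length-cartesianProduct (allFin q) (allFin q)) (≡.cong₂ ℕ._*_ length-allFin length-allFin)

  κ : IrreducibleConic → Quadric
  κ C = quadratic (polynomial C)

  κ-noLine : ∀ C → NoLine (κ C)
  κ-noLine C = noLine (degree C) (irreducible C)

  ∈ᶜ⇒∈ : ∀ C {P} → P ∈ᶜ C → P ∈ κ C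
  ∈ᶜ⇒∈ C {x , y} h = trans (sym (eval≈value (degree C) (irreducible C) x y)) h

  ∈⇒∈ᶜ : ∀ C {P} → P ∈ κ C → P ∈ᶜ C
  ∈⇒∈ᶜ C {x , y} h = trans (eval≈value (degree C) (irreducible C) x y) h

  open Counting _≟ᴬ_ {λ p C → pt p ∈ᶜ C} (λ p C → pt p ∈ᶜ? C) _≈ᶜ_ q W W-unique W-complete length-W

  -- The plane is cut into q vertical lines. Each carries at most two points of the conic, since
  -- three would be collinear.
  upper : ∀ C → ∑ W (on C) ℕ.≤ 2 ℕ.* q
  upper C = begin
    ∑ W (on C)                                         ≡⟨ ∑-cartesianProduct (allFin q) (allFin q) (on C) ⟩
    ∑ (allFin q) (λ i → ∑ (allFin q) (λ j → on C (i , j))) ≤⟨ ∑-mono (allFin q) (λ i _ →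
        atMostTwo (λ j → pt (i , j) ∈ᶜ? C) (Unique.allFin⁺ q) (vertical i)) ⟩
    ∑ (allFin q) (λ _ → 2)                             ≡⟨ ∑-const (allFin q) 2 ⟩
    length (allFin q) ℕ.* 2                            ≡⟨ ≡.trans (≡.cong (ℕ._* 2) length-allFin) (ℕ.*-comm q 2) ⟩
    2 ℕ.* q                                            ∎
    where
    open ℕ.≤-Reasoning
    vertical : ∀ i {j j′ j″} → j ≢ j′ → j ≢ j″ → j′ ≢ j″ →
      pt (i , j) ∈ᶜ C → pt (i , j′) ∈ᶜ C → pt (i , j″) ∈ᶜ C → ⊥
    vertical i {j} {j′} {j″} j≢j′ j≢j″ j′≢j″ h h′ h″ = no-three-collinear (κ-noLine C)
      (∈ᶜ⇒∈ C h) (∈ᶜ⇒∈ C h′) (∈ᶜ⇒∈ C h″) (off j≢j′) (off j≢j″) (off j′≢j″)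
      (+≈0 (*ˡ≈0 _ (-‿inverseʳ (ι i))) (-≈0 (*ˡ≈0 _ (-‿inverseʳ (ι i)))))
      where
      off : ∀ {j j′} → j ≢ j′ → pt (i , j) ≉ₚ pt (i , j′)
      off j≢j′ = pt-injective (λ eq → j≢j′ (≡.cong proj₂ eq))

  -- Newton's divided differences of a + b s + c s²: the first ones are b + c (s + t), the second
  -- one is c.
  three-roots : ∀ κ {s s′ s″} → s ≉ s′ → s ≉ s″ → s′ ≉ s″ →
    form κ 1# s ≈ 0# → form κ 1# s′ ≈ 0# → form κ 1# s″ ≈ 0# → a κ ≈ 0# × b κ ≈ 0# × c κ ≈ 0#
  three-roots κ {s} {s′} {s″} s≉s′ s≉s″ s′≉s″ h h′ h″ = a≈0 , b≈0 , c≈0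
    where
    nonzero : ∀ {x y} → x ≉ y → x - y ≉ 0#
    nonzero x≉y x-y≈0 = x≉y (-≈0⇒≈ x-y≈0)

    difference : ∀ {t} → s ≉ t → form κ 1# t ≈ 0# → b κ * 1# + c κ * (s + t) ≈ 0#
    difference {t} s≉t ht = x≉0∧xy≈0⇒y≈0 (nonzero s≉t) (trans
      (solve 6 (λ a b c o s t → (s :- t) :* (b :* o :+ c :* (s :+ t)) := form′ a b c o s :- form′ a b c o t)
        refl (a κ) (b κ) (c κ) 1# s t)
      (+≈0 h (-≈0 ht)))

    c≈0 : c κ ≈ 0#
    c≈0 = x≉0∧xy≈0⇒y≈0 (nonzero s′≉s″) (trans
      (solve 6 (λ b c o s s′ s″ → (s′ :- s″) :* c := (b :* o :+ c :* (s :+ s′)) :- (b :* o :+ c :* (s :+ s″)))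
        refl (b κ) (c κ) 1# s s′ s″)
      (+≈0 (difference s≉s′ h′) (-≈0 (difference s≉s″ h″))))

    b≈0 : b κ ≈ 0#
    b≈0 = trans (sym (*-identityʳ _)) (trans (sym (+-identityʳ _))
      (trans (+-congˡ (sym (*ˡ≈0 (s + s′) c≈0))) (difference s≉s′ h′)))

    a≈0 : a κ ≈ 0#
    a≈0 = trans (sym (trans (*-congˡ (*-identityʳ 1#)) (*-identityʳ _)))
      (trans (sym (trans (+-assoc _ _ _) (trans (+-congˡ (+≈0 (*ˡ≈0 _ b≈0) (*ˡ≈0 _ c≈0))) (+-identityʳ _)))) h)

  two-roots : ∀ κ {s s′} → s ≉ s′ → linear κ 1# s ≈ 0# → linear κ 1# s′ ≈ 0# → d κ ≈ 0# × e κ ≈ 0#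
  two-roots κ {s} {s′} s≉s′ h h′ = d≈0 , e≈0
    where
    e≈0 : e κ ≈ 0#
    e≈0 = x≉0∧xy≈0⇒y≈0 (λ s-s′≈0 → s≉s′ (-≈0⇒≈ s-s′≈0)) (trans
      (solve 5 (λ d e o s s′ → (s :- s′) :* e := linear′ d e o s :- linear′ d e o s′) refl (d κ) (e κ) 1# s s′)
      (+≈0 h (-≈0 h′)))
    d≈0 : d κ ≈ 0#
    d≈0 = trans (sym (*-identityʳ _)) (trans (sym (+-identityʳ _)) (trans (+-congˡ (sym (*ˡ≈0 s e≈0))) h))

  -- The line of slope s through a point of the conic meets it in a second point
  -- unless s is one of at most three exceptional slopes.
  module Slopes (C : IrreducibleConic) (p₁ p₂ : A) (p₂≢p₁ : p₂ ≢ p₁)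
                (p₁∈C : pt p₁ ∈ᶜ C) (p₂∈C : pt p₂ ∈ᶜ C) where

    x = ι (proj₁ p₁)
    y = ι (proj₂ p₁)
    κ₀ = recentre (κ C) x y

    -- The second point matters here. If p₁ were singular, the chord to p₂ would have zero linear
    -- part, hence zero form, and its line would lie in the conic. A conic with a single point, such
    -- as the zero set of an anisotropic form, is singular there.
    not-singular : ¬ (d κ₀ ≈ 0# × e κ₀ ≈ 0#)
    not-singular (d≈0 , e≈0) = ≉⇒-≉0 (pt-injective (λ eq → p₂≢p₁ (≡.sym eq)))
      (κ-noLine C x y u v (∈ᶜ⇒∈ C p₁∈C) linear≈0
        (trans (sym (+-identityʳ _)) (trans (+-congˡ (sym linear≈0))
          (chord-recentre (κ C) (∈ᶜ⇒∈ C p₁∈C) (∈ᶜ⇒∈ C p₂∈C)))))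
      where
      u = ι (proj₁ p₂) - x
      v = ι (proj₂ p₂) - y
      linear≈0 : linear κ₀ u v ≈ 0#
      linear≈0 = +≈0 (*ˡ≈0 u d≈0) (*ˡ≈0 v e≈0)

    asymptotic? : ∀ s → Dec (form (κ C) 1# (ι s) ≈ 0#)
    asymptotic? s = form (κ C) 1# (ι s) ≟ 0#

    tangent? : ∀ s → Dec (linear κ₀ 1# (ι s) ≈ 0#)
    tangent? s = linear κ₀ 1# (ι s) ≟ 0#

    -- The nonzero horizontal displacement excludes p₁, the point common to all these lines, so that
    -- every other point determines its slope.
    OnLine : Fin q → A → Set
    OnLine s (i , j) = ι i - x ≉ 0# × ι j - y ≈ (ι i - x) * ι s

    onLine? : ∀ s p → Dec (OnLine s p)
    onLine? s (i , j) = ¬? ((ι i - x) ≟ 0#) ×-dec ((ι j - y) ≟ ((ι i - x) * ι s))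

    slope-unique : ∀ p {s s′} → s ≢ s′ → OnLine s p → OnLine s′ p → ⊥
    slope-unique (i , j) {s} {s′} s≢s′ (u≉0 , v≈) (_ , v≈′) = s≢s′ (ι-injective (-≈0⇒≈
      (x≉0∧xy≈0⇒y≈0 u≉0 (trans
        (solve 3 (λ u s s′ → u :* (s :- s′) := u :* s :- u :* s′) refl (ι i - x) (ι s) (ι s′))
        (≈⇒-≈0 (trans (sym v≈) v≈′))))))

    -- At p₁ + l (1 , σ) the equation of the conic is l (l Φ + Λ). The root l = -Λ / Φ exists
    -- because Φ is nonzero and differs from the root 0 of p₁ because Λ is.
    second-point : ∀ s → form (κ C) 1# (ι s) ≉ 0# → linear κ₀ 1# (ι s) ≉ 0# →
      ∃[ p ] (pt p ∈ᶜ C × OnLine s p)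
    second-point s Φ≉0 Λ≉0 = (index (x + l) , index (y + l * σ)) , ∈⇒∈ᶜ C on-conic , u≉0 , slope
      where
      open SetoidReasoning setoid
      σ = ι s
      Φ = form (κ C) 1# σ
      Λ = linear κ₀ 1# σ
      w = proj₁ (inverse Φ≉0)
      l = - Λ * w

      lΦ≈-Λ : l * Φ ≈ - Λ
      lΦ≈-Λ = trans (solve 3 (λ Λ w Φ → (:- Λ) :* w :* Φ := (:- Λ) :* (Φ :* w)) refl Λ w Φ)
        (trans (*-congˡ (proj₂ (inverse Φ≉0))) (*-identityʳ _))

      l≉0 : l ≉ 0#
      l≉0 l≈0 = Λ≉0 (trans (solve 1 (λ Λ → Λ := :- (:- Λ)) refl Λ)
        (-≈0 (trans (sym lΦ≈-Λ) (*ˡ≈0 Φ l≈0))))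

      offset : ∀ z t → ι (index (z + t)) - z ≈ t
      offset z t = trans (+-congʳ (ι-index (z + t))) (solve 2 (λ z t → z :+ t :- z := t) refl z t)

      u≉0 : ι (index (x + l)) - x ≉ 0#
      u≉0 u≈0 = l≉0 (trans (sym (offset x l)) u≈0)

      slope : ι (index (y + l * σ)) - y ≈ (ι (index (x + l)) - x) * σ
      slope = trans (offset y (l * σ)) (*-congʳ (sym (offset x l)))

      on-conic : value (κ C) (ι (index (x + l))) (ι (index (y + l * σ))) ≈ 0#
      on-conic = begin
        value (κ C) (ι (index (x + l))) (ι (index (y + l * σ)))
          ≈⟨ value-cong (κ C) (ι-index _) (ι-index _) ⟩
        value (κ C) (x + l) (y + l * σ)
          ≈⟨ value-cong (κ C) (+-congˡ (*-identityʳ l)) refl ⟨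
        value (κ C) (x + l * 1#) (y + l * σ)
          ≈⟨ value-recentre (κ C) x y (l * 1#) (l * σ) ⟨
        form (κ C) (l * 1#) (l * σ) + linear κ₀ (l * 1#) (l * σ) + value (κ C) x y
          ≈⟨ +-cong (+-cong (form-scale (κ C) l 1# σ) (linear-scale κ₀ l 1# σ)) (∈ᶜ⇒∈ C p₁∈C) ⟩
        l * l * Φ + l * Λ + 0#
          ≈⟨ +-identityʳ _ ⟩
        l * l * Φ + l * Λ
          ≈⟨ solve 3 (λ l Φ Λ → l :* l :* Φ :+ l :* Λ := l :* (l :* Φ :+ Λ)) refl l Φ Λ ⟩
        l * (l * Φ + Λ)
          ≈⟨ *≈0 l (trans (+-congʳ lΦ≈-Λ) (-‿inverseˡ Λ)) ⟩
        0# ∎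

    slopes : List (Fin q)
    slopes = allFin q

    slope-cover : ∀ s → 1 ℕ.≤ ∑ W (λ p → on C p ℕ.* ⟦ onLine? s p ⟧) ℕ.+ (⟦ asymptotic? s ⟧ ℕ.+ ⟦ tangent? s ⟧)
    slope-cover s = cases (asymptotic? s) (tangent? s)
      where
      S = ∑ W (λ p → on C p ℕ.* ⟦ onLine? s p ⟧)
      yes-1 : ∀ {P : Set} (δ : Dec P) → P → 1 ℕ.≤ ⟦ δ ⟧
      yes-1 (yes _) _ = ℕ.≤-refl
      yes-1 (no ¬p) p = contradiction p ¬p
      cases : (δ : Dec (form (κ C) 1# (ι s) ≈ 0#)) (ε : Dec (linear κ₀ 1# (ι s) ≈ 0#)) → 1 ℕ.≤ S ℕ.+ (⟦ δ ⟧ ℕ.+ ⟦ ε ⟧)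
      cases (yes _) ε       = ℕ.≤-trans (ℕ.m≤m+n 1 ⟦ ε ⟧) (ℕ.m≤n+m _ S)
      cases (no _)  (yes _) = ℕ.m≤n+m 1 S
      cases (no Φ≉0) (no Λ≉0) = found (second-point s Φ≉0 Λ≉0)
        where
        found : ∃[ p ] (pt p ∈ᶜ C × OnLine s p) → 1 ℕ.≤ S ℕ.+ 0
        found (p , p∈C , line) = ℕ.≤-trans
          (ℕ.≤-trans (ℕ.*-mono-≤ (yes-1 (pt p ∈ᶜ? C) p∈C) (yes-1 (onLine? s p) line))
            (term≤∑ (λ p → on C p ℕ.* ⟦ onLine? s p ⟧) (W-complete p)))
          (ℕ.m≤m+n S 0)

    -- Pairs of a slope and a point are counted twice. The exceptions are at most two roots of the
    -- leading form and at most one tangent slope, which gives the 3.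
    many-points : q ℕ.≤ ∑ W (on C) ℕ.+ 3
    many-points = begin
      q
        ≡⟨ ≡.trans (≡.sym length-allFin) (≡.trans (≡.sym (ℕ.*-identityʳ _)) (≡.sym (∑-const slopes 1))) ⟩
      ∑ slopes (λ _ → 1)
        ≤⟨ ∑-mono slopes (λ s _ → slope-cover s) ⟩
      ∑ slopes (λ s → ∑ W (λ p → on C p ℕ.* ⟦ onLine? s p ⟧) ℕ.+ (⟦ asymptotic? s ⟧ ℕ.+ ⟦ tangent? s ⟧))
        ≡⟨ ≡.trans (∑-+ slopes _ _) (≡.cong₂ ℕ._+_ (∑-swap slopes W _) (∑-+ slopes _ _)) ⟩
      ∑ W (λ p → ∑ slopes (λ s → on C p ℕ.* ⟦ onLine? s p ⟧)) ℕ.+ (∑ slopes (λ s → ⟦ asymptotic? s ⟧) ℕ.+ ∑ slopes (λ s → ⟦ tangent? s ⟧))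
        ≤⟨ ℕ.+-mono-≤ (∑-mono W one-slope) (ℕ.+-mono-≤
             (atMostTwo asymptotic? (Unique.allFin⁺ q) (λ s≢s′ s≢s″ s′≢s″ h h′ h″ → form-nonzero (degree C) (irreducible C)
               (three-roots (κ C) (s≢s′ ∘ ι-injective) (s≢s″ ∘ ι-injective) (s′≢s″ ∘ ι-injective) h h′ h″)))
             (atMostOne tangent? (Unique.allFin⁺ q) (λ s≢s′ h h′ → not-singular (two-roots κ₀ (s≢s′ ∘ ι-injective) h h′)))) ⟩
      ∑ W (on C) ℕ.+ 3 ∎
      where
      open ℕ.≤-Reasoning
      one-slope : ∀ p → p Membership.∈ W → ∑ slopes (λ s → on C p ℕ.* ⟦ onLine? s p ⟧) ℕ.≤ on C p
      one-slope p _ = begin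
        ∑ slopes (λ s → on C p ℕ.* ⟦ onLine? s p ⟧)  ≡⟨ ∑-* slopes (on C p) _ ⟩
        on C p ℕ.* ∑ slopes (λ s → ⟦ onLine? s p ⟧)  ≤⟨ ℕ.*-monoʳ-≤ (on C p) (atMostOne (λ s → onLine? s p) (Unique.allFin⁺ q) (slope-unique p)) ⟩
        on C p ℕ.* 1                                 ≡⟨ ℕ.*-identityʳ _ ⟩
        on C p                                       ∎

  lower : ∀ {t} C → Distinct t → Through t C → q ℕ.≤ ∑ W (on C) ℕ.+ 3
  lower {p₁ , p₂ , p₃} C (p₂≢p₁ , _) (p₁∈C , p₂∈C , _) = Slopes.many-points C p₁ p₂ p₂≢p₁ p₁∈C p₂∈C

  -- The three points of t together with p and p′ are five distinct common points. `D` is taken as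
  -- the reference quadric because `_≈ᶜ_` asks for the first conic as a multiple of the second.
  bezout : ∀ {t C D p p′} → Distinct t → Through t C → Through t D →
    Avoids t p → Avoids t p′ → p ≢ p′ →
    pt p ∈ᶜ C → pt p ∈ᶜ D → pt p′ ∈ᶜ C → pt p′ ∈ᶜ D → C ≈ᶜ D
  bezout {p₁ , p₂ , p₃} {C} {D} {p} {p′} (p₂≢p₁ , p₃≢p₁ , p₃≢p₂) (1C , 2C , 3C) (1D , 2D , 3D)
    (p≢p₁ , p≢p₂ , p≢p₃) (p′≢p₁ , p′≢p₂ , p′≢p₃) p≢p′ pC pD p′C p′D =
    μ , ≉0⇒# μ≉0 , coefficients
    where
    flip : ∀ {p p′} → p ≢ p′ → pt p′ ≉ₚ pt p
    flip p≢p′ = pt-injective (λ eq → p≢p′ (≡.sym eq))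

    result = five-points {κ D} {κ C} (κ-noLine D)
      (∈ᶜ⇒∈ D 1D) (∈ᶜ⇒∈ D 2D) (∈ᶜ⇒∈ D 3D) (∈ᶜ⇒∈ D pD) (∈ᶜ⇒∈ D p′D)
      (∈ᶜ⇒∈ C 1C) (∈ᶜ⇒∈ C 2C) (∈ᶜ⇒∈ C 3C) (∈ᶜ⇒∈ C pC) (∈ᶜ⇒∈ C p′C)
      (flip p₂≢p₁) (flip p₃≢p₁) (flip p≢p₁) (flip p′≢p₁) (flip p₃≢p₂)
      (flip p≢p₂) (flip p′≢p₂) (flip p≢p₃) (flip p′≢p₃) (pt-injective p≢p′)
    μ = proj₁ result
    open _≈[_]_ (proj₂ result)

    μ≉0 : μ ≉ 0#
    μ≉0 μ≈0 = form-nonzero (degree C) (irreducible C)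
      (trans a≈ (*ˡ≈0 _ μ≈0) , trans b≈ (*ˡ≈0 _ μ≈0) , trans c≈ (*ˡ≈0 _ μ≈0))

    high : ∀ i j → 2 ℕ.< i ℕ.+ j → coeff (polynomial C) i j ≈ μ * coeff (polynomial D) i j
    high i j 2<i+j = trans (proj₁ (degree C) i j 2<i+j) (sym (*≈0 μ (proj₁ (degree D) i j 2<i+j)))

    coefficients : ∀ i j → coeff (polynomial C) i j ≈ μ * coeff (polynomial D) i j
    coefficients 0 0 = f≈
    coefficients 1 0 = d≈
    coefficients 0 1 = e≈
    coefficients 2 0 = a≈
    coefficients 1 1 = b≈
    coefficients 0 2 = c≈
    coefficients 0 (suc (suc (suc j))) = high 0 (3 ℕ.+ j) (s≤s (s≤s (s≤s z≤n)))
    coefficients 1 (suc (suc j))       = high 1 (2 ℕ.+ j) (s≤s (s≤s (s≤s z≤n)))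
    coefficients 2 (suc j)             = high 2 (1 ℕ.+ j) (s≤s (s≤s (s≤s z≤n)))
    coefficients (suc (suc (suc i))) j = high (3 ℕ.+ i) j (s≤s (s≤s (s≤s z≤n)))

  module _ (𝓟 : FiniteSubset pointSetoid) (𝓒 : FiniteSubset conicSetoid) where
    open FiniteSubset

    indices : List A
    indices = map (λ P → index (proj₁ P) , index (proj₂ P)) (elements 𝓟)

    indices-unique : Unique indices
    indices-unique = UniqueSetoid.map⁺ pointSetoid (≡.setoid A) injective (unique 𝓟)
      where
      injective : ∀ {P Q : Point} → (index (proj₁ P) , index (proj₂ P)) ≡ (index (proj₁ Q) , index (proj₂ Q)) → P ≈ₚ Q
      injective {x , y} {x′ , y′} eq =
        trans (sym (ι-index x)) (trans (reflexive (≡.cong (λ p → ι (proj₁ p)) eq)) (ι-index x′)) ,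
        trans (sym (ι-index y)) (trans (reflexive (≡.cong (λ p → ι (proj₂ p)) eq)) (ι-index y′))

    conicLike : ConicLike (elements 𝓒)
    conicLike = record
      { distinct = unique 𝓒
      ; ∼-sym    = λ {C} {D} → Setoid.sym conicSetoid {C} {D}
      ; upper    = upper
      ; lower    = λ {t} → lower {t}
      ; bezout   = λ {t} {C} {D} {p} {p′} → bezout {t} {C} {D} {p} {p′}
      }

    open Incidences indices indices-unique (elements 𝓒) conicLike using (deg; incidence-bound)

    I≡∑deg : I 𝓟 𝓒 ≡ ∑ (elements 𝓒) deg
    I≡∑deg = ≡.trans (length-filter-∑ (λ pC → proj₁ pC ∈ᶜ? proj₂ pC) (cartesianProduct (elements 𝓟) (elements 𝓒)))
      (≡.trans (∑-cartesianProduct (elements 𝓟) (elements 𝓒) _)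
      (≡.trans (∑-swap (elements 𝓟) (elements 𝓒) _)
      (∑-cong (elements 𝓒) (λ C → ≡.sym (≡.trans
        (∑-map (elements 𝓟))
        (∑-cong (elements 𝓟) (same C)))))))
      where
      ∑-map : ∀ {X Y : Set} {f : X → Y} {g : Y → ℕ} xs → ∑ (map f xs) g ≡ ∑ xs (λ x → g (f x))
      ∑-map []       = ≡.refl
      ∑-map {g = g} (x ∷ xs) = ≡.cong (g _ ℕ.+_) (∑-map xs)
      same : ∀ C P → ⟦ pt (index (proj₁ P) , index (proj₂ P)) ∈ᶜ? C ⟧ ≡ ⟦ P ∈ᶜ? C ⟧
      same C (x , y) = ⟦⟧-cong (pt (index x , index y) ∈ᶜ? C) ((x , y) ∈ᶜ? C)
        (λ h → ∈⇒∈ᶜ C (trans (sym (value-cong (κ C) (ι-index x) (ι-index y))) (∈ᶜ⇒∈ C h)))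
        (λ h → ∈⇒∈ᶜ C (trans (value-cong (κ C) (ι-index x) (ι-index y)) (∈ᶜ⇒∈ C h)))

    incidences : let N = ∣ 𝓟 ∣ ; M = ∣ 𝓒 ∣ in
      ∃[ I₁ ] ∃[ I₂ ] (I 𝓟 𝓒 ≡ I₁ ℕ.+ I₂ × q ℕ.* I₁ ℕ.≤ (4 ℕ.* N ℕ.+ 18 ℕ.* q) ℕ.* M ×
        I₂ ℕ.* I₂ ℕ.* I₂ ℕ.* I₂ ℕ.* I₂ ℕ.≤
          32 ℕ.* (q ℕ.* (N ℕ.* N ℕ.* N ℕ.* N) ℕ.* (M ℕ.* M ℕ.* M ℕ.* M)))
    incidences = ≡.subst
      (λ n → ∃[ I₁ ] ∃[ I₂ ] (I 𝓟 𝓒 ≡ I₁ ℕ.+ I₂ ×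
        q ℕ.* I₁ ℕ.≤ (4 ℕ.* n ℕ.+ 18 ℕ.* q) ℕ.* ∣ 𝓒 ∣ ×
        I₂ ℕ.* I₂ ℕ.* I₂ ℕ.* I₂ ℕ.* I₂ ℕ.≤
          32 ℕ.* (q ℕ.* (n ℕ.* n ℕ.* n ℕ.* n) ℕ.* (∣ 𝓒 ∣ ℕ.* ∣ 𝓒 ∣ ℕ.* ∣ 𝓒 ∣ ℕ.* ∣ 𝓒 ∣))))
      (length-map _ (elements 𝓟))
      (replace _ incidence-bound)
      where
      replace : ∀ (Bound : ℕ → ℕ → Set) → ∃[ I₁ ] ∃[ I₂ ] (∑ (elements 𝓒) deg ≡ I₁ ℕ.+ I₂ × Bound I₁ I₂) →
        ∃[ I₁ ] ∃[ I₂ ] (I 𝓟 𝓒 ≡ I₁ ℕ.+ I₂ × Bound I₁ I₂)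
      replace _ (I₁ , I₂ , eq , h) = I₁ , I₂ , ≡.trans I≡∑deg eq , h

-- Passage to rational numbers and fractional powers.

open import Data.Integer.Base using (+_)
open import Data.Rational.Base using (_<_; _≤_; _+_; _*_; _/_)
open ≡ using (refl; sym; trans; cong; cong₂; subst; subst₂)
open RawSemiringDefinitions ℚ.+-*-rawSemiring using (_^_)
open CommutativeExp (CommutativeRing.commutativeSemiring ℚ.+-*-commutativeRing) using (^-distrib-*)

toℚᵘ-fromℕ : ∀ n → toℚᵘ (fromℕ n) ℚᵘ.≃ mkℚᵘ (+ n) 0
toℚᵘ-fromℕ n = ℚ.toℚᵘ-fromℚᵘ (mkℚᵘ (+ n) 0)

fromℕ-+ : ∀ m n → fromℕ (m ℕ.+ n) ≡ fromℕ m + fromℕ n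
fromℕ-+ m n = ℚ.toℚᵘ-injective (ℚᵘ.≃-trans (toℚᵘ-fromℕ (m ℕ.+ n)) (ℚᵘ.≃-trans
  (*≡* (cong (ℤ._* + 1) (sym (cong₂ ℤ._+_ (ℤ.*-identityʳ (+ m)) (ℤ.*-identityʳ (+ n))))))
  (ℚᵘ.≃-sym (ℚᵘ.≃-trans (ℚ.toℚᵘ-homo-+ (fromℕ m) (fromℕ n)) (ℚᵘ.+-cong (toℚᵘ-fromℕ m) (toℚᵘ-fromℕ n))))))

fromℕ-* : ∀ m n → fromℕ (m ℕ.* n) ≡ fromℕ m * fromℕ n
fromℕ-* m n = ℚ.toℚᵘ-injective (ℚᵘ.≃-trans (toℚᵘ-fromℕ (m ℕ.* n)) (ℚᵘ.≃-trans
  (*≡* (cong (ℤ._* + 1) (ℤ.pos-* m n)))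
  (ℚᵘ.≃-sym (ℚᵘ.≃-trans (ℚ.toℚᵘ-homo-* (fromℕ m) (fromℕ n)) (ℚᵘ.*-cong (toℚᵘ-fromℕ m) (toℚᵘ-fromℕ n))))))

fromℕ-mono-≤ : ∀ {m n} → m ℕ.≤ n → fromℕ m ≤ fromℕ n
fromℕ-mono-≤ {m} {n} m≤n = ℚ.toℚᵘ-cancel-≤ (ℚᵘ.≤-respˡ-≃ (ℚᵘ.≃-sym (toℚᵘ-fromℕ m))
  (ℚᵘ.≤-respʳ-≃ (ℚᵘ.≃-sym (toℚᵘ-fromℕ n)) (*≤* (ℤ.*-monoʳ-≤-nonNeg (+ 1) (ℤ.+≤+ m≤n)))))

fromℕ-mono-< : ∀ {m n} → m ℕ.< n → fromℕ m < fromℕ n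
fromℕ-mono-< {m} {n} m<n = ℚ.toℚᵘ-cancel-< (ℚᵘ.<-respˡ-≃ (ℚᵘ.≃-sym (toℚᵘ-fromℕ m))
  (ℚᵘ.<-respʳ-≃ (ℚᵘ.≃-sym (toℚᵘ-fromℕ n)) (*<* (ℤ.*-monoʳ-<-pos (+ 1) (ℤ.+<+ m<n)))))

0≤fromℕ : ∀ n → 0ℚ ≤ fromℕ n
0≤fromℕ n = fromℕ-mono-≤ {0} {n} ℕ.z≤n

fromℕ-^ : ∀ m n → fromℕ (m ℕ.^ n) ≡ fromℕ m ^ n
fromℕ-^ m ℕ.zero  = refl
fromℕ-^ m (suc n) = trans (fromℕ-* m (m ℕ.^ n)) (cong (fromℕ m *_) (fromℕ-^ m n))

fromℕ-quotient : ∀ q .{{_ : ℕ.NonZero q}} n → fromℕ q * (+ n / q) ≡ fromℕ n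
fromℕ-quotient (suc k) n = ℚ.toℚᵘ-injective (ℚᵘ.≃-trans (ℚ.toℚᵘ-homo-* (fromℕ (suc k)) (+ n / suc k))
  (ℚᵘ.≃-trans (ℚᵘ.*-cong (toℚᵘ-fromℕ (suc k)) (ℚ.toℚᵘ-fromℚᵘ (mkℚᵘ (+ n) k)))
  (ℚᵘ.≃-trans (*≡* (trans (ℤ.*-identityʳ _) (trans (ℤ.*-comm (+ suc k) (+ n)) (cong (+ n ℤ.*_) (cong (λ z → + suc z) (sym (ℕ.+-identityʳ k)))))))
  (ℚᵘ.≃-sym (toℚᵘ-fromℕ n)))))

*-nonneg : ∀ {x y} → 0ℚ ≤ x → 0ℚ ≤ y → 0ℚ ≤ x * y
*-nonneg {x} {y} 0≤x 0≤y = subst (_≤ x * y) (ℚ.*-zeroʳ x) (ℚ.*-monoˡ-≤-nonNeg x {{nonNegative 0≤x}} 0≤y)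

*-mono-≤ : ∀ {x x′ y y′} → 0ℚ ≤ x → 0ℚ ≤ y′ → x ≤ x′ → y ≤ y′ → x * y ≤ x′ * y′
*-mono-≤ {x} {x′} {y} {y′} 0≤x 0≤y′ x≤x′ y≤y′ = ℚ.≤-trans
  (ℚ.*-monoˡ-≤-nonNeg x {{nonNegative 0≤x}} y≤y′) (ℚ.*-monoʳ-≤-nonNeg y′ {{nonNegative 0≤y′}} x≤x′)

^-nonneg : ∀ {x} n → 0ℚ ≤ x → 0ℚ ≤ x ^ n
^-nonneg ℕ.zero  0≤x = 0≤fromℕ 1
^-nonneg (suc n) 0≤x = *-nonneg 0≤x (^-nonneg n 0≤x)

^-mono-< : ∀ {x y} n → 0ℚ ≤ x → x < y → x ^ suc n < y ^ suc n
^-mono-< {x} {y} ℕ.zero  0≤x x<y = subst₂ _<_ (sym (ℚ.*-identityʳ x)) (sym (ℚ.*-identityʳ y)) x<y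
^-mono-< {x} {y} (suc n) 0≤x x<y = ℚ.≤-<-trans
  (ℚ.*-monoˡ-≤-nonNeg x {{nonNegative 0≤x}} (ℚ.<⇒≤ xⁿ<yⁿ))
  (ℚ.*-monoˡ-<-pos (y ^ suc n) {{positive (ℚ.≤-<-trans (^-nonneg (suc n) 0≤x) xⁿ<yⁿ)}} x<y)
  where xⁿ<yⁿ = ^-mono-< n 0≤x x<y

-- The contrapositive of strict monotonicity; it takes the place of extracting a root.
^-cancel-≤ : ∀ {x y} n → 0ℚ ≤ y → x ^ suc n ≤ y ^ suc n → x ≤ y
^-cancel-≤ n 0≤y xⁿ≤yⁿ = ℚ.≮⇒≥ λ y<x → ℚ.<-irrefl refl (ℚ.<-≤-trans (^-mono-< n 0≤y y<x) xⁿ≤yⁿ)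

-- Division of the bound for the poor conics by q, with 4 raised to 18 so that both terms carry the
-- same constant.
linear-part : ∀ q .{{_ : ℕ.NonZero q}} N M I₁ → q ℕ.* I₁ ℕ.≤ (4 ℕ.* N ℕ.+ 18 ℕ.* q) ℕ.* M →
  fromℕ I₁ ≤ fromℕ 18 * ((+ (N ℕ.* M)) / q + fromℕ M)
linear-part q N M I₁ h = ℚ.*-cancelˡ-≤-pos (fromℕ q)
  {{positive (fromℕ-mono-< {0} {q} (ℕ.>-nonZero⁻¹ q))}} (begin
  fromℕ q * fromℕ I₁                                   ≡⟨ fromℕ-* q I₁ ⟨
  fromℕ (q ℕ.* I₁)                                     ≤⟨ fromℕ-mono-≤ {q ℕ.* I₁} {18 ℕ.* (N ℕ.* M ℕ.+ q ℕ.* M)} (ℕ.≤-trans h enlarge) ⟩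
  fromℕ (18 ℕ.* (N ℕ.* M ℕ.+ q ℕ.* M))                 ≡⟨ trans (fromℕ-* 18 (N ℕ.* M ℕ.+ q ℕ.* M)) (cong (fromℕ 18 *_)
                                                           (trans (fromℕ-+ (N ℕ.* M) (q ℕ.* M)) (cong₂ _+_ (sym (fromℕ-quotient q (N ℕ.* M))) (fromℕ-* q M)))) ⟩
  fromℕ 18 * (fromℕ q * x + fromℕ q * fromℕ M)         ≡⟨ cong (fromℕ 18 *_) (ℚ.*-distribˡ-+ (fromℕ q) x (fromℕ M)) ⟨
  fromℕ 18 * (fromℕ q * (x + fromℕ M))                 ≡⟨ swap (fromℕ 18) (fromℕ q) (x + fromℕ M) ⟩
  fromℕ q * (fromℕ 18 * (x + fromℕ M))                 ∎)
  where
  open ℚ.≤-Reasoning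
  x = (+ (N ℕ.* M)) / q
  swap : ∀ a b c → a * (b * c) ≡ b * (a * c)
  swap a b c = trans (sym (ℚ.*-assoc a b c)) (trans (cong (_* c) (ℚ.*-comm a b)) (ℚ.*-assoc b a c))
  enlarge : (4 ℕ.* N ℕ.+ 18 ℕ.* q) ℕ.* M ℕ.≤ 18 ℕ.* (N ℕ.* M ℕ.+ q ℕ.* M)
  enlarge = ℕ.≤-trans (ℕ.*-monoˡ-≤ M (ℕ.+-monoˡ-≤ (18 ℕ.* q) (ℕ.*-monoˡ-≤ N (ℕ.m≤m+n 4 14))))
    (ℕ.≤-reflexive (regroup 18 N q M))
    where
    regroup : ∀ k N q M → (k ℕ.* N ℕ.+ k ℕ.* q) ℕ.* M ≡ k ℕ.* (N ℕ.* M ℕ.+ q ℕ.* M)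
    regroup = solve-∀

-- The hypotheses say q ≤ α⁵, N⁴ ≤ β⁵ and M⁴ ≤ γ⁵, and 32 = 2⁵, so both sides can be compared after
-- raising them to the fifth power.
root-part : ∀ q N M I₂ {α β γ} →
  q ^⟨ 1 / 5 ⟩≤ α → N ^⟨ 4 / 5 ⟩≤ β → M ^⟨ 4 / 5 ⟩≤ γ →
  I₂ ℕ.^ 5 ℕ.≤ 32 ℕ.* (q ℕ.^ 1 ℕ.* N ℕ.^ 4 ℕ.* M ℕ.^ 4) → fromℕ I₂ ≤ fromℕ 2 * (α * β * γ)
root-part q N M I₂ {α} {β} {γ} (0≤α , q≤) (0≤β , N≤) (0≤γ , M≤) h = ^-cancel-≤ 4
  (*-nonneg (0≤fromℕ 2) (*-nonneg (*-nonneg 0≤α 0≤β) 0≤γ)) (begin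
  fromℕ I₂ ^ 5                                                      ≡⟨ fromℕ-^ I₂ 5 ⟨
  fromℕ (I₂ ℕ.^ 5)                                                  ≤⟨ fromℕ-mono-≤ {I₂ ℕ.^ 5} {32 ℕ.* (q ℕ.^ 1 ℕ.* N ℕ.^ 4 ℕ.* M ℕ.^ 4)} h ⟩
  fromℕ (32 ℕ.* (q ℕ.^ 1 ℕ.* N ℕ.^ 4 ℕ.* M ℕ.^ 4))                  ≡⟨ trans (fromℕ-* 32 (q ℕ.^ 1 ℕ.* N ℕ.^ 4 ℕ.* M ℕ.^ 4)) (cong (fromℕ 32 *_)
                                                                        (trans (fromℕ-* (q ℕ.^ 1 ℕ.* N ℕ.^ 4) (M ℕ.^ 4)) (cong (_* fromℕ (M ℕ.^ 4)) (fromℕ-* (q ℕ.^ 1) (N ℕ.^ 4))))) ⟩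
  fromℕ 32 * (fromℕ (q ℕ.^ 1) * fromℕ (N ℕ.^ 4) * fromℕ (M ℕ.^ 4))  ≤⟨ ℚ.*-monoˡ-≤-nonNeg (fromℕ 32) (*-mono-≤
                                                                        (*-nonneg (0≤fromℕ (q ℕ.^ 1)) (0≤fromℕ (N ℕ.^ 4))) (^-nonneg 5 0≤γ)
                                                                        (*-mono-≤ (0≤fromℕ (q ℕ.^ 1)) (^-nonneg 5 0≤β) q≤ N≤) M≤) ⟩
  fromℕ 2 ^ 5 * (α ^ 5 * β ^ 5 * γ ^ 5)                             ≡⟨ cong (fromℕ 2 ^ 5 *_) (trans (^-distrib-* (α * β) γ 5) (cong (_* γ ^ 5) (^-distrib-* α β 5))) ⟨
  fromℕ 2 ^ 5 * (α * β * γ) ^ 5                                     ≡⟨ ^-distrib-* (fromℕ 2) (α * β * γ) 5 ⟨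
  (fromℕ 2 * (α * β * γ)) ^ 5                                       ∎)
  where open ℚ.≤-Reasoning

theorem1p5 : ∃[ K ] (0ℚ < K ×
    ((q : ℕ) .{{_ : ℕ.NonZero q}} → IsPrimePower q → (F : FiniteField q) →
    let open Plane F in
    (𝓟 : FiniteSubset pointSetoid) (𝓒 : FiniteSubset conicSetoid) →
    (α β γ : ℚ) →
    q ^⟨ 1 / 5 ⟩≤ α → ∣ 𝓟 ∣ ^⟨ 4 / 5 ⟩≤ β → ∣ 𝓒 ∣ ^⟨ 4 / 5 ⟩≤ γ →
    fromℕ (I 𝓟 𝓒) ≤
    K * ((+ (∣ 𝓟 ∣ ℕ.* ∣ 𝓒 ∣)) / q + α * β * γ + fromℕ ∣ 𝓒 ∣)))
-- 18 comes from the threshold for rich conics; the rich conics themselves need only the constant 2.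
theorem1p5 = fromℕ 18 , fromℕ-mono-< {0} {18} (ℕ.m≤m+n 1 17) , bound
  where
  bound : (q : ℕ) .{{_ : ℕ.NonZero q}} → IsPrimePower q → (F : FiniteField q) →
    let open Plane F in
    (𝓟 : FiniteSubset pointSetoid) (𝓒 : FiniteSubset conicSetoid) →
    (α β γ : ℚ) →
    q ^⟨ 1 / 5 ⟩≤ α → ∣ 𝓟 ∣ ^⟨ 4 / 5 ⟩≤ β → ∣ 𝓒 ∣ ^⟨ 4 / 5 ⟩≤ γ →
    fromℕ (I 𝓟 𝓒) ≤
    fromℕ 18 * ((+ (∣ 𝓟 ∣ ℕ.* ∣ 𝓒 ∣)) / q + α * β * γ + fromℕ ∣ 𝓒 ∣)
  bound q _ F 𝓟 𝓒 α β γ hα hβ hγ = combine (PlaneCounting.incidences F 𝓟 𝓒)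
    where
    N = ∣ 𝓟 ∣
    M = ∣ 𝓒 ∣
    x = (+ (N ℕ.* M)) / q
    y = α * β * γ
    0≤y : 0ℚ ≤ y
    0≤y = *-nonneg (*-nonneg (proj₁ hα) (proj₁ hβ)) (proj₁ hγ)
    powers : ∀ I₂ → I₂ ℕ.* I₂ ℕ.* I₂ ℕ.* I₂ ℕ.* I₂ ℕ.≤ 32 ℕ.* (q ℕ.* (N ℕ.* N ℕ.* N ℕ.* N) ℕ.* (M ℕ.* M ℕ.* M ℕ.* M)) →
      I₂ ℕ.^ 5 ℕ.≤ 32 ℕ.* (q ℕ.^ 1 ℕ.* N ℕ.^ 4 ℕ.* M ℕ.^ 4)
    powers I₂ = subst₂ ℕ._≤_ (fifth I₂) (cong (32 ℕ.*_) (cong₂ ℕ._*_ (cong₂ ℕ._*_ (sym (ℕ.*-identityʳ q)) (fourth N)) (fourth M)))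
      where
      fourth : ∀ n → n ℕ.* n ℕ.* n ℕ.* n ≡ n ℕ.* (n ℕ.* (n ℕ.* (n ℕ.* 1)))
      fourth = solve-∀
      fifth : ∀ n → n ℕ.* n ℕ.* n ℕ.* n ℕ.* n ≡ n ℕ.* (n ℕ.* (n ℕ.* (n ℕ.* (n ℕ.* 1))))
      fifth = solve-∀
    combine : _ → fromℕ (Plane.I F 𝓟 𝓒) ≤ fromℕ 18 * (x + y + fromℕ M)
    combine (I₁ , I₂ , I≡ , h₁ , h₂) = begin
      fromℕ (Plane.I F 𝓟 𝓒)                     ≡⟨ trans (cong fromℕ I≡) (fromℕ-+ I₁ I₂) ⟩
      fromℕ I₁ + fromℕ I₂                       ≤⟨ ℚ.+-mono-≤ (linear-part q N M I₁ h₁) (ℚ.≤-trans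
                                                     (root-part q N M I₂ hα hβ hγ (powers I₂ h₂))
                                                     (ℚ.*-monoʳ-≤-nonNeg y {{nonNegative 0≤y}} (fromℕ-mono-≤ {2} {18} (ℕ.m≤m+n 2 16)))) ⟩
      fromℕ 18 * (x + fromℕ M) + fromℕ 18 * y   ≡⟨ ℚ.*-distribˡ-+ (fromℕ 18) (x + fromℕ M) y ⟨
      fromℕ 18 * (x + fromℕ M + y)              ≡⟨ cong (fromℕ 18 *_) (trans (ℚ.+-assoc x (fromℕ M) y)
                                                     (trans (cong (λ z → x + z) (ℚ.+-comm (fromℕ M) y)) (sym (ℚ.+-assoc x y (fromℕ M))))) ⟩
      fromℕ 18 * (x + y + fromℕ M)              ∎
      where open ℚ.≤-Reasoning
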